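{- Let $r=p^{t}$ for a prime $p$ and a positive integer $t$. Let $\mathcal{S}$ be an $r$-uniform hypergraph, either without multiplicities or with multiplicities, and let $\mathrm{B}(\mathcal{S})$ denote its box complex. Suppose that $\widetilde H^{i}(\mathrm{B}(\mathcal{S});\mathbb{Z}_{p}) = 0$ for all $i \leq \ell$. Then \[ \chi(\mathcal{S}) \geq \left\lceil \frac{\ell + 2}{r-1} \right\rceil . \]
   Context: An $r$-multisubset of $[n]=\{1,\dots,n\}$ is a collection $\{\!\{x_1,\dots,x_r\}\!\}$ of elements of $[n]$ (repetitions allowed) such that the set $\{x_1,\dots,x_r\}$ has at least two elements. An $r$-uniform hypergraph without multiplicities has node set $V=[n]$ and a set $E$ of $r$-element subsets of $[n]$ as hyperedges (every node lies in some hyperedge); an $r$-uniform hypergraph with multiplicities has node set $V=[n]$ and a set $E$ of $r$-multisubsets of $[n]$ as hyperedges (every node lies in some hyperedge). A colouring with $m$ colours is a map $c:V\to[m]$ such that no hyperedge is monochromatic, i.e. $|\{c(x): x\in e\}|\ge 2$ for every $e\in E$; $\chi(\mathcal{S})$ is the least such $m$. The box complex $\mathrm{B}(\mathcal{S})$ is the simplicial complex on the vertex set $V\uplus\cdots\uplus V$ ($r$ disjoint copies of $V$) whose simplices are $U_1\uplus\cdots\uplus U_r$ with $U_i\subseteq V$, $\bigcup_i U_i\neq\emptyset$, and such that if all $U_i$ are nonempty then for every choice $u_i\in U_i$ ($1\le i\le r$) the set $\{u_1,\dots,u_r\}$ (resp. the multiset $\{\!\{u_1,\dots,u_r\}\!\}$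 in the case with multiplicities) is a hyperedge of $\mathcal{S}$. Cohomology is of the geometric realization, with $\mathbb{Z}_p$ coefficients. -}

module Defs where

open import Data.Nat as ℕ using (ℕ; zero; suc; _+_; _≤_; _<_; _/_)
open import Data.Integer as ℤ using (ℤ; +_; -_) renaming (_+_ to _+ℤ_; _-_ to _-ℤ_)
open import Data.Integer.Divisibility renaming (_∣_ to _∣ℤ_)
open import Data.Fin as Fin using (Fin; toℕ)
open import Data.Vec using (Vec; []; _∷_; removeAt; lookup; tabulate; sum)
open import Data.Vec.Membership.Propositional using (_∈_)
open import Data.Product using (_×_; _,_; ∃; ∃₂)
open import Relation.Binary.PropositionalEquality using (_≡_; _≢_)
open import Relation.Nullary using (yes; no)
open import Data.Sum using (_⊎_)

-- Hypergraphs on [n] = Fin n.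
-- A multisubset of Fin n is encoded by its vector of multiplicities
-- (Vec ℕ n).  An r-multisubset has total multiplicity r and at least two
-- distinct elements.  A hypergraph "without multiplicities" is the special
-- case in which every hyperedge has all multiplicities ≤ 1 (see
-- WithoutMultiplicities below); the general record covers both cases.

record Hypergraph (n r : ℕ) : Set₁ where
  field
    Edge         : Vec ℕ n → Set
    edge-size    : ∀ {e} → Edge e → sum e ≡ r
    edge-two     : ∀ {e} → Edge e →
                   ∃₂ λ x y → x ≢ y × 1 ≤ lookup e x × 1 ≤ lookup e y
    covers       : ∀ (x : Fin n) → ∃ λ e → Edge e × 1 ≤ lookup e x
open Hypergraph public

WithoutMultiplicities : ∀ {n r} → Hypergraph n r → Set
WithoutMultiplicities {n} H = ∀ e → Edge H e → (x : Fin n) → lookup e x ≤ 1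

ProperColouring : ∀ {n r m} → Hypergraph n r → (Fin n → Fin m) → Set
ProperColouring H c =
  ∀ e → Edge H e → ∃₂ λ x y → 1 ≤ lookup e x × 1 ≤ lookup e y × c x ≢ c y

BoxVertex : ℕ → ℕ → Set
BoxVertex n r = Fin r × Fin n

_<V_ : ∀ {n r} → BoxVertex n r → BoxVertex n r → Set
(i , v) <V (j , w) = (toℕ i < toℕ j) ⊎ (i ≡ j × toℕ v < toℕ w)

data Increasing {n r} : ∀ {k} → Vec (BoxVertex n r) k → Set where
  inc-[]  : Increasing []
  inc-[_] : ∀ a → Increasing (a ∷ [])
  inc-∷   : ∀ {k} {a b} {xs : Vec (BoxVertex n r) k} →
            a <V b → Increasing (b ∷ xs) → Increasing (a ∷ b ∷ xs)

multisetOf : ∀ {n r} → (Fin r → Fin n) → Vec ℕ n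
multisetOf {n} {r} u = tabulate λ v → count r u v
  where
  count : (k : ℕ) → (Fin k → Fin n) → Fin n → ℕ
  count zero    u v = 0
  count (suc k) u v with u Fin.zero Fin.≟ v
  ... | yes _ = suc (count k (λ i → u (Fin.suc i)) v)
  ... | no  _ = count k (λ i → u (Fin.suc i)) v

BoxCondition : ∀ {n r k} → Hypergraph n r → Vec (BoxVertex n r) k → Set
BoxCondition {n} {r} H σ =
  (∀ (i : Fin r) → ∃ λ (v : Fin n) → (i , v) ∈ σ) →
  ∀ (u : Fin r → Fin n) → (∀ i → (i , u i) ∈ σ) → Edge H (multisetOf u)

-- Ordered simplices of the AUGMENTED box complex, indexed by the number k
-- of vertices: k = 0 is the empty simplex (augmentation, degree -1), and
-- for k ≥ 1 these are the (k-1)-simplices of B(H), listed in increasing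
-- order (so the union of the U_i is nonempty).
Simplex : ∀ {n r} → Hypergraph n r → (k : ℕ) → Vec (BoxVertex n r) k → Set
Simplex H zero    σ = Increasing σ
Simplex H (suc k) σ = Increasing σ × BoxCondition H σ

-- Simplicial cochains with ℤ_p coefficients: a cochain is a function to ℤ
-- considered modulo p, and only its values on simplices matter.

Cochain : ℕ → ℕ → ℕ → Set
Cochain n r k = Vec (BoxVertex n r) k → ℤ

_≡_[mod_] : ℤ → ℤ → ℕ → Set
a ≡ b [mod p ] = (+ p) ∣ℤ (a -ℤ b)

sumFin : (k : ℕ) → (Fin k → ℤ) → ℤ
sumFin zero    f = + 0
sumFin (suc k) f = f Fin.zero +ℤ sumFin k (λ j → f (Fin.suc j))

sign : ℕ → ℤ → ℤ
sign zero          a = a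
sign (suc zero)    a = - a
sign (suc (suc j)) a = sign j a

δ : ∀ {n r k} → Cochain n r k → Cochain n r (suc k)
δ {k = k} f σ = sumFin (suc k) λ j → sign (toℕ j) (f (removeAt σ j))

Cocycle : ∀ {n r} → ℕ → Hypergraph n r → (k : ℕ) → Cochain n r k → Set
Cocycle p H k f = ∀ σ → Simplex H (suc k) σ → δ f σ ≡ + 0 [mod p ]

Coboundary : ∀ {n r} → ℕ → Hypergraph n r → (k : ℕ) → Cochain n r k → Set
Coboundary p H zero    f = ∀ σ → Simplex H zero σ → f σ ≡ + 0 [mod p ]
Coboundary {n} {r} p H (suc k) f =
  ∃ λ (g : Cochain n r k) → ∀ σ → Simplex H (suc k) σ → f σ ≡ δ g σ [mod p ]

-- H̃^(k-1)(B(H); ℤ_p) = 0   (k = 0 is degree -1)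
ReducedCohomologyVanishes : ∀ {n r} → ℕ → Hypergraph n r → ℕ → Set
ReducedCohomologyVanishes {n} {r} p H k =
  ∀ (f : Cochain n r k) → Cocycle p H k f → Coboundary p H k f

-- ceiling division ⌈ a / b ⌉ (b = 0 is never used; returns 0)
⌈_/_⌉ : ℕ → ℕ → ℕ
⌈ a / zero  ⌉ = 0
⌈ a / suc b ⌉ = (a + b) / suc b

{-# OPTIONS --safe #-}
-- Let r = p ^ t and G = (ℤ/p)^t, which acts on the box complex by permuting
-- the r copies of the vertex set. The product over all pairs of entries of the
-- first nonzero coordinate of their difference is an alternating G-invariant
-- cocycle e on r-tuples of elements of G (the Euler class of the reduced
-- regular representation). Pull its m-th cup power back to the tuples of box
-- vertices lying in a simplex and having increasing colours. Such a tuple of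
-- m (r - 1) + 1 vertices consists of m blocks of r vertices, one of which is
-- monochromatic; as the colouring is proper, the block misses an element of G,
-- so it contains a repetition and e vanishes on it. If the cohomology of the
-- box complex vanishes below degree m (r - 1), a zigzag in the double complex
-- of the box complex and of the tensor product of t periodic resolutions of ℤ/p
-- then shows that all coefficients of the class of e^m in H^*(G; ℤ/p) are zero.
-- But its lexicographically leading coefficient is not: it is a signed sum over
-- walks in G, and counting steps shows that only those walks contribute which
-- in each block traverse the cosets of (ℤ/p)^(t-1) one after the other, so that
-- it is a product of such coefficients for ℤ/p and for (ℤ/p)^(t-1).
module Submission where

open import Defs
open import Data.Nat as ℕ using (ℕ; zero; suc; _+_; _*_; _∸_; _^_; _≤_; _<_; z≤n; s≤s)
import Data.Nat.Properties as ℕ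
import Data.Nat.Tactic.RingSolver as ℕSolver
open import Data.Nat.DivMod using (_%_; _/_; m%n<n; m<n⇒m%n≡m; m%n%n≡m%n; [m+n]%n≡m%n; %-distribˡ-+; m≡m%n+[m/n]*n; m<n*o⇒m/o<n)
open import Data.Nat.Divisibility using (divides; ∣⇒≤) renaming (_∣_ to _∣ℕ_)
import Data.Nat.Primality as Primality
open import Data.Nat.Primality using (Prime; euclidsLemma)
open import Data.Integer as ℤ using (ℤ; +_; 0ℤ; 1ℤ)
import Data.Integer.Divisibility.Signed as Signed
open import Data.Integer.Divisibility.Signed using (∣ᵤ⇒∣)
import Data.Integer.Properties as ℤ
open import Data.Integer.Tactic.RingSolver using (solve-∀)
open import Data.Fin as Fin using (Fin; toℕ; fromℕ<; combine; remQuot)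
import Data.Fin.Permutation as Permutation
import Data.Fin.Properties as Fin
import Data.List.Base as List
open import Data.List.Base using (List; []; _∷_; _++_; length; map)
open import Data.List.Membership.DecPropositional as DecMembership using ()
open import Data.List.Membership.Propositional using (_∈_; _∉_)
open import Data.List.Membership.Propositional.Properties using (∈-++⁺ʳ; ∈-++⁺ˡ; ∈-++⁻; ∈-map⁺; ∈-map⁻; ∈-lookup)
open import Data.List.Properties using (++-assoc; length-map; length-++; map-id; map-∘; map-cong)
import Data.List.Relation.Unary.All as All
open import Data.List.Relation.Unary.All using (All; []; _∷_)
import Data.List.Relation.Unary.All.Properties as All
open import Data.List.Relation.Unary.Any using (here; there)
open import Data.Vec.Base as Vec using (Vec; []; _∷_; toList; fromList; lookup; removeAt)
open import Data.Vec.Membership.Propositional.Properties using (∈-toList⁺; ∈-toList⁻)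
open import Data.Vec.Properties using (lookup∘tabulate; tabulate∘lookup; tabulate-cong; toList∘fromList; length-toList; toList-injective; cast-is-id)
open import Data.Vec.Relation.Binary.Pointwise.Inductive as Pointwise using (Pointwise; []; _∷_)
import Data.Vec.Relation.Unary.All.Properties as VAll
open import Data.Vec.Relation.Unary.All as VAll using ([]; _∷_)
open import Data.Product using (_×_; _,_; ∃; Σ; proj₁; proj₂; map₂)
open import Data.Product.Properties using (≡-dec)
open import Data.Sum using (_⊎_; inj₁; inj₂)
open import Data.Unit using (⊤; tt)
open import Data.Empty using (⊥-elim)
open import Algebra.Properties.CommutativeMonoid.Sum ℕ.+-0-commutativeMonoid using (sum-permute) renaming (sum to sumℕ)
open import Relation.Nullary using (¬_; Dec; yes; no; contradiction)
open import Relation.Binary.Bundles using (Setoid)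
open import Relation.Binary.Definitions using (DecidableEquality; Tri; tri<; tri≈; tri>)
open import Relation.Binary.PropositionalEquality
import Relation.Binary.Reasoning.Setoid as SetoidReasoning

-- The obstacle is that G respects no order of the vertices, while the hypothesis speaks of
-- increasing simplices. Hence cochains live on arbitrary tuples, where G acts entrywise, and signed
-- sorting carries acyclicity over from increasing simplices. The same sorting operator, applied to
-- colours, is a chain map commuting with G; it lets ω be read only on colour-increasing tuples. No
-- cohomology group is formed. Prefixing a base point contracts the tuples in G, so repeatedly
-- applying `D` and prefixing gives families with ∂ X₀ = pullback of ω = 0 and ∂ X₍q+1₎ = D X₍q₎ on
-- the box complex. Solving these equations from tuples of length m (r - 1) down to length 0 ends at
-- the empty tuple. It is fixed by G, so `D` vanishes there modulo p and the last X is zero. By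
-- construction this number is also a coefficient of e^m, and unwinding the cones turns it into a
-- sum over walks. The exponents m P, m P p, m P p², ... of the chosen monomial (p = P + 1) are
-- those of the diagonal term of a power of the Moore determinant; they add up to m (r - 1).

infixl 6 _⊕_ _⊖_
infixl 7 _⊗_
infix  8 ⊝_

-- Integer arithmetic is kept opaque: the library operations unfold into sign
-- and magnitude, which blocks the inference of implicit arguments.
opaque
  _⊕_ _⊗_ _⊖_ : ℤ → ℤ → ℤ
  _⊕_ = ℤ._+_
  _⊗_ = ℤ._*_
  _⊖_ = ℤ._-_
  ⊝_ : ℤ → ℤ
  ⊝_ = ℤ.-_

-- Ring identities for the opaque operations.

opaque
  unfolding _⊕_ _⊗_ _⊖_ ⊝_

  ⊕-zero : 0ℤ ⊕ 0ℤ ≡ 0ℤ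
  ⊕-zero = refl

  ⊖-zero : 0ℤ ⊖ 0ℤ ≡ 0ℤ
  ⊖-zero = refl

  ⊝-zero : ⊝ 0ℤ ≡ 0ℤ
  ⊝-zero = refl

  ⊕-identityˡ : ∀ a → 0ℤ ⊕ a ≡ a
  ⊕-identityˡ = ℤ.+-identityˡ

  ⊕-identityʳ : ∀ a → a ⊕ 0ℤ ≡ a
  ⊕-identityʳ = ℤ.+-identityʳ

  ⊖-identityʳ : ∀ a → a ⊖ 0ℤ ≡ a
  ⊖-identityʳ = ℤ.+-identityʳ

  ⊖-inverse : ∀ a → a ⊖ a ≡ 0ℤ
  ⊖-inverse = ℤ.+-inverseʳ

  ⊗-zeroˡ : ∀ a → 0ℤ ⊗ a ≡ 0ℤ
  ⊗-zeroˡ = ℤ.*-zeroˡ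

  ⊗-zeroʳ : ∀ a → a ⊗ 0ℤ ≡ 0ℤ
  ⊗-zeroʳ = ℤ.*-zeroʳ

  ⊗-identityˡ : ∀ a → 1ℤ ⊗ a ≡ a
  ⊗-identityˡ = ℤ.*-identityˡ

  ⊗-identityʳ : ∀ a → a ⊗ 1ℤ ≡ a
  ⊗-identityʳ = ℤ.*-identityʳ

  ⊗-comm : ∀ a b → a ⊗ b ≡ b ⊗ a
  ⊗-comm = ℤ.*-comm

  ⊗-assoc : ∀ a b c → (a ⊗ b) ⊗ c ≡ a ⊗ (b ⊗ c)
  ⊗-assoc = ℤ.*-assoc

  ⊕-comm : ∀ a b → a ⊕ b ≡ b ⊕ a
  ⊕-comm = ℤ.+-comm

  multiple-refl : ∀ a q → a ≡ a ⊕ 0ℤ ⊗ q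
  multiple-refl = solve-∀

  multiple-sym : ∀ b k q → b ≡ b ⊕ k ⊗ q ⊕ (⊝ k) ⊗ q
  multiple-sym = solve-∀

  multiple-trans : ∀ c k l q → c ⊕ l ⊗ q ⊕ k ⊗ q ≡ c ⊕ (k ⊕ l) ⊗ q
  multiple-trans = solve-∀

  multiple-⊕ : ∀ a b k l q → (a ⊕ k ⊗ q) ⊕ (b ⊕ l ⊗ q) ≡ (a ⊕ b) ⊕ (k ⊕ l) ⊗ q
  multiple-⊕ = solve-∀

  multiple-⊖ : ∀ a b k l q → (a ⊕ k ⊗ q) ⊖ (b ⊕ l ⊗ q) ≡ (a ⊖ b) ⊕ (k ⊖ l) ⊗ q
  multiple-⊖ = solve-∀

  multiple-⊗ : ∀ a b k l q → (a ⊕ k ⊗ q) ⊗ (b ⊕ l ⊗ q) ≡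
               (a ⊗ b) ⊕ (k ⊗ b ⊕ a ⊗ l ⊕ k ⊗ l ⊗ q) ⊗ q
  multiple-⊗ = solve-∀

  multiple-⊝ : ∀ a k q → ⊝ (a ⊕ k ⊗ q) ≡ ⊝ a ⊕ (⊝ k) ⊗ q
  multiple-⊝ = solve-∀

  ⊖-⊖-comm : ∀ a b c d → (a ⊖ b) ⊖ (c ⊖ d) ≡ (a ⊖ c) ⊖ (b ⊖ d)
  ⊖-⊖-comm = solve-∀

  ⊕-⊖-comm : ∀ a b c d → (a ⊕ b) ⊖ (c ⊕ d) ≡ (a ⊖ c) ⊕ (b ⊖ d)
  ⊕-⊖-comm = solve-∀

  ⊕-⊕-comm : ∀ a b c d → (a ⊕ b) ⊕ (c ⊕ d) ≡ (a ⊕ c) ⊕ (b ⊕ d)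
  ⊕-⊕-comm = solve-∀

  ⊝-distrib-⊖ : ∀ a b → ⊝ (a ⊖ b) ≡ ⊝ a ⊖ ⊝ b
  ⊝-distrib-⊖ = solve-∀

  ⊝-distrib-⊕ : ∀ a b → ⊝ (a ⊕ b) ≡ ⊝ a ⊕ ⊝ b
  ⊝-distrib-⊕ = solve-∀

  ⊗-distribˡ-⊖ : ∀ k a b → k ⊗ (a ⊖ b) ≡ k ⊗ a ⊖ k ⊗ b
  ⊗-distribˡ-⊖ = solve-∀

  ⊗-distribˡ-⊕ : ∀ k a b → k ⊗ (a ⊕ b) ≡ k ⊗ a ⊕ k ⊗ b
  ⊗-distribˡ-⊕ = solve-∀

  ⊖-⊖-cancel : ∀ a b → a ⊖ (a ⊖ b) ≡ b
  ⊖-⊖-cancel = solve-∀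

  ⊝-⊖-⊖ : ∀ a b c → ⊝ (a ⊖ (b ⊖ c)) ≡ b ⊖ (a ⊖ (⊝ c))
  ⊝-⊖-⊖ = solve-∀

  homotopy-cancel : ∀ a f d s S → a ⊕ ((f ⊖ d) ⊖ (s ⊖ S) ⊖ (a ⊖ (d ⊖ S))) ≡ f ⊖ s
  homotopy-cancel = solve-∀

  ⊖-⊕-cancel : ∀ a b → b ⊕ (a ⊖ b) ≡ a
  ⊖-⊕-cancel = solve-∀

  ⊕-⊖-cancel : ∀ a b → (a ⊕ b) ⊖ a ≡ b
  ⊕-⊖-cancel = solve-∀

  leibniz-base : ∀ a b g d → (a ⊖ (b ⊖ 0ℤ)) ⊗ g ⊕ 1ℤ ⊗ (b ⊗ (g ⊖ d)) ≡ a ⊗ g ⊖ b ⊗ d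
  leibniz-base = solve-∀

  leibniz-nil : ∀ b → 0ℤ ⊖ b ⊗ 0ℤ ≡ 0ℤ ⊕ 1ℤ ⊗ (b ⊗ (0ℤ ⊖ 0ℤ))
  leibniz-nil = solve-∀

  leibniz-step : ∀ a b s c → a ⊖ (b ⊕ s ⊗ c) ≡ (a ⊖ b) ⊕ (⊝ s) ⊗ c
  leibniz-step = solve-∀

  ⊗-distribʳ-⊖ : ∀ k a b → (a ⊖ b) ⊗ k ≡ a ⊗ k ⊖ b ⊗ k
  ⊗-distribʳ-⊖ = solve-∀

  ⊗-⊗-swap : ∀ a b c → a ⊗ (b ⊗ c) ≡ b ⊗ (a ⊗ c)
  ⊗-⊗-swap = solve-∀

  telescope : ∀ a b c → (b ⊖ a) ⊕ (c ⊖ b) ≡ c ⊖ a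
  telescope = solve-∀

  shift-step : ∀ a b x y z → x ⊕ b ≡ y ⊕ z → (b ⊕ x) ⊕ a ≡ (a ⊕ y) ⊕ z
  shift-step a b x y z e = begin
    (b ⊕ x) ⊕ a ≡⟨ lemma₁ a b x ⟩
    (x ⊕ b) ⊕ a ≡⟨ cong (_⊕ a) e ⟩
    (y ⊕ z) ⊕ a ≡⟨ lemma₂ a y z ⟩
    (a ⊕ y) ⊕ z ∎
    where
    open ≡-Reasoning
    lemma₁ : ∀ a b x → (b ⊕ x) ⊕ a ≡ (x ⊕ b) ⊕ a
    lemma₁ = solve-∀
    lemma₂ : ∀ a y z → (y ⊕ z) ⊕ a ≡ (a ⊕ y) ⊕ z
    lemma₂ = solve-∀

  shift-⊖ : ∀ x y f → x ⊕ f ≡ y ⊕ f → x ⊖ y ≡ 0ℤ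
  shift-⊖ x y f e = begin
    x ⊖ y               ≡⟨ lemma x y f ⟩
    (x ⊕ f) ⊖ (y ⊕ f)   ≡⟨ cong (_⊖ (y ⊕ f)) e ⟩
    (y ⊕ f) ⊖ (y ⊕ f)   ≡⟨ ⊖-inverse (y ⊕ f) ⟩
    0ℤ                  ∎
    where
    open ≡-Reasoning
    lemma : ∀ x y f → x ⊖ y ≡ (x ⊕ f) ⊖ (y ⊕ f)
    lemma = solve-∀

  alternate-cancel : ∀ s y → (0ℤ ⊕ s ⊗ y) ⊕ (⊝ s) ⊗ (y ⊕ (⊝ s) ⊗ 0ℤ) ≡ 0ℤ
  alternate-cancel = solve-∀

  zeros : 0ℤ ⊕ 1ℤ ⊗ (0ℤ ⊕ 1ℤ ⊗ 0ℤ) ≡ 0ℤ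
  zeros = refl

  ⊗-suc : ∀ k a → + suc k ⊗ a ≡ a ⊕ + k ⊗ a
  ⊗-suc k a = ℤ.suc-* (+ k) a

  multiple-zero : ∀ q a → q ⊗ a ≡ 0ℤ ⊕ a ⊗ q
  multiple-zero = solve-∀

  ⊖-solve : ∀ a b → a ≡ (a ⊖ b) ⊕ b
  ⊖-solve = solve-∀

  ⊝-antisym : ∀ a b → b ⊖ a ≡ ⊝ (a ⊖ b)
  ⊝-antisym = solve-∀

  ⊝⊝-⊗ : ∀ a b → 0ℤ ⊖ (⊝ a) ⊗ b ≡ a ⊗ b
  ⊝⊝-⊗ = solve-∀

  sign-square : ∀ s a → (⊝ s) ⊗ ((⊝ s) ⊗ a) ≡ s ⊗ (s ⊗ a)
  sign-square = solve-∀

  move-id : ∀ k K s a → k ⊗ (K ⊗ (s ⊗ a)) ≡ (⊝ s) ⊗ (((⊝ k) ⊗ K) ⊗ a)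
  move-id = solve-∀

  ⊗-interchange′ : ∀ k K L a → (k ⊗ K) ⊗ (L ⊗ a) ≡ k ⊗ (L ⊗ (K ⊗ a))
  ⊗-interchange′ = solve-∀

  shift-difference : ∀ a b → (1ℤ ⊕ a) ⊖ (1ℤ ⊕ b) ≡ a ⊖ b
  shift-difference = solve-∀

  1⊖1 : 1ℤ ⊖ (1ℤ ⊖ 0ℤ) ≡ 0ℤ
  1⊖1 = refl

  ∣⊗∣ : ∀ a b → ℤ.∣ a ⊗ b ∣ ≡ ℤ.∣ a ∣ * ℤ.∣ b ∣
  ∣⊗∣ = ℤ.abs-*

  +-hom : ∀ a b → + (a + b) ≡ + a ⊕ + b
  +-hom a b = refl

  *-hom : ∀ a b → + (a * b) ≡ + a ⊗ + b
  *-hom = ℤ.pos-*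

  ∣⊖∣≤⊔ : ∀ a b → ℤ.∣ + a ⊖ + b ∣ ≤ a ℕ.⊔ b
  ∣⊖∣≤⊔ a b = subst (λ x → ℤ.∣ x ∣ ≤ a ℕ.⊔ b) (sym (ℤ.m-n≡m⊖n a b)) (ℤ.∣m⊝n∣≤m⊔n a b)

  ∣⊖∣≡0 : ∀ a b → ℤ.∣ + a ⊖ + b ∣ ≡ 0 → a ≡ b
  ∣⊖∣≡0 a b e = ℤ.+-injective (ℤ.i-j≡0⇒i≡j (+ a) (+ b) (ℤ.∣i∣≡0⇒i≡0 e))

  pairs-balanced : ∀ a b c d → a ⊗ b ⊗ (c ⊗ d) ≡ (⊝ a) ⊗ (⊝ c) ⊗ ((⊝ b) ⊗ (⊝ d))
  pairs-balanced = solve-∀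

  pair-swap : ∀ x k l m n y A B C D z →
    (x ⊗ (k ⊗ (l ⊗ A))) ⊗ ((m ⊗ (n ⊗ B)) ⊗ ((y ⊗ C) ⊗ (D ⊗ z))) ≡
    (k ⊗ l ⊗ (m ⊗ n)) ⊗ ((x ⊗ A) ⊗ (B ⊗ ((y ⊗ C) ⊗ (D ⊗ z))))
  pair-swap = solve-∀

  pair-swap′ : ∀ x k l m n y A B C D z →
    (y ⊗ (k ⊗ (l ⊗ C))) ⊗ ((m ⊗ (n ⊗ D)) ⊗ ((x ⊗ A) ⊗ (B ⊗ z))) ≡
    (k ⊗ l ⊗ (m ⊗ n)) ⊗ ((x ⊗ A) ⊗ (B ⊗ ((y ⊗ C) ⊗ (D ⊗ z))))
  pair-swap′ = solve-∀

  against-swap : ∀ a b c d k → a ⊗ (b ⊗ (c ⊗ (d ⊗ k))) ≡ c ⊗ (d ⊗ (a ⊗ (b ⊗ k)))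
  against-swap = solve-∀

  ⊗-⊗-comm : ∀ a b c d → (a ⊗ b) ⊗ (c ⊗ d) ≡ (a ⊗ c) ⊗ (b ⊗ d)
  ⊗-⊗-comm = solve-∀

  ∣⊝1∣ : ⊝ 1ℤ ≡ 1ℤ ⊕ (⊝ 1ℤ) ⊗ + 2
  ∣⊝1∣ = refl

  ∣-multiple : ∀ a p → p ∣ℕ ℤ.∣ a ∣ → ∃ λ k → a ≡ 0ℤ ⊕ k ⊗ + p
  ∣-multiple a p d with ∣ᵤ⇒∣ {+ p} {a} d
  ... | Signed.divides q e = q , trans e (sym (⊕-identityˡ _))

  pick-one : ∀ g → 1ℤ ⊗ g ⊕ 0ℤ ≡ g
  pick-one = solve-∀

  pick-none : ∀ g h → 0ℤ ⊗ g ⊕ h ≡ h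
  pick-none = solve-∀

  drop-zero : ∀ a s → a ⊕ s ⊗ 0ℤ ≡ a
  drop-zero = solve-∀

  two-terms : ∀ a → 0ℤ ⊕ (a ⊕ 0ℤ) ≡ a
  two-terms = solve-∀

  ⊖-injective : ∀ a b → a ⊖ b ≡ 0ℤ → a ≡ b
  ⊖-injective = ℤ.i-j≡0⇒i≡j

  hier-regroup : ∀ B C A T → (B ⊗ C) ⊗ (A ⊗ T) ≡ (C ⊗ A) ⊗ (B ⊗ T)
  hier-regroup = solve-∀

  column-step : ∀ a k B c G → (a ⊗ k) ⊗ ((B ⊗ c) ⊗ G) ≡ ((a ⊗ B) ⊗ (k ⊗ c)) ⊗ G
  column-step = solve-∀

  eval-down : ∀ s x A w T → 0ℤ ⊕ s ⊗ ((x ⊗ (A ⊗ T)) ⊗ w) ≡ (s ⊗ x) ⊗ (A ⊗ (w ⊗ T))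
  eval-down = solve-∀

  eval-factor : ∀ x A w T → x ⊗ (A ⊗ (w ⊗ T)) ≡ (x ⊗ (A ⊗ T)) ⊗ w
  eval-factor = solve-∀

  eval-across : ∀ A w e T s → (w ⊗ (e ⊗ T)) ⊗ A ⊕ s ⊗ 0ℤ ≡ 1ℤ ⊗ (A ⊗ ((e ⊗ w) ⊗ T))
  eval-across = solve-∀

  eval-across′ : ∀ A w K → 1ℤ ⊗ (A ⊗ (w ⊗ K)) ≡ (w ⊗ K) ⊗ A
  eval-across′ = solve-∀

  eval-block : ∀ a e T A w → (a ⊗ (e ⊗ T)) ⊗ (1ℤ ⊗ (A ⊗ (w ⊗ 1ℤ))) ≡ 1ℤ ⊗ ((a ⊗ A) ⊗ ((e ⊗ w) ⊗ T))
  eval-block = solve-∀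

  eval-base : ∀ a e T → (a ⊗ (e ⊗ T)) ⊗ 1ℤ ≡ 1ℤ ⊗ ((a ⊗ 1ℤ) ⊗ ((e ⊗ 1ℤ) ⊗ T))
  eval-base = solve-∀

  unit-product : ∀ x A w → x ⊗ (A ⊗ (w ⊗ 1ℤ)) ≡ x ⊗ (A ⊗ w)
  unit-product = solve-∀

  ⊝-⊗ : ∀ a b → ⊝ (a ⊗ b) ≡ a ⊗ (⊝ b)
  ⊝-⊗ = solve-∀

-- Congruence modulo p and cochains on tuples.

module Mod (p : ℕ) where

  infix 4 _≈_

  record _≈_ (a b : ℤ) : Set where
    constructor mod
    field
      quot : ℤ
      eq   : a ≡ b ⊕ quot ⊗ + p

  ≈-refl : ∀ {a} → a ≈ a
  ≈-refl {a} = mod 0ℤ (multiple-refl a (+ p))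

  ≈-reflexive : ∀ {a b} → a ≡ b → a ≈ b
  ≈-reflexive refl = ≈-refl

  ≈-sym : ∀ {a b} → a ≈ b → b ≈ a
  ≈-sym {b = b} (mod k refl) = mod (⊝ k) (multiple-sym b k (+ p))

  ≈-trans : ∀ {a b c} → a ≈ b → b ≈ c → a ≈ c
  ≈-trans {c = c} (mod k refl) (mod l refl) = mod (k ⊕ l) (multiple-trans c k l (+ p))

  +-cong : ∀ {a b c d} → a ≈ b → c ≈ d → a ⊕ c ≈ b ⊕ d
  +-cong {b = b} {d = d} (mod k refl) (mod l refl) = mod _ (multiple-⊕ b d k l (+ p))

  *-cong : ∀ {a b c d} → a ≈ b → c ≈ d → a ⊗ c ≈ b ⊗ d
  *-cong {b = b} {d = d} (mod k refl) (mod l refl) = mod _ (multiple-⊗ b d k l (+ p))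

  neg-cong : ∀ {a b} → a ≈ b → ⊝ a ≈ ⊝ b
  neg-cong {b = b} (mod k refl) = mod _ (multiple-⊝ b k (+ p))

  sub-cong : ∀ {a b c d} → a ≈ b → c ≈ d → a ⊖ c ≈ b ⊖ d
  sub-cong {b = b} {d = d} (mod k refl) (mod l refl) = mod _ (multiple-⊖ b d k l (+ p))

  ≈-setoid : Setoid _ _
  ≈-setoid = record
    { Carrier = ℤ ; _≈_ = _≈_
    ; isEquivalence = record { refl = ≈-refl ; sym = ≈-sym ; trans = ≈-trans } }

  open SetoidReasoning ≈-setoid public

  module _ {V : Set} where

    -- The alternating sum over deleted positions, unrolled at the first vertex. A cochain is a
    -- function on tuples of every length; the empty tuple carries the augmentation, so the complex
    -- is the reduced one.
    ∂ : (List V → ℤ) → List V → ℤ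
    ∂ f []      = 0ℤ
    ∂ f (v ∷ w) = f w ⊖ ∂ (λ u → f (v ∷ u)) w

    data Face : List V → List V → Set where
      here  : ∀ {v w} → Face w (v ∷ w)
      there : ∀ {v u w} → Face u w → Face (v ∷ u) (v ∷ w)

    Face-length : ∀ {u w} → Face u w → length w ≡ suc (length u)
    Face-length here      = refl
    Face-length (there x) = cong suc (Face-length x)

    Face-All : ∀ {P : V → Set} {u w} → Face u w → All P w → All P u
    Face-All here      (_ ∷ a) = a
    Face-All (there x) (b ∷ a) = b ∷ Face-All x a

    ∂-local : ∀ f g w → (∀ {u} → Face u w → f u ≈ g u) → ∂ f w ≈ ∂ g w
    ∂-local f g []      h = ≈-refl
    ∂-local f g (v ∷ w) h = sub-cong (h here) (∂-local _ _ w (λ x → h (there x)))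

    ∂-cong : ∀ {f g} → (∀ u → f u ≈ g u) → ∀ w → ∂ f w ≈ ∂ g w
    ∂-cong h w = ∂-local _ _ w (λ {u} _ → h u)

    ∂-zero : ∀ w → ∂ (λ _ → 0ℤ) w ≈ 0ℤ
    ∂-zero []      = ≈-refl
    ∂-zero (v ∷ w) = ≈-trans (sub-cong ≈-refl (∂-zero w)) (≈-reflexive ⊖-zero)

    ∂-vanish : ∀ f w → (∀ {u} → Face u w → f u ≈ 0ℤ) → ∂ f w ≈ 0ℤ
    ∂-vanish f w h = ≈-trans (∂-local f _ w h) (∂-zero w)

    ∂-sub : ∀ f g w → ∂ (λ u → f u ⊖ g u) w ≈ ∂ f w ⊖ ∂ g w
    ∂-sub f g []      = ≈-reflexive (sym ⊖-zero)
    ∂-sub f g (v ∷ w) = begin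
      (f w ⊖ g w) ⊖ ∂ (λ u → f (v ∷ u) ⊖ g (v ∷ u)) w
        ≈⟨ sub-cong ≈-refl (∂-sub _ _ w) ⟩
      (f w ⊖ g w) ⊖ (∂ (λ u → f (v ∷ u)) w ⊖ ∂ (λ u → g (v ∷ u)) w)
        ≡⟨ ⊖-⊖-comm (f w) _ _ _ ⟩
      ∂ f (v ∷ w) ⊖ ∂ g (v ∷ w) ∎

    ∂-add : ∀ f g w → ∂ (λ u → f u ⊕ g u) w ≈ ∂ f w ⊕ ∂ g w
    ∂-add f g []      = ≈-reflexive (sym ⊕-zero)
    ∂-add f g (v ∷ w) = begin
      (f w ⊕ g w) ⊖ ∂ (λ u → f (v ∷ u) ⊕ g (v ∷ u)) w
        ≈⟨ sub-cong ≈-refl (∂-add _ _ w) ⟩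
      (f w ⊕ g w) ⊖ (∂ (λ u → f (v ∷ u)) w ⊕ ∂ (λ u → g (v ∷ u)) w)
        ≡⟨ ⊕-⊖-comm (f w) _ _ _ ⟩
      ∂ f (v ∷ w) ⊕ ∂ g (v ∷ w) ∎

    ∂-scale : ∀ k f w → ∂ (λ u → k ⊗ f u) w ≈ k ⊗ ∂ f w
    ∂-scale k f []      = ≈-reflexive (sym (⊗-zeroʳ k))
    ∂-scale k f (v ∷ w) = begin
      k ⊗ f w ⊖ ∂ (λ u → k ⊗ f (v ∷ u)) w
        ≈⟨ sub-cong ≈-refl (∂-scale k _ w) ⟩
      k ⊗ f w ⊖ k ⊗ ∂ (λ u → f (v ∷ u)) w
        ≡⟨ sym (⊗-distribˡ-⊖ k (f w) _) ⟩
      k ⊗ ∂ f (v ∷ w) ∎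

    ∂-neg : ∀ f w → ∂ (λ u → ⊝ f u) w ≈ ⊝ ∂ f w
    ∂-neg f []      = ≈-reflexive (sym ⊝-zero)
    ∂-neg f (v ∷ w) = begin
      ⊝ f w ⊖ ∂ (λ u → ⊝ f (v ∷ u)) w
        ≈⟨ sub-cong ≈-refl (∂-neg _ w) ⟩
      ⊝ f w ⊖ (⊝ ∂ (λ u → f (v ∷ u)) w)
        ≡⟨ sym (⊝-distrib-⊖ (f w) _) ⟩
      ⊝ ∂ f (v ∷ w) ∎

    ∂∂ : ∀ f w → ∂ (∂ f) w ≈ 0ℤ
    ∂∂ f []      = ≈-refl
    ∂∂ f (v ∷ w) = begin
      ∂ f w ⊖ ∂ (λ u → f u ⊖ ∂ (λ u → f (v ∷ u)) u) w
        ≈⟨ sub-cong ≈-refl (∂-sub f _ w) ⟩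
      ∂ f w ⊖ (∂ f w ⊖ ∂ (∂ (λ u → f (v ∷ u))) w)
        ≡⟨ ⊖-⊖-cancel (∂ f w) _ ⟩
      ∂ (∂ (λ u → f (v ∷ u))) w
        ≈⟨ ∂∂ _ w ⟩
      0ℤ ∎

  -- Exactness in degree k - 1 of the reduced complex of tuples in `Q`. Values of `f` and `g` off
  -- `Q` are junk and never constrained.
  Acyclic : {V : Set} → (List V → Set) → ℕ → Set
  Acyclic {V} Q k = ∀ (f : List V → ℤ) → (∀ w → Q w → length w ≡ suc k → ∂ f w ≈ 0ℤ) →
                    Σ (List V → ℤ) λ g → ∀ w → Q w → length w ≡ k → f w ≈ ∂ g w

-- Signed sorting as a chain map.

module Sorting (p : ℕ) {V : Set} where
  open Mod p

  data Cmp : Set where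
    before same after : Cmp

  -- Weaker than a linear order: `before` may hold in both directions and `same` may never occur.
  -- Vertices are compared strictly, so that repeated ones cancel; colours only form a preorder, in
  -- which ties must survive.
  record Comparison : Set where
    field
      cmp          : V → V → Cmp
      before-trans : ∀ {u v w} → cmp u v ≡ before → cmp v w ≡ before → cmp u w ≡ before
      after-before : ∀ {u v} → cmp u v ≡ after → cmp v u ≡ before
      same-≡       : ∀ {u v} → cmp u v ≡ same → u ≡ v

  module _ (C : Comparison) where
    open Comparison C

    data Mono : List V → Set where
      []  : Mono []
      _∷_ : ∀ {v w} → All (λ u → cmp v u ≡ before) w → Mono w → Mono (v ∷ w)

    -- Transpose of signed insertion: `φ` is read on the tuple with v inserted, every vertex passed
    -- costs a sign, and meeting an equal vertex gives zero.
    wedge  : V → (List V → ℤ) → List V → ℤ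
    wedge′ : Cmp → V → (List V → ℤ) → V → List V → ℤ
    wedge v φ []      = φ (v ∷ [])
    wedge v φ (s ∷ w) = wedge′ (cmp v s) v φ s w
    wedge′ before v φ s w = φ (v ∷ s ∷ w)
    wedge′ same   v φ s w = 0ℤ
    wedge′ after  v φ s w = ⊝ wedge v (λ u → φ (s ∷ u)) w

    sort : (List V → ℤ) → List V → ℤ
    sort φ []      = φ []
    sort φ (v ∷ w) = sort (wedge v φ) w

    before-all : ∀ {v s w} → cmp v s ≡ before → All (λ u → cmp s u ≡ before) w →
                 All (λ u → cmp v u ≡ before) (s ∷ w)
    before-all q a = q ∷ All.map (before-trans q) a

    wedge-before : ∀ {v w} φ → All (λ u → cmp v u ≡ before) w → wedge v φ w ≡ φ (v ∷ w)
    wedge-before φ []      = refl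
    wedge-before {v} {s ∷ w} φ (q ∷ _) rewrite q = refl

    wedge-local : (P : V → Set) → ∀ {v} φ ψ w →
      (∀ u → Mono u → All P u → length u ≡ suc (length w) → φ u ≈ ψ u) →
      P v → All P w → Mono w → wedge v φ w ≈ wedge v ψ w
    wedge-local P φ ψ []      h pv _ _ = h _ ([] ∷ []) (pv ∷ []) refl
    wedge-local P {v} φ ψ (s ∷ w) h pv (ps ∷ pw) (a ∷ m) with cmp v s in q
    ... | before = h _ (before-all q a ∷ (a ∷ m)) (pv ∷ ps ∷ pw) refl
    ... | same   = ≈-refl
    -- The result of the inner insertion gets prefixed by s, so the predicate is enlarged by "s is
    -- before it" to keep the whole tuple sorted.
    ... | after  = neg-cong (wedge-local (λ u → P u × cmp s u ≡ before) _ _ w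
                     (λ u mu pu lu → h (s ∷ u) (All.map proj₂ pu ∷ mu) (ps ∷ All.map proj₁ pu) (cong suc lu))
                     (pv , after-before q) (All.zip (pw , a)) m)

    sort-local : (P : V → Set) → ∀ φ ψ w →
      (∀ u → Mono u → All P u → length u ≡ length w → φ u ≈ ψ u) →
      All P w → sort φ w ≈ sort ψ w
    sort-local P φ ψ []      h _        = h [] [] [] refl
    sort-local P φ ψ (v ∷ w) h (pv ∷ pw) = sort-local P _ _ w
      (λ u mu pu lu → wedge-local P φ ψ u (λ u′ m′ p′ l′ → h u′ m′ p′ (trans l′ (cong suc lu))) pv pu mu) pw

    sort-cong : ∀ φ ψ w → (∀ u → Mono u → length u ≡ length w → φ u ≈ ψ u) → sort φ w ≈ sort ψ w
    sort-cong φ ψ w h = sort-local (λ v → v ≡ v) φ ψ w (λ u m _ l → h u m l) (All.universal (λ _ → refl) w)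

    wedge-sub : ∀ v f g w → wedge v (λ u → f u ⊖ g u) w ≡ wedge v f w ⊖ wedge v g w
    wedge-sub v f g []      = refl
    wedge-sub v f g (s ∷ w) with cmp v s
    ... | before = refl
    ... | same   = sym ⊖-zero
    ... | after  = trans (cong ⊝_ (wedge-sub v _ _ w)) (⊝-distrib-⊖ (wedge v (λ u → f (s ∷ u)) w) _)

    sort-sub : ∀ f g w → sort (λ u → f u ⊖ g u) w ≈ sort f w ⊖ sort g w
    sort-sub f g []      = ≈-refl
    sort-sub f g (v ∷ w) = ≈-trans
      (sort-cong _ _ w (λ u _ _ → ≈-reflexive (wedge-sub v f g u)))
      (sort-sub _ _ w)

    wedge-add : ∀ v f g w → wedge v (λ u → f u ⊕ g u) w ≡ wedge v f w ⊕ wedge v g w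
    wedge-add v f g []      = refl
    wedge-add v f g (s ∷ w) with cmp v s
    ... | before = refl
    ... | same   = sym ⊕-zero
    ... | after  = trans (cong ⊝_ (wedge-add v _ _ w)) (⊝-distrib-⊕ (wedge v (λ u → f (s ∷ u)) w) _)

    sort-add : ∀ f g w → sort (λ u → f u ⊕ g u) w ≈ sort f w ⊕ sort g w
    sort-add f g []      = ≈-refl
    sort-add f g (v ∷ w) = ≈-trans
      (sort-cong _ _ w (λ u _ _ → ≈-reflexive (wedge-add v f g u)))
      (sort-add _ _ w)

    wedge-scale : ∀ v k f w → wedge v (λ u → k ⊗ f u) w ≡ k ⊗ wedge v f w
    wedge-scale v k f []      = refl
    wedge-scale v k f (s ∷ w) with cmp v s
    ... | before = refl
    ... | same   = sym (⊗-zeroʳ k)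
    ... | after  = trans (cong ⊝_ (wedge-scale v k _ w)) (⊝-⊗ k _)

    sort-scale : ∀ k f w → sort (λ u → k ⊗ f u) w ≈ k ⊗ sort f w
    sort-scale k f []      = ≈-refl
    sort-scale k f (v ∷ w) = ≈-trans
      (sort-cong _ _ w (λ u _ _ → ≈-reflexive (wedge-scale v k f u)))
      (sort-scale k _ w)

    module _ (σ : V → V) (cmp-σ : ∀ u v → cmp (σ u) (σ v) ≡ cmp u v) where

      wedge-map : ∀ v f w → wedge v (λ u → f (map σ u)) w ≡ wedge (σ v) f (map σ w)
      wedge-map v f []      = refl
      wedge-map v f (s ∷ w) rewrite cmp-σ v s with cmp v s
      ... | before = refl
      ... | same   = refl
      ... | after  = cong ⊝_ (wedge-map v (λ u → f (σ s ∷ u)) w)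

      sort-map : ∀ f w → sort (λ u → f (map σ u)) w ≈ sort f (map σ w)
      sort-map f []      = ≈-refl
      sort-map f (v ∷ w) = ≈-trans
        (sort-cong _ _ w (λ u _ _ → ≈-reflexive (wedge-map v f u)))
        (sort-map (wedge (σ v) f) w)

    private
      wedge-cmp : ∀ {v s c} φ w → cmp v s ≡ c → wedge v φ (s ∷ w) ≡ wedge′ c v φ s w
      wedge-cmp φ w refl = refl

    -- Dually to ∂ (v ∧ s) = s - v ∧ ∂ s, where v ∧ s is the signed insertion of
    -- v into the sorted list s.
    wedge-∂  : ∀ v φ w → Mono w → wedge v (∂ φ) w ≈ φ w ⊖ ∂ (wedge v φ) w
    wedge-∂′ : ∀ c v φ s w → cmp v s ≡ c → All (λ u → cmp s u ≡ before) w → Mono w →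
               wedge′ c v (∂ φ) s w ≈ φ (s ∷ w) ⊖ ∂ (wedge v φ) (s ∷ w)
    wedge-∂ v φ []      m       = ≈-refl
    wedge-∂ v φ (s ∷ w) (a ∷ m) = wedge-∂′ (cmp v s) v φ s w refl a m
    wedge-∂′ before v φ s w q a m =
      sub-cong ≈-refl (≈-sym (∂-local (wedge v φ) (λ u → φ (v ∷ u)) (s ∷ w)
        (λ {u} x → ≈-reflexive (wedge-before φ (Face-All x (before-all q a))))))
    wedge-∂′ same v φ s w q a m with same-≡ q
    ... | refl = begin
      0ℤ
        ≡⟨ sym (⊖-inverse (φ (v ∷ w))) ⟩
      φ (v ∷ w) ⊖ φ (v ∷ w)
        ≡⟨ cong (φ (v ∷ w) ⊖_) (sym (trans (cong (_⊖ 0ℤ) (wedge-before φ a)) (⊖-identityʳ _))) ⟩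
      φ (v ∷ w) ⊖ (wedge v φ w ⊖ 0ℤ)
        ≈⟨ sub-cong ≈-refl (sub-cong ≈-refl (≈-sym (∂-vanish _ w
             (λ {u} _ → ≈-reflexive (wedge-cmp φ u q))))) ⟩
      φ (v ∷ w) ⊖ (wedge v φ w ⊖ ∂ (λ u → wedge v φ (v ∷ u)) w) ∎
    wedge-∂′ after v φ s w q a m = begin
      ⊝ wedge v (λ u → φ u ⊖ ∂ (λ u → φ (s ∷ u)) u) w
        ≡⟨ cong ⊝_ (wedge-sub v φ _ w) ⟩
      ⊝ (wedge v φ w ⊖ wedge v (∂ (λ u → φ (s ∷ u))) w)
        ≈⟨ neg-cong (sub-cong ≈-refl (wedge-∂ v _ w m)) ⟩
      ⊝ (wedge v φ w ⊖ (φ (s ∷ w) ⊖ ∂ (wedge v (λ u → φ (s ∷ u))) w))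
        ≡⟨ ⊝-⊖-⊖ (wedge v φ w) (φ (s ∷ w)) _ ⟩
      φ (s ∷ w) ⊖ (wedge v φ w ⊖ (⊝ ∂ (wedge v (λ u → φ (s ∷ u))) w))
        ≈⟨ sub-cong ≈-refl (sub-cong ≈-refl (≈-trans (≈-sym (∂-neg _ w))
             (∂-cong (λ u → ≈-reflexive (sym (wedge-cmp φ u q))) w))) ⟩
      φ (s ∷ w) ⊖ (wedge v φ w ⊖ ∂ (λ u → wedge v φ (s ∷ u)) w) ∎

    -- Each insertion satisfies the cone formula `wedge-∂` on sorted tuples; together with induction
    -- for `wedge v φ` this is the unrolled `∂`.
    sort-∂ : ∀ φ w → sort (∂ φ) w ≈ ∂ (sort φ) w
    sort-∂ φ []      = ≈-refl
    sort-∂ φ (v ∷ w) = begin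
      sort (wedge v (∂ φ)) w                       ≈⟨ sort-cong _ _ w (λ u m _ → wedge-∂ v φ u m) ⟩
      sort (λ u → φ u ⊖ ∂ (wedge v φ) u) w         ≈⟨ sort-sub φ _ w ⟩
      sort φ w ⊖ sort (∂ (wedge v φ)) w            ≈⟨ sub-cong ≈-refl (sort-∂ _ w) ⟩
      sort φ w ⊖ ∂ (sort (wedge v φ)) w            ∎

-- From increasing simplices to all tuples.

module Acyclicity (p : ℕ) {V : Set} (C : Sorting.Comparison p {V}) where
  open Mod p
  open Sorting p {V}

  wedge-zero : ∀ v w → wedge C v (λ _ → 0ℤ) w ≡ 0ℤ
  wedge-zero v []      = refl
  wedge-zero v (s ∷ w) with Comparison.cmp C v s
  ... | before = refl
  ... | same   = refl
  ... | after  = trans (cong ⊝_ (wedge-zero v w)) ⊝-zero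

  sort-zero : ∀ w → sort C (λ _ → 0ℤ) w ≈ 0ℤ
  sort-zero []      = ≈-refl
  sort-zero (v ∷ w) = ≈-trans (sort-cong C _ _ w (λ u _ _ → ≈-reflexive (wedge-zero v u))) (sort-zero w)

  -- The acyclic-carrier homotopy between the identity and sorting: the cone
  -- with apex the first vertex of the tuple.
  H : ℕ → (List V → ℤ) → List V → ℤ
  H zero    f w       = 0ℤ
  H (suc k) f []      = 0ℤ
  H (suc k) f (v ∷ u) = f (v ∷ v ∷ u) ⊖ sort C (λ s → f (v ∷ s)) (v ∷ u) ⊖ ∂ (H k (λ s → f (v ∷ s))) (v ∷ u)

  H-sub : ∀ k f g w → H k (λ u → f u ⊖ g u) w ≈ H k f w ⊖ H k g w
  H-sub zero    f g w       = ≈-reflexive (sym ⊖-zero)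
  H-sub (suc k) f g []      = ≈-reflexive (sym ⊖-zero)
  H-sub (suc k) f g (v ∷ u) = begin
    (f (v ∷ v ∷ u) ⊖ g (v ∷ v ∷ u)) ⊖ sort C (λ s → f′ s ⊖ g′ s) (v ∷ u) ⊖ ∂ (H k (λ s → f′ s ⊖ g′ s)) (v ∷ u)
      ≈⟨ sub-cong (sub-cong ≈-refl (sort-sub C f′ g′ (v ∷ u)))
           (≈-trans (∂-cong (H-sub k f′ g′) (v ∷ u)) (∂-sub (H k f′) (H k g′) (v ∷ u))) ⟩
    (f (v ∷ v ∷ u) ⊖ g (v ∷ v ∷ u)) ⊖ (sort C f′ (v ∷ u) ⊖ sort C g′ (v ∷ u))
      ⊖ (∂ (H k f′) (v ∷ u) ⊖ ∂ (H k g′) (v ∷ u))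
      ≡⟨ cong (_⊖ (∂ (H k f′) (v ∷ u) ⊖ ∂ (H k g′) (v ∷ u))) (⊖-⊖-comm (f (v ∷ v ∷ u)) _ _ _) ⟩
    (f (v ∷ v ∷ u) ⊖ sort C f′ (v ∷ u)) ⊖ (g (v ∷ v ∷ u) ⊖ sort C g′ (v ∷ u))
      ⊖ (∂ (H k f′) (v ∷ u) ⊖ ∂ (H k g′) (v ∷ u))
      ≡⟨ ⊖-⊖-comm (f (v ∷ v ∷ u) ⊖ sort C f′ (v ∷ u)) _ _ _ ⟩
    H (suc k) f (v ∷ u) ⊖ H (suc k) g (v ∷ u) ∎
    where
    f′ g′ : List V → ℤ
    f′ s = f (v ∷ s)
    g′ s = g (v ∷ s)

  -- Neither coning nor sorting introduces new vertices, so `H` reads its argument only on tuples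
  -- made of entries of w. With membership in w as `P`, the homotopy stays inside any family closed
  -- under such tuples.
  H-vanish : (P : V → Set) → ∀ k f → (∀ u → All P u → length u ≡ suc k → f u ≈ 0ℤ) →
             ∀ w → All P w → length w ≡ k → H k f w ≈ 0ℤ
  H-vanish P zero    f h w       a        l = ≈-refl
  H-vanish P (suc k) f h (v ∷ u) (b ∷ a) l = begin
    f (v ∷ v ∷ u) ⊖ sort C f′ (v ∷ u) ⊖ ∂ (H k f′) (v ∷ u)
      ≈⟨ sub-cong (sub-cong (h _ (b ∷ b ∷ a) (cong suc l))
           (≈-trans (sort-local C P f′ (λ _ → 0ℤ) (v ∷ u)
             (λ s _ ps ls → h (v ∷ s) (b ∷ ps) (cong suc (trans ls l))) (b ∷ a)) (sort-zero (v ∷ u))))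
           (∂-vanish (H k f′) (v ∷ u)
             (λ {s} x → H-vanish P k f′ (λ s ps ls → h (v ∷ s) (b ∷ ps) (cong suc ls)) s (Face-All x (b ∷ a))
               (ℕ.suc-injective (trans (sym (Face-length x)) l)))) ⟩
    0ℤ ⊖ 0ℤ ⊖ 0ℤ ≡⟨ cong (_⊖ 0ℤ) ⊖-zero ⟩
    0ℤ ⊖ 0ℤ      ≡⟨ ⊖-zero ⟩
    0ℤ           ∎
    where
    f′ : List V → ℤ
    f′ s = f (v ∷ s)

  private
    ∂H : ℕ → (List V → ℤ) → List V → ℤ
    ∂H zero    f w = 0ℤ
    ∂H (suc n) f w = ∂ (H n f) w

    ∂∂H : ∀ n f w → ∂ (∂H n f) w ≈ 0ℤ
    ∂∂H zero    f w = ∂-zero w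
    ∂∂H (suc n) f w = ∂∂ (H n f) w

  -- Put g = f (v ∷ _) for the first vertex v. The identity for g, one length down, and ∂∂ = 0 turn
  -- ∂ of the recursive term into ∂ g - ∂ (sort g); everything else cancels because sorting commutes
  -- with ∂.
  homotopy : ∀ n f w → length w ≡ n → f w ⊖ sort C f w ≈ ∂H n f w ⊕ H n (∂ f) w
  homotopy zero    f []      l = ≈-reflexive (trans (⊖-inverse (f [])) (sym ⊕-zero))
  homotopy (suc n) f (v ∷ u) l = ≈-sym (begin
    ∂ (H n f) w ⊕ ((f w ⊖ ∂ g w) ⊖ sort C (λ s → f s ⊖ ∂ g s) w ⊖ ∂ (H n (λ s → f s ⊖ ∂ g s)) w)
      ≈⟨ +-cong ≈-refl (sub-cong (sub-cong ≈-refl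
           (≈-trans (sort-sub C f (∂ g) w) (sub-cong ≈-refl (sort-∂ C g w))))
           (≈-trans (∂-cong (H-sub n f (∂ g)) w) (≈-trans (∂-sub (H n f) (H n (∂ g)) w) (sub-cong ≈-refl inner)))) ⟩
    ∂ (H n f) w ⊕ ((f w ⊖ ∂ g w) ⊖ (sort C f w ⊖ ∂ (sort C g) w) ⊖ (∂ (H n f) w ⊖ (∂ g w ⊖ ∂ (sort C g) w)))
      ≡⟨ homotopy-cancel (∂ (H n f) w) (f w) _ _ _ ⟩
    f w ⊖ sort C f w ∎)
    where
    w : List V
    w = v ∷ u
    g : List V → ℤ
    g s = f (v ∷ s)
    inner : ∂ (H n (∂ g)) w ≈ ∂ g w ⊖ ∂ (sort C g) w
    inner = begin
      ∂ (H n (∂ g)) w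
        ≈⟨ ∂-local _ _ w (λ {s} x → ≈-trans (≈-reflexive (sym (⊕-⊖-cancel (∂H n g s) _)))
             (sub-cong (≈-sym (homotopy n g s (ℕ.suc-injective (trans (sym (Face-length x)) l)))) ≈-refl)) ⟩
      ∂ (λ s → (g s ⊖ sort C g s) ⊖ ∂H n g s) w
        ≈⟨ ∂-sub (λ s → g s ⊖ sort C g s) (∂H n g) w ⟩
      ∂ (λ s → g s ⊖ sort C g s) w ⊖ ∂ (∂H n g) w
        ≈⟨ sub-cong (∂-sub g (sort C g) w) (∂∂H n g w) ⟩
      (∂ g w ⊖ ∂ (sort C g) w) ⊖ 0ℤ
        ≡⟨ ⊖-identityʳ _ ⟩
      ∂ g w ⊖ ∂ (sort C g) w ∎

  -- Sorting is homotopic to the identity: a primitive on sorted tuples, composed with sorting, plus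
  -- the homotopy term is a primitive on all tuples. The other homotopy term contains ∂ f and
  -- vanishes.
  tuple-acyclic : (S : List V → Set) → (∀ {u w} → All (_∈ w) u → S w → S u) →
                  ∀ k → Acyclic (λ w → Mono C w × S w) k → Acyclic S k
  tuple-acyclic S S-closed k acyclic f cocycle = (λ w → ∂H′ k w ⊕ sort C g w) , bounds
    where
    g : List V → ℤ
    g = proj₁ (acyclic f (λ w (_ , s) → cocycle w s))
    ∂H′ : ℕ → List V → ℤ
    ∂H′ zero    w = 0ℤ
    ∂H′ (suc n) w = H n f w
    ∂∂H′ : ∀ k w → ∂ (∂H′ k) w ≈ ∂H k f w
    ∂∂H′ zero    w = ∂-zero w
    ∂∂H′ (suc n) w = ≈-refl
    bounds : ∀ w → S w → length w ≡ k → f w ≈ ∂ (λ w → ∂H′ k w ⊕ sort C g w) w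
    bounds w s l = begin
      f w
        ≡⟨ sym (⊖-⊕-cancel (f w) (sort C f w)) ⟩
      sort C f w ⊕ (f w ⊖ sort C f w)
        ≈⟨ +-cong sorted (homotopy k f w l) ⟩
      ∂ (sort C g) w ⊕ (∂H k f w ⊕ H k (∂ f) w)
        ≈⟨ +-cong ≈-refl (+-cong (≈-sym (∂∂H′ k w)) (H-vanish (_∈ w) k (∂ f)
             (λ u a lu → cocycle u (S-closed a s) lu) w self l)) ⟩
      ∂ (sort C g) w ⊕ (∂ (∂H′ k) w ⊕ 0ℤ)
        ≡⟨ trans (cong (∂ (sort C g) w ⊕_) (⊕-identityʳ _)) (⊕-comm (∂ (sort C g) w) _) ⟩
      ∂ (∂H′ k) w ⊕ ∂ (sort C g) w
        ≈⟨ ≈-sym (∂-add (∂H′ k) (sort C g) w) ⟩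
      ∂ (λ w → ∂H′ k w ⊕ sort C g w) w ∎
      where
      self : All (_∈ w) w
      self = All.tabulate (λ x → x)
      sorted : sort C f w ≈ ∂ (sort C g) w
      sorted = ≈-trans
        (sort-local C (_∈ w) f (∂ g) w
          (λ u m a lu → proj₂ (acyclic f (λ w (_ , s) → cocycle w s)) u (m , S-closed a s) (trans lu l)) self)
        (sort-∂ C g w)

-- Cup products on tuples.

sg : ℕ → ℤ
sg zero    = 1ℤ
sg (suc n) = ⊝ sg n

module CupProduct (p : ℕ) {V : Set} where
  open Mod p

  -- f is evaluated on the first j + 1 vertices, g on all vertices from the
  -- (j + 1)-st on.
  cup : ℕ → (f g : List V → ℤ) → List V → ℤ
  cup j       f g []      = 0ℤ
  cup zero    f g (v ∷ w) = f (v ∷ []) ⊗ g (v ∷ w)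
  cup (suc j) f g (v ∷ w) = cup j (λ u → f (v ∷ u)) g w

  cup-split : ∀ f g u {v c} → cup (length u) f g (u ++ v ∷ c) ≡ f (u ++ v ∷ []) ⊗ g (v ∷ c)
  cup-split f g []      = refl
  cup-split f g (x ∷ u) = cup-split (λ s → f (x ∷ s)) g u

  cup-sub : ∀ j f f′ g w → cup j (λ u → f u ⊖ f′ u) g w ≈ cup j f g w ⊖ cup j f′ g w
  cup-sub j       f f′ g []      = ≈-reflexive (sym ⊖-zero)
  cup-sub zero    f f′ g (v ∷ w) = ≈-reflexive (⊗-distribʳ-⊖ (g (v ∷ w)) _ _)
  cup-sub (suc j) f f′ g (v ∷ w) = cup-sub j _ _ g w

  cup-vanishˡ : ∀ j f g w → (∀ u → length u ≡ suc j → f u ≈ 0ℤ) → cup j f g w ≈ 0ℤ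
  cup-vanishˡ j       f g []      h = ≈-refl
  cup-vanishˡ zero    f g (v ∷ w) h = ≈-trans (*-cong (h _ refl) ≈-refl) (≈-reflexive (⊗-zeroˡ _))
  cup-vanishˡ (suc j) f g (v ∷ w) h = cup-vanishˡ j _ g w (λ u l → h (v ∷ u) (cong suc l))

  cup-vanishʳ : ∀ j f g w → (∀ u → g u ≈ 0ℤ) → cup j f g w ≈ 0ℤ
  cup-vanishʳ j       f g []      h = ≈-refl
  cup-vanishʳ zero    f g (v ∷ w) h = ≈-trans (*-cong ≈-refl (h (v ∷ w))) (≈-reflexive (⊗-zeroʳ _))
  cup-vanishʳ (suc j) f g (v ∷ w) h = cup-vanishʳ j _ g w h

  -- The face omitting the shared vertex occurs in both terms on the right and cancels. The
  -- condition on `g []` concerns the augmentation: on a single remaining vertex ∂ g reads `g []`,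
  -- which has no counterpart on the left.
  leibniz : ∀ j f g w → g [] ≡ 0ℤ →
            ∂ (cup j f g) w ≈ cup (suc j) (∂ f) g w ⊕ sg j ⊗ cup j f (∂ g) w
  leibniz j f g [] g₀ = ≈-reflexive (sym (trans (⊕-identityˡ _) (⊗-zeroʳ (sg j))))
  leibniz zero f g (v ∷ []) g₀ = begin
    0ℤ ⊖ 0ℤ                                   ≡⟨ cong (0ℤ ⊖_) (sym (⊗-zeroʳ (f (v ∷ [])))) ⟩
    0ℤ ⊖ f (v ∷ []) ⊗ 0ℤ                      ≡⟨ leibniz-nil (f (v ∷ [])) ⟩
    0ℤ ⊕ 1ℤ ⊗ (f (v ∷ []) ⊗ (0ℤ ⊖ 0ℤ))        ≡⟨ cong (λ x → 0ℤ ⊕ 1ℤ ⊗ (f (v ∷ []) ⊗ (x ⊖ 0ℤ))) (sym g₀) ⟩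
    0ℤ ⊕ 1ℤ ⊗ (f (v ∷ []) ⊗ (g [] ⊖ 0ℤ))      ∎
  leibniz zero f g (v ∷ u ∷ w) g₀ = begin
    f (u ∷ []) ⊗ g (u ∷ w) ⊖ ∂ (λ s → f (v ∷ []) ⊗ g (v ∷ s)) (u ∷ w)
      ≈⟨ sub-cong ≈-refl (∂-scale (f (v ∷ [])) (λ s → g (v ∷ s)) (u ∷ w)) ⟩
    f (u ∷ []) ⊗ g (u ∷ w) ⊖ f (v ∷ []) ⊗ ∂ (λ s → g (v ∷ s)) (u ∷ w)
      ≡⟨ sym (leibniz-base (f (u ∷ [])) (f (v ∷ [])) (g (u ∷ w)) _) ⟩
    (f (u ∷ []) ⊖ (f (v ∷ []) ⊖ 0ℤ)) ⊗ g (u ∷ w) ⊕ 1ℤ ⊗ (f (v ∷ []) ⊗ ∂ g (v ∷ u ∷ w)) ∎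
  leibniz (suc j) f g (v ∷ w) g₀ = begin
    cup (suc j) f g w ⊖ ∂ (cup j f′ g) w
      ≈⟨ sub-cong ≈-refl (leibniz j f′ g w g₀) ⟩
    cup (suc j) f g w ⊖ (cup (suc j) (∂ f′) g w ⊕ sg j ⊗ cup j f′ (∂ g) w)
      ≡⟨ leibniz-step (cup (suc j) f g w) _ _ _ ⟩
    (cup (suc j) f g w ⊖ cup (suc j) (∂ f′) g w) ⊕ (⊝ sg j) ⊗ cup j f′ (∂ g) w
      ≈⟨ +-cong (≈-sym (cup-sub (suc j) f (∂ f′) g w)) ≈-refl ⟩
    cup (suc j) (λ u → f u ⊖ ∂ f′ u) g w ⊕ (⊝ sg j) ⊗ cup j f′ (∂ g) w ∎
    where
    f′ : List V → ℤ
    f′ u = f (v ∷ u)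

  cup-closed : ∀ j f g → g [] ≡ 0ℤ → (∀ u → length u ≡ suc (suc j) → ∂ f u ≈ 0ℤ) → (∀ u → ∂ g u ≈ 0ℤ) →
               ∀ w → ∂ (cup j f g) w ≈ 0ℤ
  cup-closed j f g g₀ hf hg w = begin
    ∂ (cup j f g) w
      ≈⟨ leibniz j f g w g₀ ⟩
    cup (suc j) (∂ f) g w ⊕ sg j ⊗ cup j f (∂ g) w
      ≈⟨ +-cong (cup-vanishˡ (suc j) (∂ f) g w hf) (*-cong ≈-refl (cup-vanishʳ j f (∂ g) w hg)) ⟩
    0ℤ ⊕ sg j ⊗ 0ℤ
      ≡⟨ trans (⊕-identityˡ _) (⊗-zeroʳ (sg j)) ⟩
    0ℤ ∎

  cup-map : ∀ (σ : V → V) j f f′ g g′ w → (∀ u → f (map σ u) ≈ f′ u) → (∀ u → g (map σ u) ≈ g′ u) →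
            cup j f g (map σ w) ≈ cup j f′ g′ w
  cup-map σ j       f f′ g g′ []      hf hg = ≈-refl
  cup-map σ zero    f f′ g g′ (v ∷ w) hf hg = *-cong (hf (v ∷ [])) (hg (v ∷ w))
  cup-map σ (suc j) f f′ g g′ (v ∷ w) hf hg = cup-map σ j _ _ g g′ w (λ u → hf (v ∷ u)) hg

-- Periodic resolutions and their tensor product.

module Operators (p : ℕ) where
  open Mod p

  iter : ∀ {S : Set} → ℕ → (S → S) → S → S
  iter zero    σ s = s
  iter (suc k) σ s = iter k σ (σ s)

  orb : ∀ {S : Set} → ℕ → (S → S) → (S → ℤ) → S → ℤ
  orb zero    σ f s = 0ℤ
  orb (suc k) σ f s = f s ⊕ orb k σ f (σ s)

  -- The differentials σ - 1 and 1 + σ + ⋯ + σ^(p-1), alternating, of the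
  -- periodic resolution of a cyclic group.
  d : ∀ {S : Set} → ℕ → (S → S) → (S → ℤ) → S → ℤ
  d zero          σ f s = f (σ s) ⊖ f s
  d (suc zero)    σ f s = orb p σ f s
  d (suc (suc n)) σ f s = d n σ f s

  -- A function for each multidegree: the tensor product of t periodic resolutions has one free
  -- generator per vector of exponents.
  Family : Set → ℕ → Set
  Family S t = Vec ℕ t → S → ℤ

  down : ∀ {S t} → (S → S) → Family S (suc t) → ℕ → Family S t
  down σ X zero    a s = 0ℤ
  down σ X (suc n) a s = d n σ (X (n ∷ a)) s

  -- The total differential of the tensor product of t such resolutions.
  D : ∀ {S t} → Vec (S → S) t → Family S t → Family S t
  D []       X a       s = 0ℤ
  D (σ ∷ σs) X (n ∷ a) s = down σ X n a s ⊕ sg n ⊗ D σs (λ a → X (n ∷ a)) a s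

  -- Common interface of ∂, of the operators d themselves and of sorting, so that commutation with
  -- `D` is proved once, in `T-D`.
  record Linear {S : Set} (T : (S → ℤ) → S → ℤ) : Set where
    field
      T-cong  : ∀ {f g} → (∀ s → f s ≈ g s) → ∀ s → T f s ≈ T g s
      T-add   : ∀ f g s → T (λ s → f s ⊕ g s) s ≈ T f s ⊕ T g s
      T-sub   : ∀ f g s → T (λ s → f s ⊖ g s) s ≈ T f s ⊖ T g s
      T-scale : ∀ k f s → T (λ s → k ⊗ f s) s ≈ k ⊗ T f s

    T-zero : ∀ s → T (λ _ → 0ℤ) s ≈ 0ℤ
    T-zero s = begin
      T (λ _ → 0ℤ) s        ≈⟨ T-cong (λ _ → ≈-reflexive (sym (⊗-zeroˡ 0ℤ))) s ⟩
      T (λ _ → 0ℤ ⊗ 0ℤ) s   ≈⟨ T-scale 0ℤ (λ _ → 0ℤ) s ⟩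
      0ℤ ⊗ T (λ _ → 0ℤ) s   ≡⟨ ⊗-zeroˡ _ ⟩
      0ℤ                    ∎

  ∂-linear : ∀ {V : Set} → Linear (∂ {V})
  ∂-linear = record { T-cong = ∂-cong ; T-add = ∂-add ; T-sub = ∂-sub ; T-scale = ∂-scale }

  module _ {S : Set} (Q : S → Set) (σ : S → S) (closed : ∀ {s} → Q s → Q (σ s)) where

    orb-local : ∀ k f g → (∀ s → Q s → f s ≈ g s) → ∀ s → Q s → orb k σ f s ≈ orb k σ g s
    orb-local zero    f g h s q = ≈-refl
    orb-local (suc k) f g h s q = +-cong (h s q) (orb-local k f g h (σ s) (closed q))

    d-local : ∀ n f g → (∀ s → Q s → f s ≈ g s) → ∀ s → Q s → d n σ f s ≈ d n σ g s
    d-local zero          f g h s q = sub-cong (h (σ s) (closed q)) (h s q)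
    d-local (suc zero)    f g h s q = orb-local p f g h s q
    d-local (suc (suc n)) f g h s q = d-local n f g h s q

  module _ {S : Set} (σ : S → S) where

    orb-linear : ∀ k → Linear (orb k σ)
    orb-linear k = record
      { T-cong  = λ h s → orb-local (λ s → s ≡ s) σ (λ _ → refl) k _ _ (λ s _ → h s) s refl
      ; T-add   = add k ; T-sub = sub k ; T-scale = scale k }
      where
      add : ∀ k f g s → orb k σ (λ s → f s ⊕ g s) s ≈ orb k σ f s ⊕ orb k σ g s
      add zero    f g s = ≈-reflexive (sym ⊕-zero)
      add (suc k) f g s = ≈-trans (+-cong ≈-refl (add k f g (σ s))) (≈-reflexive (⊕-⊕-comm (f s) _ _ _))
      sub : ∀ k f g s → orb k σ (λ s → f s ⊖ g s) s ≈ orb k σ f s ⊖ orb k σ g s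
      sub zero    f g s = ≈-reflexive (sym ⊖-zero)
      sub (suc k) f g s = ≈-trans (+-cong ≈-refl (sub k f g (σ s))) (≈-reflexive (sym (⊕-⊖-comm (f s) _ _ _)))
      scale : ∀ k c f s → orb k σ (λ s → c ⊗ f s) s ≈ c ⊗ orb k σ f s
      scale zero    c f s = ≈-reflexive (sym (⊗-zeroʳ c))
      scale (suc k) c f s = ≈-trans (+-cong ≈-refl (scale k c f (σ s))) (≈-reflexive (sym (⊗-distribˡ-⊕ c (f s) _)))

    d-linear : ∀ n → Linear (d n σ)
    d-linear zero = record
      { T-cong  = λ h s → sub-cong (h (σ s)) (h s)
      ; T-add   = λ f g s → ≈-reflexive (⊕-⊖-comm (f (σ s)) _ _ _)
      ; T-sub   = λ f g s → ≈-reflexive (⊖-⊖-comm (f (σ s)) _ _ _)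
      ; T-scale = λ k f s → ≈-reflexive (sym (⊗-distribˡ-⊖ k (f (σ s)) _)) }
    d-linear (suc zero)    = orb-linear p
    d-linear (suc (suc n)) = d-linear n

    orb-telescope : ∀ k (f : S → ℤ) s → orb k σ (λ s → f (σ s) ⊖ f s) s ≡ f (iter k σ s) ⊖ f s
    orb-telescope zero    f s = sym (⊖-inverse (f s))
    orb-telescope (suc k) f s = trans (cong ((f (σ s) ⊖ f s) ⊕_) (orb-telescope k f (σ s)))
                                      (telescope (f s) (f (σ s)) _)

    orb-shift : ∀ k (f : S → ℤ) s → orb k σ f (σ s) ⊕ f s ≡ orb k σ f s ⊕ f (iter k σ s)
    orb-shift zero    f s = refl
    orb-shift (suc k) f s = shift-step (f s) (f (σ s)) _ _ _ (orb-shift k f (σ s))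

    -- Both orders of composition reduce to σ^p = 1: the norm of σ - 1 telescopes, and shifting the
    -- norm by σ exchanges one summand for an equal one.
    dd : (∀ s → iter p σ s ≡ s) → ∀ n f s → d (suc n) σ (d n σ f) s ≈ 0ℤ
    dd σᵖ zero f s = ≈-reflexive (trans (orb-telescope p f s)
      (trans (cong (λ x → f x ⊖ f s) (σᵖ s)) (⊖-inverse (f s))))
    dd σᵖ (suc zero) f s = ≈-reflexive (shift-⊖ _ _ (f s)
      (trans (orb-shift p f s) (cong (λ x → orb p σ f s ⊕ f x) (σᵖ s))))
    dd σᵖ (suc (suc n)) f s = dd σᵖ n f s

  module _ {S : Set} (T : (S → ℤ) → S → ℤ) (linear : Linear T)
           (σ : S → S) (T-σ : ∀ f s → T (λ s → f (σ s)) s ≈ T f (σ s)) where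
    open Linear linear

    T-orb : ∀ k f s → T (orb k σ f) s ≈ orb k σ (T f) s
    T-orb zero    f s = T-zero s
    T-orb (suc k) f s = begin
      T (λ s → f s ⊕ orb k σ f (σ s)) s           ≈⟨ T-add f (λ s → orb k σ f (σ s)) s ⟩
      T f s ⊕ T (λ s → orb k σ f (σ s)) s         ≈⟨ +-cong ≈-refl (≈-trans (T-σ (orb k σ f) s) (T-orb k f (σ s))) ⟩
      T f s ⊕ orb k σ (T f) (σ s)                 ∎

    T-d : ∀ n f s → T (d n σ f) s ≈ d n σ (T f) s
    T-d zero          f s = ≈-trans (T-sub (λ s → f (σ s)) f s) (sub-cong (T-σ f s) ≈-refl)
    T-d (suc zero)    f s = T-orb p f s
    T-d (suc (suc n)) f s = T-d n f s

  T-D : ∀ {S t} (T : (S → ℤ) → S → ℤ) → Linear T → (σs : Vec (S → S) t) →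
        VAll.All (λ σ → ∀ f s → T (λ s → f (σ s)) s ≈ T f (σ s)) σs →
        ∀ X a s → T (D σs X a) s ≈ D σs (λ a → T (X a)) a s
  T-D T linear []       []       X a       s = Linear.T-zero linear s
  T-D T linear (σ ∷ σs) (c ∷ cs) X (n ∷ a) s = begin
    T (λ s → down σ X n a s ⊕ sg n ⊗ D σs X′ a s) s
      ≈⟨ T-add (down σ X n a) (λ s → sg n ⊗ D σs X′ a s) s ⟩
    T (down σ X n a) s ⊕ T (λ s → sg n ⊗ D σs X′ a s) s
      ≈⟨ +-cong (T-down n) (≈-trans (T-scale (sg n) (D σs X′ a) s) (*-cong ≈-refl (T-D T linear σs cs X′ a s))) ⟩
    down σ (λ a → T (X a)) n a s ⊕ sg n ⊗ D σs (λ a → T (X′ a)) a s ∎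
    where
    open Linear linear
    X′ : Family _ _
    X′ a = X (n ∷ a)
    T-down : ∀ n → T (down σ X n a) s ≈ down σ (λ a → T (X a)) n a s
    T-down zero    = T-zero s
    T-down (suc n) = T-d T linear σ c n (X (n ∷ a)) s

  D-local : ∀ {S t} (Q : S → Set) (σs : Vec (S → S) t) → VAll.All (λ σ → ∀ {s} → Q s → Q (σ s)) σs →
            ∀ X Y → (∀ a s → Q s → X a s ≈ Y a s) → ∀ a s → Q s → D σs X a s ≈ D σs Y a s
  D-local Q []       []       X Y h a       s q = ≈-refl
  D-local Q (σ ∷ σs) (c ∷ cs) X Y h (n ∷ a) s q =
    +-cong (down-local n) (*-cong ≈-refl (D-local Q σs cs _ _ (λ a → h (n ∷ a)) a s q))
    where
    down-local : ∀ n → down σ X n a s ≈ down σ Y n a s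
    down-local zero    = ≈-refl
    down-local (suc n) = d-local Q σ c n _ _ (h (n ∷ a)) s q

  D-cong : ∀ {S t} (σs : Vec (S → S) t) {X Y} → (∀ a s → X a s ≈ Y a s) → ∀ a s → D σs X a s ≈ D σs Y a s
  D-cong σs h a s = D-local (λ s → s ≡ s) σs (VAll.universal (λ _ {_} _ → refl) σs) _ _ (λ a s _ → h a s) a s refl

  D-add : ∀ {S t} (σs : Vec (S → S) t) X Y a s → D σs (λ a s → X a s ⊕ Y a s) a s ≈ D σs X a s ⊕ D σs Y a s
  D-add []       X Y a       s = ≈-reflexive (sym ⊕-zero)
  D-add (σ ∷ σs) X Y (n ∷ a) s = begin
    down σ (λ a s → X a s ⊕ Y a s) n a s ⊕ sg n ⊗ D σs (λ a s → X (n ∷ a) s ⊕ Y (n ∷ a) s) a s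
      ≈⟨ +-cong (down-add n) (≈-trans (*-cong ≈-refl (D-add σs (λ a → X (n ∷ a)) (λ a → Y (n ∷ a)) a s))
           (≈-reflexive (⊗-distribˡ-⊕ (sg n) _ _))) ⟩
    (down σ X n a s ⊕ down σ Y n a s) ⊕
      (sg n ⊗ D σs (λ a → X (n ∷ a)) a s ⊕ sg n ⊗ D σs (λ a → Y (n ∷ a)) a s)
      ≡⟨ ⊕-⊕-comm (down σ X n a s) _ _ _ ⟩
    D (σ ∷ σs) X (n ∷ a) s ⊕ D (σ ∷ σs) Y (n ∷ a) s ∎
    where
    down-add : ∀ n → down σ (λ a s → X a s ⊕ Y a s) n a s ≈ down σ X n a s ⊕ down σ Y n a s
    down-add zero    = ≈-reflexive (sym ⊕-zero)
    down-add (suc n) = Linear.T-add (d-linear σ n) _ _ s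

  D-scale : ∀ {S t} (σs : Vec (S → S) t) k X a s → D σs (λ a s → k ⊗ X a s) a s ≈ k ⊗ D σs X a s
  D-scale []       k X a       s = ≈-reflexive (sym (⊗-zeroʳ k))
  D-scale (σ ∷ σs) k X (n ∷ a) s = begin
    down σ (λ a s → k ⊗ X a s) n a s ⊕ sg n ⊗ D σs (λ a s → k ⊗ X (n ∷ a) s) a s
      ≈⟨ +-cong (down-scale n) (≈-trans (*-cong ≈-refl (D-scale σs k (λ a → X (n ∷ a)) a s))
           (≈-reflexive (⊗-⊗-swap (sg n) k _))) ⟩
    k ⊗ down σ X n a s ⊕ k ⊗ (sg n ⊗ D σs (λ a → X (n ∷ a)) a s)
      ≡⟨ sym (⊗-distribˡ-⊕ k _ _) ⟩
    k ⊗ D (σ ∷ σs) X (n ∷ a) s ∎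
    where
    down-scale : ∀ n → down σ (λ a s → k ⊗ X a s) n a s ≈ k ⊗ down σ X n a s
    down-scale zero    = ≈-reflexive (sym (⊗-zeroʳ k))
    down-scale (suc n) = Linear.T-scale (d-linear σ n) k _ s

  D-zero : ∀ {S t} (σs : Vec (S → S) t) a s → D σs (λ _ _ → 0ℤ) a s ≈ 0ℤ
  D-zero σs a s = begin
    D σs (λ _ _ → 0ℤ) a s        ≈⟨ D-cong σs (λ _ _ → ≈-reflexive (sym (⊗-zeroˡ 0ℤ))) a s ⟩
    D σs (λ _ _ → 0ℤ ⊗ 0ℤ) a s   ≈⟨ D-scale σs 0ℤ (λ _ _ → 0ℤ) a s ⟩
    0ℤ ⊗ D σs (λ _ _ → 0ℤ) a s   ≡⟨ ⊗-zeroˡ _ ⟩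
    0ℤ                           ∎

  data Commuting {S : Set} : ∀ {t} → Vec (S → S) t → Set where
    []  : Commuting []
    _∷_ : ∀ {t σ} {σs : Vec (S → S) t} → VAll.All (λ τ → ∀ s → σ (τ s) ≡ τ (σ s)) σs →
          Commuting σs → Commuting (σ ∷ σs)

  d-commutes : ∀ {S : Set} {σ τ : S → S} → (∀ s → σ (τ s) ≡ τ (σ s)) →
               ∀ n f s → d n σ (λ s → f (τ s)) s ≈ d n σ f (τ s)
  d-commutes c zero          f s = ≈-reflexive (cong (λ x → f x ⊖ _) (sym (c s)))
  d-commutes {σ = σ} {τ} c (suc zero) f s = go p s
    where
    go : ∀ k s → orb k σ (λ s → f (τ s)) s ≈ orb k σ f (τ s)
    go zero    s = ≈-refl
    go (suc k) s = +-cong ≈-refl (≈-trans (go k (σ s)) (≈-reflexive (cong (orb k σ f) (sym (c s)))))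
  d-commutes c (suc (suc n)) f s = d-commutes c n f s

  -- Squares within one direction vanish by `dd`. Mixed terms agree because the generators commute,
  -- and they cancel because `sg` changes between n and n + 1.
  DD : ∀ {S t} (σs : Vec (S → S) t) → Commuting σs → VAll.All (λ σ → ∀ s → iter p σ s ≡ s) σs →
       ∀ X a s → D σs (D σs X) a s ≈ 0ℤ
  DD []       []       []       X a s = ≈-refl
  DD (σ ∷ σs) (c ∷ cs) (o ∷ os) X (n ∷ a) s = begin
    down σ (D (σ ∷ σs) X) n a s ⊕ sg n ⊗ D σs (λ a → D (σ ∷ σs) X (n ∷ a)) a s
      ≈⟨ +-cong ≈-refl (*-cong ≈-refl (≈-trans
           (D-add σs (down σ X n) (λ a s → sg n ⊗ D σs (λ a → X (n ∷ a)) a s) a s)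
           (+-cong ≈-refl (≈-trans (D-scale σs (sg n) _ a s)
             (*-cong ≈-refl (DD σs cs os (λ a → X (n ∷ a)) a s)))))) ⟩
    down σ (D (σ ∷ σs) X) n a s ⊕ sg n ⊗ (D σs (down σ X n) a s ⊕ sg n ⊗ 0ℤ)
      ≈⟨ cancel n ⟩
    0ℤ ∎
    where
    dd-down : ∀ n → d n σ (down σ X n a) s ≈ 0ℤ
    dd-down zero    = Linear.T-zero (d-linear σ zero) s
    dd-down (suc n) = dd σ o n (X (n ∷ a)) s
    cancel : ∀ n → down σ (D (σ ∷ σs) X) n a s ⊕ sg n ⊗ (D σs (down σ X n) a s ⊕ sg n ⊗ 0ℤ) ≈ 0ℤ
    cancel zero = ≈-trans (+-cong ≈-refl (*-cong ≈-refl (+-cong (D-zero σs a s) ≈-refl)))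
      (≈-reflexive zeros)
    cancel (suc n) = begin
      d n σ (λ s → down σ X n a s ⊕ sg n ⊗ D σs (λ a → X (n ∷ a)) a s) s ⊕ _
        ≈⟨ +-cong (≈-trans (T-add (down σ X n a) (λ s → sg n ⊗ D σs (λ a → X (n ∷ a)) a s) s)
             (+-cong (dd-down n) (≈-trans (T-scale (sg n) (D σs (λ a → X (n ∷ a)) a) s)
               (*-cong ≈-refl (T-D (d n σ) (d-linear σ n) σs (VAll.map (λ c f s → d-commutes c n f s) c) _ a s))))) ≈-refl ⟩
      (0ℤ ⊕ sg n ⊗ D σs (down σ X (suc n)) a s) ⊕ (⊝ sg n) ⊗ (D σs (down σ X (suc n)) a s ⊕ (⊝ sg n) ⊗ 0ℤ)
        ≡⟨ alternate-cancel (sg n) _ ⟩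
      0ℤ ∎
      where open Linear (d-linear σ n)

-- Invariant functions and naturality of the total differential.

module Invariance (p : ℕ) where
  open Mod p
  open Operators p

  p⊗-zero : ∀ a → + p ⊗ a ≈ 0ℤ
  p⊗-zero a = mod a (multiple-zero (+ p) a)

  -- On invariant functions σ - 1 is zero and the norm is multiplication by p, hence zero modulo p.
  -- This is why every single coefficient of a class, not just the class, is an invariant.
  D-fixed : ∀ {S t} (Q : S → Set) (σs : Vec (S → S) t) → VAll.All (λ σ → ∀ {s} → Q s → Q (σ s)) σs →
            ∀ X → VAll.All (λ σ → ∀ a s → Q s → X a (σ s) ≈ X a s) σs → ∀ a s → Q s → D σs X a s ≈ 0ℤ
  D-fixed Q []       []       X []       a       s q = ≈-refl
  D-fixed Q (σ ∷ σs) (c ∷ cs) X (f ∷ fs) (n ∷ a) s q = begin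
    down σ X n a s ⊕ sg n ⊗ D σs (λ a → X (n ∷ a)) a s
      ≈⟨ +-cong (down-fixed n) (*-cong ≈-refl
           (D-fixed Q σs cs (λ a → X (n ∷ a)) (VAll.map (λ g a → g (n ∷ a)) fs) a s q)) ⟩
    0ℤ ⊕ sg n ⊗ 0ℤ
      ≡⟨ trans (⊕-identityˡ _) (⊗-zeroʳ (sg n)) ⟩
    0ℤ ∎
    where
    orb-fixed : ∀ k g → (∀ s → Q s → g (σ s) ≈ g s) → ∀ s → Q s → orb k σ g s ≈ + k ⊗ g s
    orb-fixed zero    g h s q = ≈-reflexive (sym (⊗-zeroˡ _))
    orb-fixed (suc k) g h s q = begin
      g s ⊕ orb k σ g (σ s)   ≈⟨ +-cong ≈-refl (orb-fixed k g h (σ s) (c q)) ⟩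
      g s ⊕ + k ⊗ g (σ s)     ≈⟨ +-cong ≈-refl (*-cong ≈-refl (h s q)) ⟩
      g s ⊕ + k ⊗ g s         ≡⟨ sym (⊗-suc k (g s)) ⟩
      + suc k ⊗ g s           ∎
    d-fixed : ∀ n g → (∀ s → Q s → g (σ s) ≈ g s) → d n σ g s ≈ 0ℤ
    d-fixed zero          g h = ≈-trans (sub-cong (h s q) ≈-refl) (≈-reflexive (⊖-inverse (g s)))
    d-fixed (suc zero)    g h = ≈-trans (orb-fixed p g h s q) (p⊗-zero (g s))
    d-fixed (suc (suc n)) g h = d-fixed n g h
    down-fixed : ∀ n → down σ X n a s ≈ 0ℤ
    down-fixed zero    = ≈-refl
    down-fixed (suc n) = d-fixed n (X (n ∷ a)) (f (n ∷ a))

  orb-natural : ∀ {S S′ : Set} (φ : S′ → S) {σ τ} → (∀ s′ → σ (φ s′) ≡ φ (τ s′)) →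
                ∀ k f s′ → orb k σ f (φ s′) ≡ orb k τ (λ s′ → f (φ s′)) s′
  orb-natural φ e zero    f s′ = refl
  orb-natural φ {τ = τ} e (suc k) f s′ =
    cong (f (φ s′) ⊕_) (trans (cong (orb k _ f) (e s′)) (orb-natural φ e k f (τ s′)))

  d-natural : ∀ {S S′ : Set} (φ : S′ → S) {σ τ} → (∀ s′ → σ (φ s′) ≡ φ (τ s′)) →
              ∀ n f s′ → d n σ f (φ s′) ≡ d n τ (λ s′ → f (φ s′)) s′
  d-natural φ e zero          f s′ = cong (λ x → f x ⊖ f (φ s′)) (e s′)
  d-natural φ e (suc zero)    f s′ = orb-natural φ e p f s′
  d-natural φ e (suc (suc n)) f s′ = d-natural φ e n f s′

  D-natural : ∀ {S S′ : Set} {t} (φ : S′ → S) {σs : Vec (S → S) t} {τs} →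
              Pointwise (λ σ τ → ∀ s′ → σ (φ s′) ≡ φ (τ s′)) σs τs →
              ∀ X a s′ → D σs X a (φ s′) ≡ D τs (λ a s′ → X a (φ s′)) a s′
  D-natural φ []       X a             s′ = refl
  D-natural φ (e ∷ es) X (zero  ∷ a) s′ = cong (λ x → 0ℤ ⊕ 1ℤ ⊗ x) (D-natural φ es _ a s′)
  D-natural φ (e ∷ es) X (suc n ∷ a) s′ =
    cong₂ (λ x y → x ⊕ sg (suc n) ⊗ y) (d-natural φ e n (X (n ∷ a)) s′) (D-natural φ es _ a s′)

  -- Lets the differential pass from one argument of a pairing to the other; it later trades
  -- translations of a whole tuple for translations of a single vertex.
  D-adjoint : ∀ {S S′ : Set} {t} (Φ : Vec ℕ t → S → S′ → ℤ) {σs : Vec (S → S) t} {τs : Vec (S′ → S′) t} →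
              Pointwise (λ σ τ → ∀ a s s′ → Φ a (σ s) s′ ≈ Φ a s (τ s′)) σs τs →
              ∀ a s s′ → D σs (λ a s → Φ a s s′) a s ≈ D τs (λ a s′ → Φ a s s′) a s′
  D-adjoint Φ []       a       s s′ = ≈-refl
  D-adjoint Φ {σ ∷ σs} {τ ∷ τs} (e ∷ es) (n ∷ a) s s′ = +-cong (down-adjoint n)
    (*-cong ≈-refl (D-adjoint (λ a → Φ (n ∷ a)) (Pointwise.map (λ g a → g (n ∷ a)) es) a s s′))
    where
    orb-adjoint : ∀ (F : _ → _ → ℤ) → (∀ s s′ → F (σ s) s′ ≈ F s (τ s′)) →
                  ∀ k s s′ → orb k σ (λ s → F s s′) s ≈ orb k τ (F s) s′
    orb-adjoint F h zero    s s′ = ≈-refl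
    orb-adjoint F h (suc k) s s′ = +-cong ≈-refl (begin
      orb k σ (λ s → F s s′) (σ s)   ≈⟨ orb-adjoint F h k (σ s) s′ ⟩
      orb k τ (F (σ s)) s′           ≈⟨ Linear.T-cong (orb-linear τ k) (h s) s′ ⟩
      orb k τ (λ s′ → F s (τ s′)) s′ ≡⟨ sym (orb-natural τ (λ _ → refl) k (F s) s′) ⟩
      orb k τ (F s) (τ s′)           ∎)
    d-adjoint : ∀ (F : _ → _ → ℤ) → (∀ s s′ → F (σ s) s′ ≈ F s (τ s′)) →
                ∀ n → d n σ (λ s → F s s′) s ≈ d n τ (F s) s′
    d-adjoint F h zero          = sub-cong (h s s′) ≈-refl
    d-adjoint F h (suc zero)    = orb-adjoint F h p s s′
    d-adjoint F h (suc (suc n)) = d-adjoint F h n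
    down-adjoint : ∀ n → down σ (λ a s → Φ a s s′) n a s ≈ down τ (λ a s′ → Φ a s s′) n a s′
    down-adjoint zero    = ≈-refl
    down-adjoint (suc n) = d-adjoint (Φ (n ∷ a)) (e (n ∷ a)) n

  ∂-map : ∀ {V V′ : Set} (σ : V → V′) f w → ∂ (λ u → f (map σ u)) w ≡ ∂ f (map σ w)
  ∂-map σ f []      = refl
  ∂-map σ f (v ∷ w) = cong (f (map σ w) ⊖_) (∂-map σ (λ u → f (σ v ∷ u)) w)

  record Action {V : Set} {t} (σs : Vec (V → V) t) : Set where
    field
      commuting : Commuting σs
      order     : VAll.All (λ σ → ∀ v → iter p σ v ≡ v) σs

  maps : ∀ {V : Set} {t} → Vec (V → V) t → Vec (List V → List V) t
  maps = Vec.map map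

  maps-All : ∀ {V : Set} {t} {P : (V → V) → Set} {Q : (List V → List V) → Set} →
             (∀ {σ} → P σ → Q (map σ)) → {σs : Vec (V → V) t} → VAll.All P σs → VAll.All Q (maps σs)
  maps-All h xs = VAll.map⁺ (VAll.map h xs)

  iter-map : ∀ {V : Set} k (σ : V → V) → (∀ v → iter k σ v ≡ v) → ∀ w → iter k (map σ) w ≡ w
  iter-map k σ h w = trans (go k w) (trans (map-cong h w) (map-id w))
    where
    go : ∀ k w → iter k (map σ) w ≡ map (iter k σ) w
    go zero    w = sym (map-id w)
    go (suc k) w = trans (go k (map σ w)) (sym (map-∘ w))

  maps-action : ∀ {V : Set} {t} {σs : Vec (V → V) t} → Action σs → Action (maps σs)
  maps-action A = record
    { commuting = comm (Action.commuting A)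
    ; order     = maps-All (λ {σ} h → iter-map p σ h) (Action.order A) }
    where
    map-comm : ∀ {V : Set} {σ τ : V → V} → (∀ v → σ (τ v) ≡ τ (σ v)) → ∀ w → map σ (map τ w) ≡ map τ (map σ w)
    map-comm h w = trans (sym (map-∘ w)) (trans (map-cong h w) (map-∘ w))
    comm : ∀ {V : Set} {t} {σs : Vec (V → V) t} → Commuting σs → Commuting (maps σs)
    comm []       = []
    comm (c ∷ cs) = maps-All map-comm c ∷ comm cs

  ∂-D : ∀ {V : Set} {t} (σs : Vec (V → V) t) X a w → ∂ (D (maps σs) X a) w ≈ D (maps σs) (λ a → ∂ (X a)) a w
  ∂-D σs = T-D ∂ ∂-linear (maps σs) (VAll.map⁺ (VAll.universal (λ σ f s → ≈-reflexive (∂-map σ f s)) σs))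

  -- The zigzag in the double complex.

  module Zigzag {V : Set} {t} (σs : Vec (V → V) t) (action : Action σs)
                (Q : List V → Set) (Q-σ : VAll.All (λ σ → ∀ {w} → Q w → Q (map σ w)) σs)
                (N : ℕ) (acyclic : ∀ k → k ≤ N → Acyclic Q k)
                (X : ℕ → Family (List V) t)
                (X-zero : ∀ a w → Q w → ∂ (X 0 a) w ≈ 0ℤ)
                (X-suc : ∀ q a w → Q w → ∂ (X (suc q) a) w ≈ D (maps σs) (X q) a w) where

    private
      open Action (maps-action action)
      Ds : Family (List V) t → Family (List V) t
      Ds = D (maps σs)

      D-bounded : ∀ k X Y → (∀ a w → Q w → length w ≡ k → X a w ≈ Y a w) →
                  ∀ a w → Q w → length w ≡ k → Ds X a w ≈ Ds Y a w
      D-bounded k X Y h a w q l = D-local (λ w → Q w × length w ≡ k) (maps σs)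
        (maps-All (λ {σ} c {w} x → c (proj₁ x) , trans (length-map σ w) (proj₂ x)) Q-σ)
        X Y (λ a w x → h a w (proj₁ x) (proj₂ x)) a w (q , l)

      D-nil : ∀ X a → Ds X a [] ≈ 0ℤ
      D-nil X a = D-fixed (_≡ []) (maps σs) (VAll.map⁺ (VAll.universal (λ σ {_} e → cong (map σ) e) σs)) X
        (VAll.map⁺ (VAll.universal (λ { σ a .[] refl → ≈-refl }) σs)) a [] refl

      -- Stage of the zigzag at tuples of length k. In fact ∂ B and X q differ by a `D`-closed
      -- correction, but the next stage only needs their images under `D`.
      record Filling (q k : ℕ) : Set where
        field
          B       : Family (List V) t
          fills   : ∀ a w → Q w → length w ≡ k → Ds (λ a → ∂ (B a)) a w ≈ Ds (X q) a w
          endpoint : k ≡ 0 → Q [] → ∀ a → X q a [] ≈ 0ℤ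

      solve : ∀ q k → k ≤ N → (E : Family (List V) t) →
              (∀ a w → Q w → length w ≡ suc k → ∂ (λ w → X q a w ⊖ E a w) w ≈ 0ℤ) →
              (∀ a w → Ds E a w ≈ 0ℤ) → (∀ a → E a [] ≈ 0ℤ) → Filling q k
      solve q k k≤N E cocycle DE E-nil = record { B = B ; fills = fills ; endpoint = endpoint }
        where
        B : Family (List V) t
        B a = proj₁ (acyclic k k≤N (λ w → X q a w ⊖ E a w) (cocycle a))
        bounds : ∀ a w → Q w → length w ≡ k → X q a w ⊖ E a w ≈ ∂ (B a) w
        bounds a = proj₂ (acyclic k k≤N (λ w → X q a w ⊖ E a w) (cocycle a))
        X≈ : ∀ a w → Q w → length w ≡ k → X q a w ≈ ∂ (B a) w ⊕ E a w
        X≈ a w x l = ≈-trans (≈-reflexive (⊖-solve (X q a w) (E a w))) (+-cong (bounds a w x l) ≈-refl)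
        fills : ∀ a w → Q w → length w ≡ k → Ds (λ a → ∂ (B a)) a w ≈ Ds (X q) a w
        fills a w x l = ≈-sym (begin
          Ds (X q) a w                          ≈⟨ D-bounded k _ _ X≈ a w x l ⟩
          Ds (λ a w → ∂ (B a) w ⊕ E a w) a w    ≈⟨ D-add (maps σs) (λ a → ∂ (B a)) E a w ⟩
          Ds (λ a → ∂ (B a)) a w ⊕ Ds E a w     ≈⟨ +-cong ≈-refl (DE a w) ⟩
          Ds (λ a → ∂ (B a)) a w ⊕ 0ℤ           ≡⟨ ⊕-identityʳ _ ⟩
          Ds (λ a → ∂ (B a)) a w                ∎)
        endpoint : k ≡ 0 → Q [] → ∀ a → X q a [] ≈ 0ℤ
        endpoint k≡0 x a = begin
          X q a []       ≈⟨ X≈ a [] x (sym k≡0) ⟩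
          0ℤ ⊕ E a []    ≈⟨ +-cong ≈-refl (E-nil a) ⟩
          0ℤ ⊕ 0ℤ        ≡⟨ ⊕-zero ⟩
          0ℤ             ∎

      -- With B from the preceding stage, one vertex longer, ∂ (X (q + 1) - D B) = D (X q) - D (∂ B)
      -- = 0, so acyclicity provides the next B. The correction D B is `D`-closed by `DD`.
      filling : ∀ q k → k + q ≡ N → Filling q k
      filling zero k e = solve zero k (ℕ.≤-reflexive (trans (sym (ℕ.+-identityʳ k)) e)) (λ _ _ → 0ℤ)
        (λ a w x _ → ≈-trans (∂-cong (λ u → ≈-reflexive (⊖-identityʳ _)) w) (X-zero a w x))
        (λ a w → D-zero (maps σs) a w) (λ _ → ≈-refl)
      filling (suc q) k e = solve (suc q) k (ℕ.m+n≤o⇒m≤o k (ℕ.≤-reflexive e)) (Ds B)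
        (λ a w x l → begin
          ∂ (λ w → X (suc q) a w ⊖ Ds B a w) w       ≈⟨ ∂-sub (X (suc q) a) (Ds B a) w ⟩
          ∂ (X (suc q) a) w ⊖ ∂ (Ds B a) w           ≈⟨ sub-cong (X-suc q a w x)
                                                          (≈-trans (∂-D σs B a w) (fills a w x l)) ⟩
          Ds (X q) a w ⊖ Ds (X q) a w                ≡⟨ ⊖-inverse _ ⟩
          0ℤ                                         ∎)
        (DD (maps σs) commuting order B) (D-nil B)
        where open Filling (filling q (suc k) (trans (sym (ℕ.+-suc k q)) e))

    -- At the empty tuple both summands of X N die: ∂ is zero there by definition, and the
    -- correction lies in the image of `D`, which vanishes because all generators fix the empty
    -- tuple.
    zigzag-end : Q [] → ∀ a → X N a [] ≈ 0ℤ
    zigzag-end x = Filling.endpoint (filling N 0 refl) refl x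

  -- Explicit solution of ∂ X₀ = ω and ∂ X₍q+1₎ = D X₍q₎ when all tuples are allowed: prefixing o
  -- contracts the tuple complex.
  cone : ∀ {V : Set} {t} → Vec (V → V) t → V → (List V → ℤ) → ℕ → Family (List V) t
  cone σs o ω zero    a w = ω (o ∷ w)
  cone σs o ω (suc q) a w = D (maps σs) (cone σs o ω q) a (o ∷ w)

  module Cone {V : Set} {t} (σs : Vec (V → V) t) (action : Action σs) (o : V)
              (ω : List V → ℤ) (closed : ∀ w → ∂ ω w ≈ 0ℤ)
              (invariant : VAll.All (λ σ → ∀ w → ω (map σ w) ≈ ω w) σs) where

    private
      open Action (maps-action action)

      contract : ∀ f w → (∂ f (o ∷ w) ≈ 0ℤ) → ∂ (λ u → f (o ∷ u)) w ≈ f w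
      contract f w h = begin
        ∂ (λ u → f (o ∷ u)) w                     ≡⟨ sym (⊖-⊖-cancel (f w) _) ⟩
        f w ⊖ (f w ⊖ ∂ (λ u → f (o ∷ u)) w)       ≈⟨ sub-cong ≈-refl h ⟩
        f w ⊖ 0ℤ                                  ≡⟨ ⊖-identityʳ _ ⟩
        f w                                       ∎

      ω-all : ∀ {t u} {σs : Vec (V → V) t} → VAll.All (λ σ → ∀ w → ω (map σ w) ≈ ω w) σs →
              VAll.All (λ σ → ∀ (a : Vec ℕ u) w → w ≡ w → ω (σ w) ≈ ω w) (maps σs)
      ω-all = maps-All (λ h a w _ → h w)

    cone-zero : ∀ a w → ∂ (cone σs o ω 0 a) w ≈ ω w
    cone-zero a w = contract ω w (closed (o ∷ w))

    D∂cone : ∀ q a w → D (maps σs) (λ a → ∂ (cone σs o ω q a)) a w ≈ 0ℤ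
    cone-suc : ∀ q a w → ∂ (cone σs o ω (suc q) a) w ≈ D (maps σs) (cone σs o ω q) a w
    D∂cone zero a w = ≈-trans (D-cong (maps σs) cone-zero a w)
      (D-fixed (λ w → w ≡ w) (maps σs) (VAll.universal (λ _ {_} _ → refl) (maps σs)) (λ _ → ω) (ω-all invariant) a w refl)
    D∂cone (suc q) a w = ≈-trans (D-cong (maps σs) (cone-suc q) a w) (DD (maps σs) commuting order (cone σs o ω q) a w)
    cone-suc q a w = contract (D (maps σs) (cone σs o ω q) a) w (≈-trans (∂-D σs (cone σs o ω q) a (o ∷ w)) (D∂cone q a (o ∷ w)))

-- Repetitions and the alternating cocycle.

data Repeat {V : Set} : List V → Set where
  here  : ∀ {v w} → v ∈ w → Repeat (v ∷ w)
  there : ∀ {v w} → Repeat w → Repeat (v ∷ w)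

Repeat-++ : ∀ {V : Set} (s : List V) {w} → Repeat w → Repeat (s ++ w)
Repeat-++ []      r = r
Repeat-++ (x ∷ s) r = there (Repeat-++ s r)

Repeat-map⁻ : ∀ {V W : Set} (φ : V → W) → (∀ {x y} → φ x ≡ φ y → x ≡ y) → ∀ {w} → Repeat (map φ w) → Repeat w
Repeat-map⁻ {V} φ inj {v ∷ w} (here m)  = here (member w m)
  where
  member : ∀ w → φ v ∈ map φ w → v ∈ w
  member (x ∷ w) (here e)  = here (inj e)
  member (x ∷ w) (there m) = there (member w m)
Repeat-map⁻ φ inj {v ∷ w} (there r) = there (Repeat-map⁻ φ inj r)

lookup-repeat : ∀ {V : Set} (w : List V) i j → i Fin.< j → List.lookup w i ≡ List.lookup w j → Repeat w
lookup-repeat (x ∷ w) Fin.zero    (Fin.suc j) _ e = here (subst (_∈ w) (sym e) (∈-lookup j))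
lookup-repeat (x ∷ w) (Fin.suc i) (Fin.suc j) (s≤s l) e = there (lookup-repeat w i j l e)

Fin-repeat : ∀ {n} (w : List (Fin n)) → n < length w → Repeat w
Fin-repeat w l with Fin.pigeonhole l (List.lookup w)
... | i , j , i<j , e = lookup-repeat w i j i<j e

sg-sg : ∀ n a → sg n ⊗ (sg n ⊗ a) ≡ a
sg-sg zero    a = trans (⊗-identityˡ _) (⊗-identityˡ a)
sg-sg (suc n) a = trans (sign-square (sg n) a) (sg-sg n a)

module AlternatingProduct {V : Set} (κ : V → V → ℤ) where

  against : V → List V → ℤ
  against x []      = 1ℤ
  against x (y ∷ w) = κ x y ⊗ against x w

  alt : List V → ℤ
  alt []      = 1ℤ
  alt (x ∷ w) = against x w ⊗ alt w

  module _ (κ-self : ∀ x → κ x x ≡ 0ℤ) where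

    against-member : ∀ {x w} → x ∈ w → against x w ≡ 0ℤ
    against-member {x} {_ ∷ w} (here refl) = trans (cong (_⊗ against x w) (κ-self x)) (⊗-zeroˡ _)
    against-member {x} {y ∷ w} (there m) = trans (cong (κ x y ⊗_) (against-member m)) (⊗-zeroʳ _)

    alt-repeat : ∀ {w} → Repeat w → alt w ≡ 0ℤ
    alt-repeat {v ∷ w} (here m)  = trans (cong (_⊗ alt w) (against-member m)) (⊗-zeroˡ _)
    alt-repeat {v ∷ w} (there r) = trans (cong (against v w ⊗_) (alt-repeat r)) (⊗-zeroʳ _)

  against-insert : ∀ x y s {u} → against x (s ++ y ∷ u) ≡ κ x y ⊗ against x (s ++ u)
  against-insert x y []      = refl
  against-insert x y (z ∷ s) = trans (cong (κ x z ⊗_) (against-insert x y s)) (⊗-⊗-swap (κ x z) (κ x y) _)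

  module _ (κ-antisym : ∀ x y → κ y x ≡ ⊝ κ x y) where

    alt-move : ∀ x s u → alt (x ∷ s ++ u) ≡ sg (length s) ⊗ alt (s ++ x ∷ u)
    alt-move x []      u = sym (⊗-identityˡ _)
    alt-move x (y ∷ s) u = begin
      (κ x y ⊗ against x (s ++ u)) ⊗ (against y (s ++ u) ⊗ alt (s ++ u))
        ≡⟨ ⊗-interchange′ (κ x y) (against x (s ++ u)) (against y (s ++ u)) (alt (s ++ u)) ⟩
      κ x y ⊗ (against y (s ++ u) ⊗ (against x (s ++ u) ⊗ alt (s ++ u)))
        ≡⟨ cong (λ a → κ x y ⊗ (against y (s ++ u) ⊗ a)) (alt-move x s u) ⟩
      κ x y ⊗ (against y (s ++ u) ⊗ (sg (length s) ⊗ alt (s ++ x ∷ u)))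
        ≡⟨ move-id (κ x y) (against y (s ++ u)) (sg (length s)) _ ⟩
      (⊝ sg (length s)) ⊗ (((⊝ κ x y) ⊗ against y (s ++ u)) ⊗ alt (s ++ x ∷ u))
        ≡⟨ cong (λ a → (⊝ sg (length s)) ⊗ (a ⊗ alt (s ++ x ∷ u)))
             (sym (trans (against-insert y x s) (cong (_⊗ against y (s ++ u)) (κ-antisym x y)))) ⟩
      sg (length (y ∷ s)) ⊗ alt (y ∷ s ++ x ∷ u) ∎
      where open ≡-Reasoning

  guard : ∀ {P : Set} → Dec P → ℤ → ℤ
  guard (yes _) a = a
  guard (no _)  a = 0ℤ

  guard-yes : ∀ {P : Set} (D : Dec P) a → P → guard D a ≡ a
  guard-yes (yes _) a x = refl
  guard-yes (no n)  a x = contradiction x n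

  guard-no : ∀ {P : Set} (D : Dec P) a → ¬ P → guard D a ≡ 0ℤ
  guard-no (yes x) a n = contradiction x n
  guard-no (no _)  a n = refl

module Alternating (p : ℕ) {V : Set} (κ : V → V → ℤ) where
  open Mod p
  open AlternatingProduct κ public

  module _ (κ-self : ∀ x → κ x x ≡ 0ℤ) (κ-antisym : ∀ x y → κ y x ≡ ⊝ κ x y) where

    private
      append : ∀ (s : List V) y u → s ++ y ∷ u ≡ (s ++ y ∷ []) ++ u
      append s y u = sym (++-assoc s (y ∷ []) u)

      sg-append : ∀ (s : List V) y → sg (length (s ++ y ∷ [])) ≡ ⊝ sg (length s)
      sg-append []      y = refl
      sg-append (x ∷ s) y = cong ⊝_ (sg-append s y)

    -- Among the faces of x ∷ s ++ w obtained by deleting a vertex of w only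
    -- the deletion of the second copy of x survives.
    ∂-alt-member : ∀ x s w → x ∈ w → ∂ (λ u → alt (x ∷ s ++ u)) w ≈ sg (length s) ⊗ alt (s ++ w)
    ∂-alt-member x s (y ∷ w) (here refl) = begin
      alt (x ∷ s ++ w) ⊖ ∂ (λ u → alt (x ∷ s ++ x ∷ u)) w
        ≈⟨ sub-cong (≈-reflexive (alt-move κ-antisym x s w)) (∂-vanish _ w (λ {u} _ →
             ≈-reflexive (alt-repeat κ-self (here (∈-++⁺ʳ s (here refl)))))) ⟩
      sg (length s) ⊗ alt (s ++ x ∷ w) ⊖ 0ℤ
        ≡⟨ ⊖-identityʳ _ ⟩
      sg (length s) ⊗ alt (s ++ x ∷ w) ∎
    ∂-alt-member x s (y ∷ w) (there m) = begin
      alt (x ∷ s ++ w) ⊖ ∂ (λ u → alt (x ∷ s ++ y ∷ u)) w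
        ≈⟨ sub-cong (≈-reflexive (alt-repeat κ-self (here (∈-++⁺ʳ s m))))
             (∂-cong (λ u → ≈-reflexive (cong (λ l → alt (x ∷ l)) (append s y u))) w) ⟩
      0ℤ ⊖ ∂ (λ u → alt (x ∷ (s ++ y ∷ []) ++ u)) w
        ≈⟨ sub-cong ≈-refl (∂-alt-member x (s ++ y ∷ []) w m) ⟩
      0ℤ ⊖ sg (length (s ++ y ∷ [])) ⊗ alt ((s ++ y ∷ []) ++ w)
        ≡⟨ cong₂ (λ a l → 0ℤ ⊖ a ⊗ alt l) (sg-append s y) (sym (append s y w)) ⟩
      0ℤ ⊖ (⊝ sg (length s)) ⊗ alt (s ++ y ∷ w)
        ≡⟨ ⊝⊝-⊗ (sg (length s)) _ ⟩
      sg (length s) ⊗ alt (s ++ y ∷ w) ∎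

    -- Faces that keep both copies of a repeated vertex contribute nothing. The two faces deleting
    -- one copy differ by moving the other copy into its place, and alternation makes them cancel.
    ∂-alt-repeat : ∀ s w → Repeat w → ∂ (λ u → alt (s ++ u)) w ≈ 0ℤ
    ∂-alt-repeat s (y ∷ w) (here m) = begin
      alt (s ++ w) ⊖ ∂ (λ u → alt (s ++ y ∷ u)) w
        ≈⟨ sub-cong ≈-refl (∂-cong (λ u → ≈-reflexive (trans (sym (sg-sg (length s) _))
             (cong (sg (length s) ⊗_) (sym (alt-move κ-antisym y s u))))) w) ⟩
      alt (s ++ w) ⊖ ∂ (λ u → sg (length s) ⊗ alt (y ∷ s ++ u)) w
        ≈⟨ sub-cong ≈-refl (≈-trans (∂-scale (sg (length s)) (λ u → alt (y ∷ s ++ u)) w)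
             (*-cong ≈-refl (∂-alt-member y s w m))) ⟩
      alt (s ++ w) ⊖ sg (length s) ⊗ (sg (length s) ⊗ alt (s ++ w))
        ≡⟨ cong (alt (s ++ w) ⊖_) (sg-sg (length s) _) ⟩
      alt (s ++ w) ⊖ alt (s ++ w)
        ≡⟨ ⊖-inverse _ ⟩
      0ℤ ∎
    ∂-alt-repeat s (y ∷ w) (there r) = begin
      alt (s ++ w) ⊖ ∂ (λ u → alt (s ++ y ∷ u)) w
        ≈⟨ sub-cong (≈-reflexive (alt-repeat κ-self (Repeat-++ s r)))
             (≈-trans (∂-cong (λ u → ≈-reflexive (cong alt (append s y u))) w) (∂-alt-repeat (s ++ y ∷ []) w r)) ⟩
      0ℤ ⊖ 0ℤ
        ≡⟨ ⊖-zero ⟩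
      0ℤ ∎

  -- For R + 1 = ∣V∣ and an invariant κ, e represents the Euler class of the
  -- reduced permutation module on V; ω m, its m-th cup power, is supported on
  -- tuples of m R + 1 vertices.
  module Euler (R : ℕ) where
    open CupProduct p {V}

    e : List V → ℤ
    e w = guard (length w ℕ.≟ suc R) (alt w)

    ω : ℕ → List V → ℤ
    ω zero    w = guard (length w ℕ.≟ 1) 1ℤ
    ω (suc m) w = cup (m * R) (ω m) e w

    e-full : ∀ w → length w ≡ suc R → e w ≡ alt w
    e-full w l = guard-yes (length w ℕ.≟ suc R) (alt w) l

    ω-split : ∀ m u v c → length u ≡ m * R → length (v ∷ c) ≡ suc R →
              ω (suc m) (u ++ v ∷ c) ≡ ω m (u ++ v ∷ []) ⊗ alt (v ∷ c)
    ω-split m u v c lu lc =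
      trans (cong (λ j → cup j (ω m) e (u ++ v ∷ c)) (sym lu))
        (trans (cup-split (ω m) e u) (cong (ω m (u ++ v ∷ []) ⊗_) (e-full (v ∷ c) lc)))

    module _ (κ-self : ∀ x → κ x x ≡ 0ℤ) (κ-antisym : ∀ x y → κ y x ≡ ⊝ κ x y)
             (pigeonhole : ∀ (w : List V) → suc R < length w → Repeat w) where

      -- Only tuples of R + 2 vertices have faces on which e is not zero by its guard, and those
      -- tuples contain a repetition.
      e-closed : ∀ w → ∂ e w ≈ 0ℤ
      e-closed w with length w ℕ.≟ suc (suc R)
      ... | yes l = begin
        ∂ e w    ≈⟨ ∂-local e alt w (λ {u} x → ≈-reflexive (e-full u (ℕ.suc-injective (trans (sym (Face-length x)) l)))) ⟩
        ∂ alt w  ≈⟨ ∂-alt-repeat κ-self κ-antisym [] w (pigeonhole w (ℕ.≤-reflexive (sym l))) ⟩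
        0ℤ       ∎
      ... | no n = ∂-vanish e w (λ {u} x → ≈-reflexive
        (guard-no (length u ℕ.≟ suc R) (alt u) (λ l → n (trans (Face-length x) (cong suc l)))))

      ω-closed : ∀ m w → ∂ (ω m) w ≈ 0ℤ
      ω-closed zero []              = ≈-refl
      ω-closed zero (v ∷ [])        = ≈-reflexive ⊖-zero
      ω-closed zero (v ∷ u ∷ [])    = ≈-reflexive 1⊖1
      ω-closed zero (v ∷ u ∷ x ∷ w) = ∂-vanish (ω zero) (v ∷ u ∷ x ∷ w) faces
        where
        faces : ∀ {y} → Face y (v ∷ u ∷ x ∷ w) → ω zero y ≈ 0ℤ
        faces {y} f = ≈-reflexive (guard-no (length y ℕ.≟ 1) 1ℤ (λ l → long (trans (Face-length f) (cong suc l))))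
          where
          long : suc (suc (suc (length w))) ≢ 2
          long ()
      ω-closed (suc m) w = cup-closed (m * R) (ω m) e refl (λ u _ → ω-closed m u) e-closed w

    alt-map : ∀ (σ : V → V) → (∀ x y → κ (σ x) (σ y) ≈ κ x y) → ∀ w → alt (map σ w) ≈ alt w
    alt-map σ h []      = ≈-refl
    alt-map σ h (x ∷ w) = *-cong (against-map w) (alt-map σ h w)
      where
      against-map : ∀ w → against (σ x) (map σ w) ≈ against x w
      against-map []      = ≈-refl
      against-map (y ∷ w) = *-cong (h x y) (against-map w)

    ω-map : ∀ (σ : V → V) → (∀ x y → κ (σ x) (σ y) ≈ κ x y) → ∀ m w → ω m (map σ w) ≈ ω m w
    ω-map σ h zero w rewrite length-map σ w = ≈-refl
    ω-map σ h (suc m) w = cup-map σ (m * R) (ω m) (ω m) e e w (ω-map σ h m) e-map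
      where
      e-map : ∀ u → e (map σ u) ≈ e u
      e-map u rewrite length-map σ u with length u ℕ.≟ suc R
      ... | yes _ = alt-map σ h u
      ... | no  _ = ≈-refl

-- The group (ℤ/p)^t and its difference function.

module Cyclic (P : ℕ) where

  p : ℕ
  p = suc P

  open Operators p
  open Invariance p

  next prev : Fin p → Fin p
  next i = fromℕ< (m%n<n (suc (toℕ i)) p)
  prev i = fromℕ< (m%n<n (P + toℕ i) p)

  toℕ-next : ∀ i → toℕ (next i) ≡ suc (toℕ i) % p
  toℕ-next i = Fin.toℕ-fromℕ< _

  toℕ-prev : ∀ i → toℕ (prev i) ≡ (P + toℕ i) % p
  toℕ-prev i = Fin.toℕ-fromℕ< _

  %-absorb : ∀ a b → (a + b % p) % p ≡ (a + b) % p
  %-absorb a b = begin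
    (a + b % p) % p              ≡⟨ %-distribˡ-+ a (b % p) p ⟩
    (a % p + b % p % p) % p      ≡⟨ cong (λ x → (a % p + x) % p) (m%n%n≡m%n b p) ⟩
    (a % p + b % p) % p          ≡⟨ sym (%-distribˡ-+ a b p) ⟩
    (a + b) % p                  ∎
    where open ≡-Reasoning

  toℕ-% : ∀ (i : Fin p) → toℕ i % p ≡ toℕ i
  toℕ-% i = m<n⇒m%n≡m (Fin.toℕ<n i)

  next-prev : ∀ i → next (prev i) ≡ i
  next-prev i = Fin.toℕ-injective (begin
    toℕ (next (prev i))            ≡⟨ toℕ-next (prev i) ⟩
    (1 + toℕ (prev i)) % p         ≡⟨ cong (λ x → (1 + x) % p) (toℕ-prev i) ⟩
    (1 + (P + toℕ i) % p) % p      ≡⟨ %-absorb 1 (P + toℕ i) ⟩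
    (p + toℕ i) % p                ≡⟨ cong (_% p) (ℕ.+-comm p (toℕ i)) ⟩
    (toℕ i + p) % p                ≡⟨ [m+n]%n≡m%n (toℕ i) p ⟩
    toℕ i % p                      ≡⟨ toℕ-% i ⟩
    toℕ i                          ∎)
    where open ≡-Reasoning

  prev-next : ∀ i → prev (next i) ≡ i
  prev-next i = Fin.toℕ-injective (begin
    toℕ (prev (next i))            ≡⟨ toℕ-prev (next i) ⟩
    (P + toℕ (next i)) % p         ≡⟨ cong (λ x → (P + x) % p) (toℕ-next i) ⟩
    (P + (1 + toℕ i) % p) % p      ≡⟨ %-absorb P (1 + toℕ i) ⟩
    (P + suc (toℕ i)) % p          ≡⟨ cong (_% p) (trans (ℕ.+-suc P (toℕ i)) (ℕ.+-comm p (toℕ i))) ⟩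
    (toℕ i + p) % p                ≡⟨ [m+n]%n≡m%n (toℕ i) p ⟩
    toℕ i % p                      ≡⟨ toℕ-% i ⟩
    toℕ i                          ∎)
    where open ≡-Reasoning

  toℕ-iter : ∀ k i → toℕ (iter k next i) ≡ (k + toℕ i) % p
  toℕ-iter zero    i = sym (toℕ-% i)
  toℕ-iter (suc k) i = begin
    toℕ (iter k next (next i))     ≡⟨ toℕ-iter k (next i) ⟩
    (k + toℕ (next i)) % p         ≡⟨ cong (λ x → (k + x) % p) (toℕ-next i) ⟩
    (k + (1 + toℕ i) % p) % p      ≡⟨ %-absorb k (1 + toℕ i) ⟩
    (k + suc (toℕ i)) % p          ≡⟨ cong (_% p) (ℕ.+-suc k (toℕ i)) ⟩
    (suc k + toℕ i) % p            ∎
    where open ≡-Reasoning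

  next-order : ∀ i → iter p next i ≡ i
  next-order i = Fin.toℕ-injective (begin
    toℕ (iter p next i)  ≡⟨ toℕ-iter p i ⟩
    (p + toℕ i) % p      ≡⟨ cong (_% p) (ℕ.+-comm p (toℕ i)) ⟩
    (toℕ i + p) % p      ≡⟨ [m+n]%n≡m%n (toℕ i) p ⟩
    toℕ i % p            ≡⟨ toℕ-% i ⟩
    toℕ i                ∎)
    where open ≡-Reasoning

  open Mod p

  %-≈ : ∀ a → + (a % p) ≈ + a
  %-≈ a = ≈-sym (mod (+ (a / p)) (trans (cong +_ (m≡m%n+[m/n]*n a p))
    (trans (+-hom (a % p) (a / p * p)) (cong (+ (a % p) ⊕_) (*-hom (a / p) p)))))

  diff : Fin p → Fin p → ℤ
  diff i j = + toℕ j ⊖ + toℕ i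

  diff-next : ∀ i j → diff (next i) (next j) ≈ diff i j
  diff-next i j = begin
    + toℕ (next j) ⊖ + toℕ (next i)      ≡⟨ cong₂ (λ x y → + x ⊖ + y) (toℕ-next j) (toℕ-next i) ⟩
    + (suc (toℕ j) % p) ⊖ + (suc (toℕ i) % p) ≈⟨ sub-cong (%-≈ (suc (toℕ j))) (%-≈ (suc (toℕ i))) ⟩
    + suc (toℕ j) ⊖ + suc (toℕ i)        ≡⟨ cong₂ _⊖_ (+-hom 1 (toℕ j)) (+-hom 1 (toℕ i)) ⟩
    (1ℤ ⊕ + toℕ j) ⊖ (1ℤ ⊕ + toℕ i)      ≡⟨ shift-difference (+ toℕ j) (+ toℕ i) ⟩
    + toℕ j ⊖ + toℕ i                    ∎

  ≈0⇒∣ : ∀ {a} → a ≈ 0ℤ → p ∣ℕ ℤ.∣ a ∣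
  ≈0⇒∣ {a} (mod k e) = divides ℤ.∣ k ∣ (trans (cong ℤ.∣_∣ (trans e (⊕-identityˡ _))) (∣⊗∣ k (+ p)))

  diff-nonzero : ∀ {i j} → i ≢ j → ¬ diff i j ≈ 0ℤ
  diff-nonzero {i} {j} i≢j z = i≢j (sym (Fin.toℕ-injective (∣⊖∣≡0 (toℕ j) (toℕ i) (small _ (≈0⇒∣ z)
    (ℕ.≤-<-trans (∣⊖∣≤⊔ (toℕ j) (toℕ i)) (ℕ.⊔-lub (Fin.toℕ<n j) (Fin.toℕ<n i)))))))
    where
    small : ∀ n → p ∣ℕ n → n < p → n ≡ 0
    small zero    _ _ = refl
    small (suc n) d l = contradiction (∣⇒≤ d) (ℕ.<⇒≱ l)

  El : ℕ → Set
  El zero    = ⊤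
  El (suc t) = Fin p × El t

  -- The differences are taken between representatives in ℤ, so antisymmetry is an exact identity,
  -- whereas translation invariance holds only modulo p.
  κ : ∀ t → El t → El t → ℤ
  κ′ : ∀ t {g g′ : Fin p} → Dec (g ≡ g′) → El t → El t → ℤ
  κ zero    x       y         = 0ℤ
  κ (suc t) (g , b) (g′ , b′) = κ′ t (g Fin.≟ g′) b b′
  κ′ t          (yes _) b b′ = κ t b b′
  κ′ t {g} {g′} (no _)  b b′ = diff g g′

  κ-same : ∀ t g b b′ → κ (suc t) (g , b) (g , b′) ≡ κ t b b′
  κ-same t g b b′ with g Fin.≟ g
  ... | yes _ = refl
  ... | no n  = contradiction refl n

  κ-diff : ∀ t {g g′} b b′ → g ≢ g′ → κ (suc t) (g , b) (g′ , b′) ≡ diff g g′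
  κ-diff t {g} {g′} b b′ n with g Fin.≟ g′
  ... | yes e = contradiction e n
  ... | no _  = refl

  κ-self : ∀ t x → κ t x x ≡ 0ℤ
  κ-self zero    x       = refl
  κ-self (suc t) (g , b) = trans (κ-same t g b b) (κ-self t b)

  κ-antisym : ∀ t x y → κ t y x ≡ ⊝ κ t x y
  κ-antisym zero    x       y         = sym ⊝-zero
  κ-antisym (suc t) (g , b) (g′ , b′) with g Fin.≟ g′
  ... | yes refl = trans (κ-same t g b′ b) (κ-antisym t b b′)
  ... | no n     = trans (κ-diff t b′ b (λ e → n (sym e))) (⊝-antisym (+ toℕ g′) (+ toℕ g))

  second : ∀ {t} → (El t → El t) → El (suc t) → El (suc t)
  second σ (g , b) = g , σ b

  first : ∀ {t} → (Fin p → Fin p) → El (suc t) → El (suc t)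
  first σ (g , b) = σ g , b

  shifts : (Fin p → Fin p) → ∀ t → Vec (El t → El t) t
  shifts σ zero    = []
  shifts σ (suc t) = first σ ∷ Vec.map second (shifts σ t)

  κ-invariant : ∀ t → VAll.All (λ σ → ∀ x y → κ t (σ x) (σ y) ≈ κ t x y) (shifts next t)
  κ-invariant zero    = []
  κ-invariant (suc t) = κ-first ∷ lift (κ-invariant t)
    where
    κ-first : ∀ x y → κ (suc t) (first next x) (first next y) ≈ κ (suc t) x y
    κ-first (g , b) (g′ , b′) with g Fin.≟ g′
    ... | yes refl = ≈-reflexive (κ-same t (next g) b b′)
    ... | no n     = ≈-trans (≈-reflexive (κ-diff t b b′ (λ e → n (trans (sym (prev-next g))
                       (trans (cong prev e) (prev-next g′)))))) (diff-next g g′)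
    lift : ∀ {u} {σs : Vec (El t → El t) u} → VAll.All (λ σ → ∀ x y → κ t (σ x) (σ y) ≈ κ t x y) σs →
           VAll.All (λ σ → ∀ x y → κ (suc t) (σ x) (σ y) ≈ κ (suc t) x y) (Vec.map second σs)
    lift []       = []
    lift {σs = σ ∷ σs} (h ∷ hs) = κ-second ∷ lift hs
      where
      κ-second : ∀ x y → κ (suc t) (second σ x) (second σ y) ≈ κ (suc t) x y
      κ-second (g , b) (g′ , b′) with g Fin.≟ g′
      ... | yes refl = h b b′
      ... | no n     = ≈-refl

  iter-first : ∀ {t} k σ (x : El (suc t)) → iter k (first σ) x ≡ (iter k σ (proj₁ x) , proj₂ x)
  iter-first zero    σ x       = refl
  iter-first (suc k) σ (g , b) = iter-first k σ (σ g , b)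

  iter-second : ∀ {t} k σ (x : El (suc t)) → iter k (second σ) x ≡ (proj₁ x , iter k σ (proj₂ x))
  iter-second zero    σ x       = refl
  iter-second (suc k) σ (g , b) = iter-second k σ (g , σ b)

  shifts-action : ∀ t → Action (shifts next t)
  shifts-action t = record { commuting = commuting t ; order = order t }
    where
    second-All : ∀ {t u} {Q : (El t → El t) → Set} {R : (El (suc t) → El (suc t)) → Set} →
                 (∀ {σ} → Q σ → R (second σ)) → {σs : Vec (El t → El t) u} →
                 VAll.All Q σs → VAll.All R (Vec.map second σs)
    second-All h xs = VAll.map⁺ (VAll.map h xs)
    order : ∀ t → VAll.All (λ σ → ∀ v → iter p σ v ≡ v) (shifts next t)
    order zero    = []
    order (suc t) = (λ x → trans (iter-first p next x) (cong (_, proj₂ x) (next-order (proj₁ x))))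
      ∷ second-All (λ {σ} h x → trans (iter-second p σ x) (cong (proj₁ x ,_) (h (proj₂ x)))) (order t)
    commuting : ∀ t → Commuting (shifts next t)
    seconds : ∀ {t u} {σs : Vec (El t → El t) u} → Commuting σs → Commuting (Vec.map second σs)
    seconds []       = []
    seconds (c ∷ cs) = second-All (λ h x → cong (proj₁ x ,_) (h (proj₂ x))) c ∷ seconds cs
    commuting zero    = []
    commuting (suc t) = second-All (λ _ x → refl) (VAll.universal (λ _ → tt) (shifts next t)) ∷ seconds (commuting t)

  index : ∀ {t} → El t → Fin (p ^ t)
  index {zero}  _       = Fin.zero
  index {suc t} (g , b) = combine g (index b)

  element : ∀ {t} → Fin (p ^ t) → El t
  element {zero}  _ = tt
  element {suc t} i = map₂ element (remQuot {p} (p ^ t) i)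

  index-element : ∀ {t} (i : Fin (p ^ t)) → index (element {t} i) ≡ i
  index-element {zero}  Fin.zero = refl
  index-element {suc t} i = trans
    (cong (combine (proj₁ (remQuot {p} (p ^ t) i))) (index-element {t} (proj₂ (remQuot {p} (p ^ t) i))))
    (Fin.combine-remQuot {p} (p ^ t) i)

  element-index : ∀ {t} (x : El t) → element (index x) ≡ x
  element-index {zero}  tt      = refl
  element-index {suc t} (g , b) =
    trans (cong (map₂ element) (Fin.remQuot-combine {p} {p ^ t} g (index b))) (cong (g ,_) (element-index b))

  index-injective : ∀ {t} {x y : El t} → index x ≡ index y → x ≡ y
  index-injective {x = x} {y} e = trans (sym (element-index x)) (trans (cong element e) (element-index y))

  El-repeat : ∀ t (w : List (El t)) → p ^ t < length w → Repeat w
  El-repeat t w l = Repeat-map⁻ index index-injective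
    (Fin-repeat (map index w) (subst (p ^ t <_) (sym (length-map index w)) l))

  _≟El_ : ∀ {t} → DecidableEquality (El t)
  _≟El_ {zero}  tt tt = yes refl
  _≟El_ {suc t} = ≡-dec Fin._≟_ _≟El_

-- Coefficients as sums over walks.

module Walks (p : ℕ) where
  open Mod p
  open Operators p
  open Invariance p

  -- The sum of ω over all tuples obtained from w by prepending q vertices,
  -- each a translate of the one after it, with the coefficients of D.
  W : ∀ {V : Set} {t} → Vec (V → V) t → (List V → ℤ) → ℕ → Vec ℕ t → List V → ℤ
  W τs ω zero    a w       = ω w
  W τs ω (suc q) a []      = 0ℤ
  W τs ω (suc q) a (v ∷ w) = D τs (λ a v′ → W τs ω q a (v′ ∷ v ∷ w)) a v

  -- A walk only ever sees its front vertex, so a completed final part c can be split off with its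
  -- factor k. This separates the blocks of a cup power.
  W-cut : ∀ {V : Set} {t} (τs : Vec (V → V) t) ω ω′ k c q a v x →
          (∀ u → length u ≡ q → ω (u ++ v ∷ x ++ c) ≈ k ⊗ ω′ (u ++ v ∷ x)) →
          W τs ω q a (v ∷ x ++ c) ≈ k ⊗ W τs ω′ q a (v ∷ x)
  W-cut τs ω ω′ k c zero    a v x h = h [] refl
  W-cut τs ω ω′ k c (suc q) a v x h = ≈-trans
    (D-cong τs (λ a v′ → W-cut τs ω ω′ k c q a v′ (v ∷ x) (extend v′)) a v)
    (D-scale τs k (λ a v′ → W τs ω′ q a (v′ ∷ v ∷ x)) a v)
    where
    extend : ∀ v′ u → length u ≡ q → ω (u ++ v′ ∷ v ∷ x ++ c) ≈ k ⊗ ω′ (u ++ v′ ∷ v ∷ x)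
    extend v′ u l = subst₂ (λ y z → ω y ≈ k ⊗ ω′ z) (++-assoc u (v′ ∷ []) (v ∷ x ++ c)) (++-assoc u (v′ ∷ []) (v ∷ x))
      (h (u ++ v′ ∷ []) (trans (length-++ u) (trans (ℕ.+-comm (length u) 1) (cong suc l))))

  W-invariant : ∀ {V : Set} {t} (τs : Vec (V → V) t) ω (σ : V → V) →
                Pointwise (λ τ τ′ → ∀ v → τ (σ v) ≡ σ (τ′ v)) τs τs → (∀ w → ω (map σ w) ≈ ω w) →
                ∀ q a w → W τs ω q a (map σ w) ≈ W τs ω q a w
  W-invariant τs ω σ c h zero    a w       = h w
  W-invariant τs ω σ c h (suc q) a []      = ≈-refl
  W-invariant τs ω σ c h (suc q) a (v ∷ w) = ≈-trans
    (≈-reflexive (D-natural σ c (λ a v′ → W τs ω q a (v′ ∷ σ v ∷ map σ w)) a v))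
    (D-cong τs (λ a v′ → W-invariant τs ω σ c h q a (v′ ∷ v ∷ w)) a v)

  module _ {V : Set} {t} (σs τs : Vec (V → V) t) (o : V) (ω : List V → ℤ)
           (inverse : Pointwise (λ σ τ → ∀ v → σ (τ v) ≡ v) σs τs)
           (W-inv : VAll.All (λ σ → ∀ q a w → W τs ω q a (map σ w) ≈ W τs ω q a w) σs) where

    -- A cone step translates the tuple behind o. By invariance the front vertex may be moved by the
    -- inverse translation instead, and `D-adjoint` makes this a step of the walk.
    cone≈W : ∀ q a w → cone σs o ω q a w ≈ W τs ω q a (o ∷ w)
    cone≈W zero    a w = ≈-refl
    cone≈W (suc q) a w = ≈-trans
      (D-cong (maps σs) (cone≈W q) a (o ∷ w))
      (D-adjoint (λ a s v → W τs ω q a (v ∷ s)) (adjoint inverse W-inv) a (o ∷ w) o)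
      where
      adjoint : ∀ {u} {σs τs′ : Vec (V → V) u} → Pointwise (λ σ τ → ∀ v → σ (τ v) ≡ v) σs τs′ →
                VAll.All (λ σ → ∀ q a w → W τs ω q a (map σ w) ≈ W τs ω q a w) σs →
                Pointwise (λ σ τ → ∀ a s v → W τs ω q a (v ∷ σ s) ≈ W τs ω q a (τ v ∷ s)) (maps σs) τs′
      adjoint []       []       = []
      adjoint {σs = σ ∷ _} {τ ∷ _} (e ∷ es) (i ∷ is) = (λ a s v → ≈-trans
        (≈-reflexive (cong (λ x → W τs ω q a (x ∷ map σ s)) (sym (e v)))) (i q a (τ v ∷ s))) ∷ adjoint es is

  module _ {V : Set} (κ : V → V → ℤ) (R : ℕ) {t} (τs : Vec (V → V) t) where
    open Alternating p κ
    open Euler R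

    W-block : ∀ m a v c → length c ≡ R →
              W τs (ω (suc m)) (m * R) a (v ∷ c) ≈ alt (v ∷ c) ⊗ W τs (ω m) (m * R) a (v ∷ [])
    W-block m a v c l = W-cut τs (ω (suc m)) (ω m) (alt (v ∷ c)) c (m * R) a v []
      (λ u lu → ≈-reflexive (trans (ω-split m u v c lu (cong suc l)) (⊗-comm _ _)))

    -- `F` counts the vertices still missing from the current block. Whatever is prepended, the
    -- repetition ends up inside that block and kills its alternating product.
    W-repeat : (∀ x → κ x x ≡ 0ℤ) → ∀ m F a c → Repeat c → length c + F ≡ suc R →
               W τs (ω (suc m)) (F + m * R) a c ≈ 0ℤ
    W-repeat κ-self m zero a (v ∷ c) r l = ≈-trans
      (W-block m a v c (ℕ.suc-injective (trans (sym (ℕ.+-identityʳ _)) l)))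
      (≈-reflexive (trans (cong (_⊗ W τs (ω m) (m * R) a (v ∷ [])) (alt-repeat κ-self r)) (⊗-zeroˡ _)))
    W-repeat κ-self m (suc F) a (v ∷ c) r l = ≈-trans
      (D-cong τs (λ a v′ → W-repeat κ-self m F a (v′ ∷ v ∷ c) (there r)
        (trans (cong suc (sym (ℕ.+-suc (length c) F))) l)) a v)
      (D-zero τs a v)

-- Powers, parity and arithmetic modulo a prime; the cyclic case.

pow : ℕ → ℤ → ℤ
pow zero    x = 1ℤ
pow (suc n) x = x ⊗ pow n x

pow-⊗ : ∀ n x y → pow n (x ⊗ y) ≡ pow n x ⊗ pow n y
pow-⊗ zero    x y = sym (⊗-identityˡ 1ℤ)
pow-⊗ (suc n) x y = trans (cong ((x ⊗ y) ⊗_) (pow-⊗ n x y)) (⊗-⊗-comm x y _ _)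

pow-zero : ∀ n → pow (suc n) 0ℤ ≡ 0ℤ
pow-zero n = ⊗-zeroˡ _

double : ℕ → ℕ
double zero    = zero
double (suc k) = suc (suc (double k))

double-+ : ∀ k l → double k + double l ≡ double (k + l)
double-+ zero    l = refl
double-+ (suc k) l = cong (λ x → suc (suc x)) (double-+ k l)

double≡+ : ∀ k → double k ≡ k + k
double≡+ zero    = refl
double≡+ (suc k) = cong suc (trans (cong suc (double≡+ k)) (sym (ℕ.+-suc k k)))

double-* : ∀ k l → double k * l ≡ double (k * l)
double-* k l = trans (cong (_* l) (double≡+ k)) (trans (ℕ.*-distribʳ-+ l k k) (sym (double≡+ (k * l))))

module PrimeField (P : ℕ) (prime-p : Prime (suc P)) where
  open Cyclic P
  open Mod p

  ∣⇒≈0 : ∀ a → p ∣ℕ ℤ.∣ a ∣ → a ≈ 0ℤ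
  ∣⇒≈0 a d = mod (proj₁ (∣-multiple a p d)) (proj₂ (∣-multiple a p d))

  ⊗-nonzero : ∀ {a b} → ¬ a ≈ 0ℤ → ¬ b ≈ 0ℤ → ¬ a ⊗ b ≈ 0ℤ
  ⊗-nonzero {a} {b} na nb z with euclidsLemma ℤ.∣ a ∣ ℤ.∣ b ∣ prime-p (subst (p ∣ℕ_) (∣⊗∣ a b) (≈0⇒∣ z))
  ... | inj₁ d = na (∣⇒≈0 a d)
  ... | inj₂ d = nb (∣⇒≈0 b d)

  ≉0-resp : ∀ {a b} → a ≈ b → ¬ b ≈ 0ℤ → ¬ a ≈ 0ℤ
  ≉0-resp e n z = n (≈-trans (≈-sym e) z)

  small-nonzero : ∀ n → suc n < p → ¬ + suc n ≈ 0ℤ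
  small-nonzero n l z = ℕ.<⇒≱ l (∣⇒≤ (≈0⇒∣ z))

  1<p : 1 < p
  1<p = ℕ.nonTrivial⇒n>1 p {{Primality.prime⇒nonTrivial prime-p}}

  pow-nonzero : ∀ n {x} → ¬ x ≈ 0ℤ → ¬ pow n x ≈ 0ℤ
  pow-nonzero zero    nx = small-nonzero 0 1<p
  pow-nonzero (suc n) nx = ⊗-nonzero nx (pow-nonzero n nx)

  data Parity : Set where
    odd : ∀ K → P ≡ double K → Parity
    two : P ≡ 1 → Parity

  parity : Parity
  parity = go (halve P)
    where
    halve : ∀ n → (∃ λ k → n ≡ double k) ⊎ (∃ λ k → n ≡ suc (double k))
    halve zero = inj₁ (0 , refl)
    halve (suc n) with halve n
    ... | inj₁ (k , e) = inj₂ (k , cong suc e)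
    ... | inj₂ (k , e) = inj₁ (suc k , cong suc e)
    double≡*2 : ∀ k → double k ≡ k * 2
    double≡*2 k = trans (double≡+ k) (trans (cong (λ x → k + x) (sym (ℕ.+-identityʳ k))) (ℕ.*-comm 2 k))
    go : (∃ λ k → P ≡ double k) ⊎ (∃ λ k → P ≡ suc (double k)) → Parity
    go (inj₁ (k , e)) = odd k e
    go (inj₂ (k , e)) with Primality.prime⇒irreducible prime-p (divides (suc k) (cong suc (trans e (cong suc (double≡*2 k)))))
    ... | inj₂ e₂ = two (ℕ.suc-injective (sym e₂))

  open Operators p
  open Invariance p
  open Walks p

  iter-shift : ∀ {S : Set} l (σ : S → S) x → iter l σ (σ x) ≡ σ (iter l σ x)
  iter-shift zero    σ x = refl
  iter-shift (suc l) σ x = iter-shift l σ (σ x)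

  iter-+ : ∀ {S : Set} k l (σ : S → S) x → iter k σ (iter l σ x) ≡ iter (k + l) σ x
  iter-+ zero    l σ x = refl
  iter-+ (suc k) l σ x = trans (cong (iter k σ) (sym (iter-shift l σ x))) (iter-+ k l σ (σ x))

  next-free : ∀ i x → suc i < p → iter (suc i) next x ≢ x
  next-free i x i< e = ℕ.<⇒≱ i< (∣⇒≤ (divides q (ℕ.+-cancelʳ-≡ (toℕ x) (suc i) (q * p) sum)))
    where
    q : ℕ
    q = (suc i + toℕ x) / p
    sum : suc i + toℕ x ≡ q * p + toℕ x
    sum = trans (m≡m%n+[m/n]*n (suc i + toℕ x) p)
      (trans (cong (_+ q * p) (trans (sym (toℕ-iter (suc i) x)) (cong toℕ e))) (ℕ.+-comm (toℕ x) (q * p)))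

  next-distinct : ∀ k l x → k < l → l < p → iter k next x ≢ iter l next x
  next-distinct k l x k<l l<p e with ℕ.m≤n⇒∃[o]m+o≡n k<l
  ... | o , refl = next-free o (iter k next x) (ℕ.≤-<-trans (s≤s (ℕ.m≤n+m o k)) l<p)
    (trans (iter-+ (suc o) k next x) (trans (cong (λ n → iter (suc n) next x) (ℕ.+-comm o k)) (sym e)))

  next-transitive : ∀ x y → ∃ λ k → iter k next x ≡ y
  next-transitive x y = toℕ y + (p ∸ toℕ x) , Fin.toℕ-injective (trans
    (toℕ-iter (toℕ y + (p ∸ toℕ x)) x)
    (trans (cong (_% p) (trans (ℕ.+-assoc (toℕ y) (p ∸ toℕ x) (toℕ x))
             (cong (λ n → toℕ y + n) (ℕ.m∸n+n≡m (ℕ.<⇒≤ (Fin.toℕ<n x))))))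
      (trans ([m+n]%n≡m%n (toℕ y) p) (toℕ-% y))))
  prev-iter : ∀ k x → iter k prev (iter k next x) ≡ x
  prev-iter zero    x = refl
  prev-iter (suc k) x = trans (cong (λ y → iter k prev (prev y)) (iter-shift k next x))
    (trans (cong (iter k prev) (prev-next _)) (prev-iter k x))

  next-iter : ∀ k x → iter k next (iter k prev x) ≡ x
  next-iter zero    x = refl
  next-iter (suc k) x = trans (cong (λ y → iter k next (next y)) (iter-shift k prev x))
    (trans (cong (iter k next) (next-prev _)) (next-iter k x))

  prev-order : ∀ x → iter p prev x ≡ x
  prev-order x = trans (cong (iter p prev) (sym (next-order x))) (prev-iter p x)

  orb-base : ∀ (f : Fin p → ℤ) x y → orb p prev f x ≡ orb p prev f y
  orb-base f x y with next-transitive x y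
  ... | k , refl = go k x
    where
    step : ∀ z → orb p prev f z ≡ orb p prev f (next z)
    step z = ⊖-injective _ _ (shift-⊖ _ _ (f (next z))
      (trans (cong (λ x → orb p prev f x ⊕ f (next z)) (sym (prev-next z)))
        (trans (orb-shift prev p f (next z)) (cong (λ x → orb p prev f (next z) ⊕ f x) (prev-order (next z))))))
    go : ∀ k z → orb p prev f z ≡ orb p prev f (iter k next z)
    go zero    z = refl
    go (suc k) z = trans (step z) (go k (next z))

  indicator : Fin p → Fin p → ℤ
  indicator y z with z Fin.≟ y
  ... | yes _ = 1ℤ
  ... | no  _ = 0ℤ

  indicator-sum : ∀ y x → orb p prev (indicator y) x ≡ 1ℤ
  indicator-sum y x = trans (orb-base (indicator y) x y)
    (trans (cong₂ _⊕_ at-y (rest P (prev y) away)) (⊕-identityʳ 1ℤ))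
    where
    at-y : indicator y y ≡ 1ℤ
    at-y with y Fin.≟ y
    ... | yes _ = refl
    ... | no n  = contradiction refl n
    off-y : ∀ z → z ≢ y → indicator y z ≡ 0ℤ
    off-y z n with z Fin.≟ y
    ... | yes e = contradiction e n
    ... | no _  = refl
    rest : ∀ k z → (∀ i → i < k → iter i prev z ≢ y) → orb k prev (indicator y) z ≡ 0ℤ
    rest zero    z h = refl
    rest (suc k) z h = trans (cong₂ _⊕_ (off-y z (h 0 (s≤s z≤n))) (rest k (prev z) (λ i l → h (suc i) (s≤s l)))) ⊕-zero
    away : ∀ i → i < P → iter i prev (prev y) ≢ y
    away i l e = next-free i y (s≤s l) (trans (cong (iter (suc i) next) (sym e)) (next-iter (suc i) y))

  -- Evaluation of the cup powers of the Euler class for the cyclic group.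
  -- For odd p the surviving walks tile ℤ/p minus a point by pairs of
  -- neighbours; covering the neighbour of the starting point first shows that
  -- they contribute K! equal terms, p = 2K + 1.
  module CyclicEvaluation
    (κ : Fin p → Fin p → ℤ) (κ-self : ∀ x → κ x x ≡ 0ℤ)
    (κ-balanced : ∀ a b c d → κ a c ⊗ κ a d ⊗ (κ b c ⊗ κ b d) ≡ κ c a ⊗ κ c b ⊗ (κ d a ⊗ κ d b))
    (κ-nonzero : ∀ {x y} → x ≢ y → ¬ κ x y ≈ 0ℤ)
    (κ-next : ∀ x y → κ (next x) (next y) ≈ κ x y) where

    open Alternating p κ
    open Euler P

    -- Exchanging two adjacent pairs reverses four factors. `κ-balanced` says that no sign results;
    -- it holds for every power of an antisymmetric function, whatever its parity.
    alt-swap : ∀ l a b c d w → alt (l ++ a ∷ b ∷ c ∷ d ∷ w) ≡ alt (l ++ c ∷ d ∷ a ∷ b ∷ w)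
    alt-swap [] a b c d w = trans
      (pair-swap (κ a b) (κ a c) (κ a d) (κ b c) (κ b d) (κ c d) _ _ _ _ _)
      (trans (cong (_⊗ rest) (κ-balanced a b c d))
        (sym (pair-swap′ (κ a b) (κ c a) (κ c b) (κ d a) (κ d b) (κ c d) _ _ _ _ _)))
      where
      rest : ℤ
      rest = (κ a b ⊗ against a w) ⊗ (against b w ⊗ ((κ c d ⊗ against c w) ⊗ (against d w ⊗ alt w)))
    alt-swap (x ∷ l) a b c d w = cong₂ _⊗_ (against-pairs l) (alt-swap l a b c d w)
      where
      against-pairs : ∀ l → against x (l ++ a ∷ b ∷ c ∷ d ∷ w) ≡ against x (l ++ c ∷ d ∷ a ∷ b ∷ w)
      against-pairs []      = against-swap (κ x a) (κ x b) (κ x c) (κ x d) _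
      against-pairs (y ∷ l) = cong (κ x y ⊗_) (against-pairs l)

    -- The walk sum after 2 j steps, stripped of repeated vertices: the norm selects y, and σ - 1
    -- has to move on to `prev y`.
    S : ℕ → List (Fin p) → ℤ
    S zero    c = alt c
    S (suc j) c = orb p prev (λ y → S j (prev y ∷ y ∷ c)) Fin.zero

    orb-zero : ∀ k f x → (∀ y → f y ≈ 0ℤ) → orb k prev f x ≈ 0ℤ
    orb-zero k f x h = ≈-trans (Linear.T-cong (orb-linear prev k) h x) (Linear.T-zero (orb-linear prev k) x)

    S-repeat : ∀ j c → Repeat c → S j c ≈ 0ℤ
    S-repeat zero    c r = ≈-reflexive (alt-repeat κ-self r)
    S-repeat (suc j) c r = orb-zero p _ Fin.zero (λ y → S-repeat j _ (there (there r)))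

    S-swap : ∀ j l a b c d w → S j (l ++ a ∷ b ∷ c ∷ d ∷ w) ≈ S j (l ++ c ∷ d ∷ a ∷ b ∷ w)
    S-swap zero    l a b c d w = ≈-reflexive (alt-swap l a b c d w)
    S-swap (suc j) l a b c d w =
      Linear.T-cong (orb-linear prev p) (λ y → S-swap j (prev y ∷ y ∷ l) a b c d w) Fin.zero

    -- j S_{j-1}, read as 0 for j = 0.
    N : ℕ → List (Fin p) → ℤ
    N zero    c = 0ℤ
    N (suc j) c = + suc j ⊗ S j c

    N-repeat : ∀ j c → Repeat c → N j c ≈ 0ℤ
    N-repeat zero    c r = ≈-refl
    N-repeat (suc j) c r = ≈-trans (*-cong ≈-refl (S-repeat j c r)) (≈-reflexive (⊗-zeroʳ _))

    N-swap : ∀ j a b c d w → N j (a ∷ b ∷ c ∷ d ∷ w) ≈ N j (c ∷ d ∷ a ∷ b ∷ w)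
    N-swap zero    a b c d w = ≈-refl
    N-swap (suc j) a b c d w = *-cong ≈-refl (S-swap j [] a b c d w)

    orb-N : ∀ j c → orb p prev (λ y → N j (prev y ∷ y ∷ c)) Fin.zero ≈ + j ⊗ S j c
    orb-N zero    c = ≈-trans (orb-zero p _ Fin.zero (λ _ → ≈-refl)) (≈-reflexive (sym (⊗-zeroˡ _)))
    orb-N (suc j) c = Linear.T-scale (orb-linear prev p) (+ suc j) (λ y → S j (prev y ∷ y ∷ c)) Fin.zero

    -- In a nonzero term some pair covers `prev y`. It cannot be the pair ending there, whose other
    -- vertex `prev (prev y)` is already taken, so it is (`prev y`, y). It may come at any of the j
    -- stages, and pairs commute; this gives the factor j in `N`.
    S-pair : ∀ j c y → prev (prev y) ∈ c → prev y ∉ c → length c + double j ≡ p → S j c ≈ N j (prev y ∷ y ∷ c)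
    -- With no pair left, c has p entries and misses `prev y`, so it must repeat something.
    S-pair zero c y _ u∉ l with Fin-repeat (prev y ∷ c) (ℕ.≤-reflexive (cong suc (trans (sym l) (ℕ.+-identityʳ _))))
    ... | here u∈ = contradiction u∈ u∉
    ... | there r = ≈-reflexive (alt-repeat κ-self r)
    S-pair (suc j) c y x∈ u∉ l = begin
      orb p prev (λ z → S j (prev z ∷ z ∷ c)) Fin.zero
        ≈⟨ Linear.T-cong (orb-linear prev p) split Fin.zero ⟩
      orb p prev (λ z → indicator y z ⊗ G ⊕ N j (prev z ∷ z ∷ c′)) Fin.zero
        ≈⟨ Linear.T-add (orb-linear prev p) (λ z → indicator y z ⊗ G) (λ z → N j (prev z ∷ z ∷ c′)) Fin.zero ⟩
      orb p prev (λ z → indicator y z ⊗ G) Fin.zero ⊕ orb p prev (λ z → N j (prev z ∷ z ∷ c′)) Fin.zero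
        ≈⟨ +-cong (≈-trans (Linear.T-cong (orb-linear prev p) (λ z → ≈-reflexive (⊗-comm _ G)) Fin.zero)
             (≈-trans (Linear.T-scale (orb-linear prev p) G (indicator y) Fin.zero)
               (*-cong ≈-refl (≈-reflexive (indicator-sum y Fin.zero))))) (orb-N j c′) ⟩
      G ⊗ 1ℤ ⊕ + j ⊗ G
        ≡⟨ trans (cong (_⊕ (+ j ⊗ G)) (⊗-identityʳ G)) (sym (⊗-suc j G)) ⟩
      + suc j ⊗ G ∎
      where
      c′ : List (Fin p)
      c′ = prev y ∷ y ∷ c
      G : ℤ
      G = S j c′
      split : ∀ z → S j (prev z ∷ z ∷ c) ≈ indicator y z ⊗ G ⊕ N j (prev z ∷ z ∷ c′)
      split z with z Fin.≟ y
      ... | yes refl = ≈-trans (≈-reflexive (sym (pick-one G)))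
        (+-cong ≈-refl (≈-sym (N-repeat j _ (here (there (here refl))))))
      ... | no z≢y with z Fin.≟ prev y
      -- The excluded pair: it would use `prev (prev y)` a second time.
      ...   | yes refl = ≈-trans (S-repeat j _ (here (there x∈))) (≈-trans (≈-sym (N-repeat j _ (there (here (here refl)))))
                (≈-reflexive (sym (pick-none G _))))
      ...   | no z≢u = begin
        S j (prev z ∷ z ∷ c)
          ≈⟨ S-pair j (prev z ∷ z ∷ c) y (there (there x∈)) fresh
               (trans (cong suc (trans (sym (ℕ.+-suc (length c) _)) refl)) (trans (sym (ℕ.+-suc (length c) _)) l)) ⟩
        N j (prev y ∷ y ∷ prev z ∷ z ∷ c)
          ≈⟨ N-swap j _ _ _ _ c ⟩
        N j (prev z ∷ z ∷ c′)
          ≡⟨ sym (pick-none G _) ⟩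
        0ℤ ⊗ G ⊕ N j (prev z ∷ z ∷ c′) ∎
        where
        fresh : prev y ∉ prev z ∷ z ∷ c
        fresh (here e)          = z≢y (trans (sym (next-prev z)) (trans (cong next (sym e)) (next-prev y)))
        fresh (there (here e))  = z≢u (sym e)
        fresh (there (there m)) = u∉ m

    -- c fills the arc from z to its L-th successor. Applying `S-pair` just beyond the arc lengthens
    -- it by two and yields the factor j, a unit because j < p; new vertices are distinct from old
    -- ones, so `alt` stays a unit.
    S-nonzero : ∀ j L c z → length c ≡ suc L → length c + double j ≡ p → iter L next z ∈ c →
                All (λ x → ∃ λ k → k ≤ L × x ≡ iter k next z) c → ¬ alt c ≈ 0ℤ → ¬ S j c ≈ 0ℤ
    S-nonzero zero    L c z lc l top∈ all nz = nz
    S-nonzero (suc j) L c z lc l top∈ all nz =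
      ≉0-resp (S-pair (suc j) c y (subst (_∈ c) (sym prev²) top∈) (subst (_∉ c) (sym prev¹) (absent 0 0<)) l)
        (⊗-nonzero (small-nonzero j (ℕ.≤-<-trans (≤-double j) bound))
          (S-nonzero j (suc (suc L)) (prev y ∷ y ∷ c) z (cong suc (cong suc lc))
            (trans (cong suc (sym (ℕ.+-suc (length c) _))) (trans (sym (ℕ.+-suc (length c) _)) l))
            (there (here (iter-next² L z)))
            ((suc L , ℕ.n≤1+n _ , trans prev¹ (sym (iter-shift L next z))) ∷ (suc (suc L) , ℕ.≤-refl , sym (iter-next² L z)) ∷
              All.map (λ (k , k≤ , e) → k , ℕ.m≤n⇒m≤1+n (ℕ.m≤n⇒m≤1+n k≤) , e) all)
            (alt-extend (prev y) (y ∷ c) (λ { (here e) → distinct-prev e ; (there m) → subst (_∉ c) (sym prev¹) (absent 0 0<) m })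
              (alt-extend y c (absent 1 1<) nz))))
      where
      y : Fin p
      y = next (next (iter L next z))
      ≤-double : ∀ j → suc j ≤ suc (double j)
      ≤-double zero    = s≤s z≤n
      ≤-double (suc j) = s≤s (ℕ.m≤n⇒m≤1+n (≤-double j))
      iter-next² : ∀ k x → iter (suc (suc k)) next x ≡ next (next (iter k next x))
      iter-next² k x = trans (iter-shift (suc k) next x) (cong next (iter-shift k next x))
      prev¹ : prev y ≡ next (iter L next z)
      prev¹ = prev-next _
      prev² : prev (prev y) ≡ iter L next z
      prev² = trans (cong prev prev¹) (prev-next _)
      size : suc L + suc (suc (double j)) ≡ p
      size = trans (cong (_+ suc (suc (double j))) (sym lc)) l
      1< : suc (suc L) < p
      1< = subst (suc (suc (suc L)) ≤_) size (ℕ.≤-trans (ℕ.≤-reflexive (trans (cong suc (ℕ.+-comm 2 L)) refl))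
             (s≤s (ℕ.+-monoʳ-≤ L (s≤s (s≤s z≤n)))))
      0< : suc L < p
      0< = ℕ.<-trans (ℕ.n<1+n _) 1<
      bound : suc (double j) < p
      bound = subst (suc (suc (double j)) ≤_) size (ℕ.m≤n+m _ (suc L))
      absent : ∀ i → suc i + L < p → iter (suc i) next (iter L next z) ∉ c
      absent i b m with All.lookup all m
      ... | k , k≤L , e = next-distinct k (suc i + L) z (ℕ.≤-<-trans k≤L (ℕ.m<n+m L (s≤s z≤n))) b
        (trans (sym e) (iter-+ (suc i) L next z))
      distinct-prev : prev y ≢ y
      distinct-prev e = next-free 0 (prev y) (ℕ.≤-<-trans (s≤s z≤n) 0<) (trans (next-prev y) (sym e))
      alt-extend : ∀ x w → x ∉ w → ¬ alt w ≈ 0ℤ → ¬ alt (x ∷ w) ≈ 0ℤ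
      alt-extend x w n nw = ⊗-nonzero (against-nonzero w n) nw
        where
        against-nonzero : ∀ w → x ∉ w → ¬ against x w ≈ 0ℤ
        against-nonzero []      n = small-nonzero 0 (ℕ.≤-<-trans (s≤s z≤n) 0<)
        against-nonzero (v ∷ w) n = ⊗-nonzero (κ-nonzero (λ e → n (here e))) (against-nonzero w (λ m → n (there m)))

    Wᴬ : (List (Fin p) → ℤ) → ℕ → List (Fin p) → ℤ
    Wᴬ ω n = W (prev ∷ []) ω n (n ∷ [])

    Wᴬ-step : ∀ ω n v w → Wᴬ ω (suc n) (v ∷ w) ≡ d n prev (λ v′ → Wᴬ ω n (v′ ∷ v ∷ w)) v
    Wᴬ-step ω n v w = drop-zero _ _

    Wᴬ-const : ∀ m n v v′ → Wᴬ (ω m) n (v ∷ []) ≈ Wᴬ (ω m) n (v′ ∷ [])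
    Wᴬ-const m n v v′ with next-transitive v v′
    ... | k , refl = go k v
      where
      go : ∀ k v → Wᴬ (ω m) n (v ∷ []) ≈ Wᴬ (ω m) n (iter k next v ∷ [])
      go zero    v = ≈-refl
      go (suc k) v = ≈-trans (≈-sym (W-invariant (prev ∷ []) (ω m) next
        ((λ v → trans (prev-next v) (sym (next-prev v))) ∷ []) (ω-map next κ-next m) n (n ∷ []) (v ∷ []))) (go k (next v))

    Wᴬ-block : ∀ m v c → length c ≡ P → Wᴬ (ω (suc m)) (m * P) (v ∷ c) ≈ alt (v ∷ c) ⊗ Wᴬ (ω m) (m * P) (Fin.zero ∷ [])
    Wᴬ-block m v c l = ≈-trans (W-block κ P (prev ∷ []) m (m * P ∷ []) v c l)
      (*-cong ≈-refl (Wᴬ-const m (m * P) v Fin.zero))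

    -- As P is even, so is q: the first of two consecutive differentials is the norm, the second is
    -- σ - 1. The unmoved term of the latter repeats y and drops out, leaving the pairs of `S`.
    Wᴬ-pairs : ∀ K → P ≡ double K → ∀ j m v c → length (v ∷ c) + double j ≡ p →
               Wᴬ (ω (suc m)) (double j + m * P) (v ∷ c) ≈ S j (v ∷ c) ⊗ Wᴬ (ω m) (m * P) (Fin.zero ∷ [])
    Wᴬ-pairs K P≡ zero m v c l = Wᴬ-block m v c (ℕ.suc-injective (trans (sym (ℕ.+-identityʳ _)) l))
    Wᴬ-pairs K P≡ (suc j) m v c l = begin
      Wᴬ (ω (suc m)) (suc (suc q)) (v ∷ c)
        ≡⟨ Wᴬ-step _ (suc q) v c ⟩
      d (suc q) prev (λ y → Wᴬ (ω (suc m)) (suc q) (y ∷ v ∷ c)) v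
        ≡⟨ d-suc-even ⟩
      orb p prev (λ y → Wᴬ (ω (suc m)) (suc q) (y ∷ v ∷ c)) v
        ≈⟨ Linear.T-cong (orb-linear prev p) inner v ⟩
      orb p prev (λ y → U ⊗ S j (prev y ∷ y ∷ v ∷ c)) v
        ≈⟨ Linear.T-scale (orb-linear prev p) U (λ y → S j (prev y ∷ y ∷ v ∷ c)) v ⟩
      U ⊗ orb p prev (λ y → S j (prev y ∷ y ∷ v ∷ c)) v
        ≡⟨ trans (⊗-comm U _) (cong (_⊗ U) (orb-base (λ y → S j (prev y ∷ y ∷ v ∷ c)) v Fin.zero)) ⟩
      S (suc j) (v ∷ c) ⊗ U ∎
      where
      q : ℕ
      q = double j + m * P
      U : ℤ
      U = Wᴬ (ω m) (m * P) (Fin.zero ∷ [])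
      even-* : ∀ m → ∃ λ k → m * P ≡ double k
      even-* zero    = 0 , refl
      even-* (suc m) with even-* m
      ... | k , e = K + k , trans (cong₂ _+_ P≡ e) (double-+ K k)
      half : ∃ λ k → q ≡ double k
      half with even-* m
      ... | k , e = j + k , trans (cong (λ x → double j + x) e) (double-+ j k)
      d-double : ∀ k (f : Fin p → ℤ) x → d (double k) prev f x ≡ f (prev x) ⊖ f x
      d-double zero    f x = refl
      d-double (suc k) f x = d-double k f x
      d-suc-double : ∀ k (f : Fin p → ℤ) x → d (suc (double k)) prev f x ≡ orb p prev f x
      d-suc-double zero    f x = refl
      d-suc-double (suc k) f x = d-suc-double k f x
      d-suc-even : ∀ {f : Fin p → ℤ} {x} → d (suc q) prev f x ≡ orb p prev f x
      d-suc-even {f} {x} = trans (cong (λ n → d (suc n) prev f x) (proj₂ half)) (d-suc-double (proj₁ half) f x)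
      d-even : ∀ (f : Fin p → ℤ) x → d q prev f x ≡ f (prev x) ⊖ f x
      d-even f x = trans (cong (λ n → d n prev f x) (proj₂ half)) (d-double (proj₁ half) f x)
      size : length (v ∷ c) + suc (suc (double j)) ≡ suc (suc (length (v ∷ c))) + double j
      size = trans (ℕ.+-suc (length (v ∷ c)) _) (cong suc (ℕ.+-suc (length (v ∷ c)) _))
      inner : ∀ y → Wᴬ (ω (suc m)) (suc q) (y ∷ v ∷ c) ≈ U ⊗ S j (prev y ∷ y ∷ v ∷ c)
      inner y = begin
        Wᴬ (ω (suc m)) (suc q) (y ∷ v ∷ c)
          ≡⟨ trans (Wᴬ-step _ q y (v ∷ c)) (d-even _ y) ⟩
        Wᴬ (ω (suc m)) q (prev y ∷ y ∷ v ∷ c) ⊖ Wᴬ (ω (suc m)) q (y ∷ y ∷ v ∷ c)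
          ≈⟨ sub-cong (Wᴬ-pairs K P≡ j m (prev y) (y ∷ v ∷ c) (trans (sym size) l))
               (W-repeat κ P (prev ∷ []) κ-self m (double j) (q ∷ []) (y ∷ y ∷ v ∷ c) (here (here refl)) (trans (sym size) l)) ⟩
        S j (prev y ∷ y ∷ v ∷ c) ⊗ U ⊖ 0ℤ
          ≡⟨ trans (⊖-identityʳ _) (⊗-comm _ U) ⟩
        U ⊗ S j (prev y ∷ y ∷ v ∷ c) ∎

    cyclic-nonzero : ∀ m v → ¬ Wᴬ (ω m) (m * P) (v ∷ []) ≈ 0ℤ
    cyclic-nonzero zero    v = small-nonzero 0 1<p
    cyclic-nonzero (suc m) v with parity
    ... | odd K P≡ = ≉0-resp
      (subst (λ n → Wᴬ (ω (suc m)) (n + m * P) (v ∷ []) ≈ S K (v ∷ []) ⊗ Wᴬ (ω m) (m * P) (Fin.zero ∷ []))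
        (sym P≡) (Wᴬ-pairs K P≡ K m v [] (cong suc (sym P≡))))
      (⊗-nonzero (S-nonzero K 0 (v ∷ []) v refl (cong suc (sym P≡)) (here refl) ((0 , z≤n , refl) ∷ [])
        (≉0-resp (≈-reflexive (⊗-identityˡ 1ℤ)) (small-nonzero 0 1<p))) (cyclic-nonzero m Fin.zero))
    ... | two P≡ = ≉0-resp
      (subst (λ n → Wᴬ (ω (suc m)) (n + m * P) (v ∷ []) ≈ alt (prev v ∷ v ∷ []) ⊗ Wᴬ (ω m) (m * P) (Fin.zero ∷ []))
        (sym P≡) step)
      (⊗-nonzero (⊗-nonzero (⊗-nonzero (κ-nonzero prev≢) (small-nonzero 0 1<p))
        (≉0-resp (≈-reflexive (⊗-identityˡ 1ℤ)) (small-nonzero 0 1<p))) (cyclic-nonzero m Fin.zero))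
      where
      prev≢ : prev v ≢ v
      prev≢ e = next-free 0 (prev v) 1<p (trans (next-prev v) (sym e))
      f : Fin p → ℤ
      f v′ = Wᴬ (ω (suc m)) (m * P) (v′ ∷ v ∷ [])
      fv : f v ≈ 0ℤ
      fv = W-repeat κ P (prev ∷ []) κ-self m 0 (m * P ∷ []) (v ∷ v ∷ []) (here (here refl)) (cong suc (sym P≡))
      -- For p = 2 the differentials f (prev v) - f v and f v + f (prev v) agree here, since f v
      -- contains a repetition.
      d-either : ∀ n → d n prev f v ≈ f (prev v)
      d-either zero          = ≈-trans (sub-cong ≈-refl fv) (≈-reflexive (⊖-identityʳ _))
      d-either (suc zero)    = ≈-trans
        (≈-reflexive (cong (λ n → f v ⊕ orb n prev f (prev v)) P≡))
        (≈-trans (+-cong fv ≈-refl) (≈-reflexive (two-terms _)))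
      d-either (suc (suc n)) = d-either n
      step : Wᴬ (ω (suc m)) (1 + m * P) (v ∷ []) ≈ alt (prev v ∷ v ∷ []) ⊗ Wᴬ (ω m) (m * P) (Fin.zero ∷ [])
      step = begin
        Wᴬ (ω (suc m)) (suc (m * P)) (v ∷ [])   ≡⟨ Wᴬ-step _ (m * P) v [] ⟩
        d (m * P) prev f v                      ≈⟨ d-either (m * P) ⟩
        f (prev v)                              ≈⟨ Wᴬ-block m (prev v) (v ∷ []) (sym P≡) ⟩
        alt (prev v ∷ v ∷ []) ⊗ Wᴬ (ω m) (m * P) (Fin.zero ∷ []) ∎

-- Induction on the rank of the group.

Repeat-map : ∀ {V W : Set} (φ : V → W) {w} → Repeat w → Repeat (map φ w)
Repeat-map φ (here m)  = here (∈-map⁺ φ m)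
Repeat-map φ (there r) = there (Repeat-map φ r)

Repeat-++ʳ : ∀ {V : Set} {w : List V} v → Repeat w → Repeat (w ++ v)
Repeat-++ʳ v (here m)  = here (∈-++⁺ˡ m)
Repeat-++ʳ v (there r) = there (Repeat-++ʳ v r)

Repeat-common : ∀ {V : Set} {x : V} (u v : List V) → x ∈ u → x ∈ v → Repeat (u ++ v)
Repeat-common (y ∷ u) v (here refl) m = here (∈-++⁺ʳ u m)
Repeat-common (y ∷ u) v (there k)   m = there (Repeat-common u v k m)

data RepeatSplit {V : Set} (u v : List V) : Set where
  left   : Repeat u → RepeatSplit u v
  right  : Repeat v → RepeatSplit u v
  both   : ∀ {x} → x ∈ u → x ∈ v → RepeatSplit u v

Repeat-split : ∀ {V : Set} (u v : List V) → Repeat (u ++ v) → RepeatSplit u v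
Repeat-split []      v r = right r
Repeat-split (x ∷ u) v (here m) with ∈-++⁻ u m
... | inj₁ k = left (here k)
... | inj₂ k = both (here refl) k
Repeat-split (x ∷ u) v (there r) with Repeat-split u v r
... | left k     = left (there k)
... | right k    = right k
... | both k l  = both (there k) l

module TowerEvaluation (P : ℕ) (prime-p : Prime (suc P)) where
  open PrimeField P prime-p
  open Cyclic P
  open Mod p
  open Operators p
  open Invariance p
  open Walks p

  -- p^t - 1, arranged for the induction: after one vertex of a block, R t more complete its column,
  -- and P columns of R t + 1 vertices follow.
  R : ℕ → ℕ
  R zero    = 0
  R (suc t) = R t + P * suc (R t)

  R-size : ∀ t → p ^ t ≡ suc (R t)
  R-size zero    = refl
  R-size (suc t) = cong (p *_) (R-size t)

  El-pigeonhole : ∀ t (w : List (El t)) → suc (R t) < length w → Repeat w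
  El-pigeonhole t w l = El-repeat t w (subst (_< length w) (sym (R-size t)) l)

  Ω : ∀ t → ℕ → List (El t) → ℤ
  Ω t = Alternating.Euler.ω p (κ t) (R t)

  Wᴱ : ∀ t → (List (El t) → ℤ) → ℕ → Vec ℕ t → List (El t) → ℤ
  Wᴱ t = W (shifts prev t)

  -- The exponents of the lexicographically leading monomial of the m-th power
  -- of the Euler class.
  leading : ∀ t → ℕ → Vec ℕ t
  leading zero    m = []
  leading (suc t) m = m * P ∷ leading t (m * p)

  pow-cong : ∀ n {x y} → x ≈ y → pow n x ≈ pow n y
  pow-cong zero    e = ≈-refl
  pow-cong (suc n) e = *-cong e (pow-cong n e)

  -- R t is even for odd p, and -1 is 1 modulo 2. Hence the signs of the R t steps inside a complete
  -- column multiply to 1.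
  pow-R : ∀ t n → pow (R t) (sg n) ≈ 1ℤ
  pow-R t n with parity
  ... | odd K P≡ = ≈-reflexive (trans (cong (λ k → pow k (sg n)) (proj₂ (even t))) (pow-even (proj₁ (even t))))
    where
    pow-even : ∀ k → pow (double k) (sg n) ≡ 1ℤ
    pow-even zero    = refl
    pow-even (suc k) = trans (sg-sg n _) (pow-even k)
    even : ∀ t → ∃ λ k → R t ≡ double k
    even zero    = 0 , refl
    even (suc t) with even t
    ... | k , e = k + K * suc (R t) ,
      trans (cong₂ _+_ e (trans (cong (_* suc (R t)) P≡) (double-* K (suc (R t))))) (double-+ k _)
  ... | two P≡ = pow-one (R t)
    where
    minus-one : ⊝ 1ℤ ≈ 1ℤ
    minus-one = mod (⊝ 1ℤ) (trans ∣⊝1∣ (cong (λ k → 1ℤ ⊕ (⊝ 1ℤ) ⊗ + suc k) (sym P≡)))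
    sg-one : ∀ n → sg n ≈ 1ℤ
    sg-one zero    = ≈-refl
    sg-one (suc n) = ≈-trans (neg-cong (sg-one n)) minus-one
    pow-one : ∀ k → pow k (sg n) ≈ 1ℤ
    pow-one zero    = ≈-refl
    pow-one (suc k) = ≈-trans (*-cong (sg-one n) (pow-one k)) (≈-reflexive (⊗-identityˡ 1ℤ))

  module Step (t : ℕ) where

    s : ℕ
    s = suc (R t)

    module G = Alternating p (κ (suc t))
    module B = Alternating p (κ t)

    -- Two complete columns over g and g′ form s * s pairs, each contributing `diff g g′`.
    κᴬ : Fin p → Fin p → ℤ
    κᴬ g g′ = pow s (pow s (diff g g′))

    module A = Alternating p κᴬ

    κᴬ-self : ∀ g → κᴬ g g ≡ 0ℤ
    κᴬ-self g = trans (cong (λ x → pow s (pow s x)) (⊖-inverse (+ toℕ g)))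
      (trans (cong (pow s) (pow-zero (R t))) (pow-zero (R t)))

    κᴬ-balanced : ∀ a b c d → κᴬ a c ⊗ κᴬ a d ⊗ (κᴬ b c ⊗ κᴬ b d) ≡ κᴬ c a ⊗ κᴬ c b ⊗ (κᴬ d a ⊗ κᴬ d b)
    κᴬ-balanced a b c d = trans (collect (diff a c) (diff a d) (diff b c) (diff b d))
      (trans (cong (λ x → pow s (pow s x)) (trans (pairs-balanced (diff a c) (diff a d) (diff b c) (diff b d))
        (sym (cong₂ _⊗_ (cong₂ _⊗_ (flip a c) (flip b c)) (cong₂ _⊗_ (flip a d) (flip b d))))))
      (sym (collect (diff c a) (diff c b) (diff d a) (diff d b))))
      where
      flip : ∀ i j → diff j i ≡ ⊝ diff i j
      flip i j = ⊝-antisym (+ toℕ j) (+ toℕ i)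
      pow² : ∀ x y → pow s (pow s x) ⊗ pow s (pow s y) ≡ pow s (pow s (x ⊗ y))
      pow² x y = sym (trans (cong (pow s) (pow-⊗ s x y)) (pow-⊗ s (pow s x) (pow s y)))
      collect : ∀ w x y z → pow s (pow s w) ⊗ pow s (pow s x) ⊗ (pow s (pow s y) ⊗ pow s (pow s z)) ≡
                pow s (pow s (w ⊗ x ⊗ (y ⊗ z)))
      collect w x y z = trans (cong₂ _⊗_ (pow² w x) (pow² y z)) (pow² (w ⊗ x) (y ⊗ z))

    module AE = CyclicEvaluation κᴬ κᴬ-self κᴬ-balanced
      (λ n → pow-nonzero s (pow-nonzero s (diff-nonzero n)))
      (λ i j → pow-cong s (pow-cong s (diff-next i j)))

    column : Fin p → List (El t) → List (El (suc t))
    column g = map (g ,_)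

    columns : List (Fin p × List (El t)) → List (El (suc t))
    columns []             = []
    columns ((g , β) ∷ cs) = column g β ++ columns cs

    heads : List (Fin p × List (El t)) → List (Fin p)
    heads = map proj₁

    tail : List (Fin p × List (El t)) → ℤ
    tail []             = 1ℤ
    tail ((g , β) ∷ cs) = B.alt β ⊗ tail cs

    Full : List (Fin p × List (El t)) → Set
    Full = All (λ c → length (proj₂ c) ≡ s)

    length-columns : ∀ cs → Full cs → length (columns cs) ≡ length cs * s
    length-columns []             []      = refl
    length-columns ((g , β) ∷ cs) (l ∷ f) = trans (length-++ (column g β))
      (cong₂ _+_ (trans (length-map (g ,_) β) l) (length-columns cs f))

    column-repeat : ∀ g β w → s < length β → Repeat (column g β ++ w)
    column-repeat g β w l = Repeat-++ʳ w (Repeat-map (g ,_) (El-pigeonhole t β l))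

    repeated-head : ∀ g β cs → length β ≡ s → Full cs → g ∈ heads cs → Repeat (column g β ++ columns cs)
    repeated-head g β ((.g , β′) ∷ cs) l (l′ ∷ f) (here refl)
      with Repeat-split β β′ (El-pigeonhole t (β ++ β′) (subst (s <_) (sym (trans (length-++ β) (cong₂ _+_ l l′)))
             (ℕ.m<m+n s (s≤s z≤n))))
    ... | left r     = Repeat-++ʳ _ (Repeat-map (g ,_) r)
    ... | right r    = Repeat-++ (column g β) (Repeat-++ʳ (columns cs) (Repeat-map (g ,_) r))
    ... | both k m   = Repeat-common (column g β) _ (∈-map⁺ (g ,_) k) (∈-++⁺ˡ (∈-map⁺ (g ,_) m))
    repeated-head g β ((g′ , β′) ∷ cs) l (l′ ∷ f) (there m) with repeated-head g β cs l f m
    ... | r with Repeat-split (column g β) (columns cs) r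
    ...   | left k     = Repeat-++ʳ _ k
    ...   | right k    = Repeat-++ (column g β) (Repeat-++ (column g′ β′) k)
    ...   | both k n   = Repeat-common (column g β) _ k (∈-++⁺ʳ (column g′ β′) n)

    against-same : ∀ g b β w → G.against (g , b) (column g β ++ w) ≡ B.against b β ⊗ G.against (g , b) w
    against-same g b []       w = sym (⊗-identityˡ _)
    against-same g b (b′ ∷ β) w = trans (cong₂ _⊗_ (κ-same t g b b′) (against-same g b β w)) (sym (⊗-assoc _ _ _))

    against-other : ∀ g g′ b β w → g ≢ g′ →
                    G.against (g , b) (column g′ β ++ w) ≡ pow (length β) (diff g g′) ⊗ G.against (g , b) w
    against-other g g′ b []       w n = sym (⊗-identityˡ _)
    against-other g g′ b (b′ ∷ β) w n =
      trans (cong₂ _⊗_ (κ-diff t b b′ n) (against-other g g′ b β w n)) (sym (⊗-assoc _ _ _))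

    cross : Fin p → List (Fin p × List (El t)) → ℤ
    cross g []             = 1ℤ
    cross g ((g′ , β) ∷ cs) = pow s (diff g g′) ⊗ cross g cs

    against-columns : ∀ g b cs → Full cs → g ∉ heads cs → G.against (g , b) (columns cs) ≡ cross g cs
    against-columns g b []              []      n = refl
    against-columns g b ((g′ , β) ∷ cs) (l ∷ f) n = trans (against-other g g′ b β (columns cs) (λ e → n (here e)))
      (cong₂ _⊗_ (cong (λ k → pow k (diff g g′)) l) (against-columns g b cs f (λ m → n (there m))))

    alt-column : ∀ g β cs → Full cs → g ∉ heads cs →
                 G.alt (column g β ++ columns cs) ≡ (B.alt β ⊗ pow (length β) (cross g cs)) ⊗ G.alt (columns cs)
    alt-column g []      cs f n = sym (trans (cong (_⊗ G.alt (columns cs)) (⊗-identityˡ 1ℤ)) (⊗-identityˡ _))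
    alt-column g (b ∷ β) cs f n = trans
      (cong₂ _⊗_ (trans (against-same g b β (columns cs)) (cong (B.against b β ⊗_) (against-columns g b cs f n)))
        (alt-column g β cs f n))
      (column-step (B.against b β) (cross g cs) (B.alt β) _ _)

    pow-cross : ∀ g cs → pow s (cross g cs) ≡ A.against g (heads cs)
    pow-cross g []             = pow-one s
      where
      pow-one : ∀ n → pow n 1ℤ ≡ 1ℤ
      pow-one zero    = refl
      pow-one (suc n) = trans (⊗-identityˡ _) (pow-one n)
    pow-cross g ((g′ , β) ∷ cs) = trans (pow-⊗ s (pow s (diff g g′)) (cross g cs)) (cong (κᴬ g g′ ⊗_) (pow-cross g cs))

    -- Pairs inside a column only see the smaller group, pairs from different columns only the first
    -- coordinates. If a first coordinate occurs twice, both sides vanish: two complete columns over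
    -- it exceed the s available elements.
    alt-columns : ∀ cs → Full cs → G.alt (columns cs) ≡ A.alt (heads cs) ⊗ tail cs
    alt-columns []             []      = sym (⊗-identityˡ 1ℤ)
    alt-columns ((g , β) ∷ cs) (l ∷ f) with DecMembership._∈?_ Fin._≟_ g (heads cs)
    ... | yes m = trans (G.alt-repeat (κ-self (suc t)) (repeated-head g β cs l f m))
      (sym (trans (cong (_⊗ (B.alt β ⊗ tail cs)) (A.alt-repeat κᴬ-self (here m))) (⊗-zeroˡ _)))
    ... | no n = trans (alt-column g β cs f n)
      (trans (cong₂ (λ x y → (B.alt β ⊗ x) ⊗ y) (trans (cong (λ k → pow k (cross g cs)) l) (pow-cross g cs)) (alt-columns cs f))
        (hier-regroup (B.alt β) (A.against g (heads cs)) (A.alt (heads cs)) (tail cs)))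

    across-down : ℕ → (ℕ → Fin p → ℤ) → Fin p → ℤ
    across-down zero    F g = 0ℤ
    across-down (suc n) F g = d n prev (F n) g

    -- A step goes either across, acting on the first coordinate and lowering n, or stays within the
    -- column at the price of the sign `sg n`. The names `across` and `within` below refer to these
    -- alternatives.
    W-step : ∀ ω q n a g b w → Wᴱ (suc t) ω (suc q) (n ∷ a) ((g , b) ∷ w) ≡
      across-down n (λ n g′ → Wᴱ (suc t) ω q (n ∷ a) ((g′ , b) ∷ (g , b) ∷ w)) g ⊕
      sg n ⊗ D (shifts prev t) (λ a b′ → Wᴱ (suc t) ω q (n ∷ a) ((g , b′) ∷ (g , b) ∷ w)) a b
    W-step ω q n a g b w = cong₂ (λ x y → x ⊕ sg n ⊗ y) (first-part n)
      (D-natural (g ,_) (seconds (shifts prev t)) (λ a v′ → Wᴱ (suc t) ω q (n ∷ a) (v′ ∷ (g , b) ∷ w)) a b)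
      where
      first-part : ∀ n → down (first prev) (λ a v′ → Wᴱ (suc t) ω q a (v′ ∷ (g , b) ∷ w)) n a (g , b) ≡
                   across-down n (λ n g′ → Wᴱ (suc t) ω q (n ∷ a) ((g′ , b) ∷ (g , b) ∷ w)) g
      first-part zero    = refl
      first-part (suc n) = d-natural (_, b) (λ _ → refl) n (λ v′ → Wᴱ (suc t) ω q (n ∷ a) (v′ ∷ (g , b) ∷ w)) g
      seconds : ∀ {u} (τs : Vec (El t → El t) u) → Pointwise (λ σ τ → ∀ b′ → σ (g , b′) ≡ (g , τ b′)) (Vec.map second τs) τs
      seconds []       = []
      seconds (τ ∷ τs) = (λ _ → refl) ∷ seconds τs

    Gω : ℕ → List (El (suc t)) → ℤ
    Gω = Ω (suc t)

    r : ℕ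
    r = suc (R (suc t))

    private
      -- The counting behind `W-vanish`. Capacity: s for the current column and s for each remaining
      -- step across and each later block, as either opens a new column. Demand: all vertices of
      -- these columns. Leaving a column lowers the capacity by s and the demand by l ≤ s, so the
      -- deficit persists.
      across-bound : ∀ n m l F X → l ≤ s → s + s * (suc n + m) < l + suc F + X → s + s * (n + m) < suc F + X
      across-bound n m l F X l≤s h = ℕ.+-cancelˡ-< s _ _ (ℕ.<-≤-trans
        (subst (_< l + suc F + X) (cong (λ x → s + x) (ℕ.*-suc s (n + m))) h)
        (subst (l + suc F + X ≤_) (ℕ.+-assoc s (suc F) X) (ℕ.+-monoˡ-≤ X (ℕ.+-monoˡ-≤ (suc F) l≤s))))

    -- The remaining vertices do not fit into the remaining columns, each of
    -- which has room for at most s vertices.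
    W-vanish : ∀ m F n a g b β w → length (b ∷ β) + length w + F ≡ r → length (b ∷ β) ≤ s →
               s + s * (n + m) < length (b ∷ β) + F + m * r →
               Wᴱ (suc t) (Gω (suc m)) (F + m * R (suc t)) (n ∷ a) (column g (b ∷ β) ++ w) ≈ 0ℤ
    W-vanish zero zero n a g b β w l l≤s h = ⊥-elim (ℕ.<-irrefl refl (ℕ.<-≤-trans h
      (ℕ.≤-trans (ℕ.≤-reflexive (trans (ℕ.+-identityʳ _) (ℕ.+-identityʳ _))) (ℕ.≤-trans l≤s (ℕ.m≤m+n s _)))))
    W-vanish (suc m) zero n a g b β w l l≤s h = ≈-trans
      (W-block (κ (suc t)) (R (suc t)) (shifts prev (suc t)) (suc m) (n ∷ a) (g , b) (column g β ++ w)
        (ℕ.suc-injective (trans (cong suc (trans (length-++ (column g β)) (cong (_+ length w) (length-map (g ,_) β))))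
          (trans (sym (ℕ.+-identityʳ _)) l))))
      (≈-trans (*-cong ≈-refl (W-vanish m (R (suc t)) n a g b [] [] refl (s≤s z≤n)
        (across-bound n m (length (b ∷ β)) (R (suc t)) (m * r) l≤s
          (subst₂ (λ x y → s + s * x < y) (ℕ.+-suc n m)
            (trans (cong (_+ suc m * r) (ℕ.+-identityʳ (length (b ∷ β)))) (sym (ℕ.+-assoc (length (b ∷ β)) r (m * r)))) h))))
        (≈-reflexive (⊗-zeroʳ _)))
    W-vanish m (suc F) n a g b β w l l≤s h = begin
      Wᴱ (suc t) (Gω (suc m)) (suc F + m * R (suc t)) (n ∷ a) (column g (b ∷ β) ++ w)
        ≡⟨ W-step (Gω (suc m)) (F + m * R (suc t)) n a g b (column g β ++ w) ⟩
      across-down n (λ n g′ → Wᴱ (suc t) (Gω (suc m)) (F + m * R (suc t)) (n ∷ a) ((g′ , b) ∷ column g (b ∷ β) ++ w)) g ⊕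
      sg n ⊗ D (shifts prev t) (λ a b′ → Wᴱ (suc t) (Gω (suc m)) (F + m * R (suc t)) (n ∷ a) (column g (b′ ∷ b ∷ β) ++ w)) a b
        ≈⟨ +-cong (across n h) (*-cong ≈-refl (≈-trans (D-cong (shifts prev t) within a b) (D-zero (shifts prev t) a b))) ⟩
      0ℤ ⊕ sg n ⊗ 0ℤ
        ≡⟨ drop-zero 0ℤ (sg n) ⟩
      0ℤ ∎
      where
      length-c : length (column g (b ∷ β) ++ w) ≡ length (b ∷ β) + length w
      length-c = trans (length-++ (column g (b ∷ β))) (cong (_+ length w) (length-map (g ,_) (b ∷ β)))
      across : ∀ n → s + s * (n + m) < length (b ∷ β) + suc F + m * r →
        across-down n (λ n g′ → Wᴱ (suc t) (Gω (suc m)) (F + m * R (suc t)) (n ∷ a) ((g′ , b) ∷ column g (b ∷ β) ++ w)) g ≈ 0ℤ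
      across zero    h = ≈-refl
      across (suc n) h = ≈-trans (Linear.T-cong (d-linear prev n) (λ g′ →
          W-vanish m F n a g′ b [] (column g (b ∷ β) ++ w)
            (trans (cong (λ x → suc (x + F)) length-c) (trans (sym (ℕ.+-suc _ F)) l)) (s≤s z≤n)
            (across-bound n m (length (b ∷ β)) F (m * r) l≤s h)) g)
        (Linear.T-zero (d-linear prev n) g)
      within : ∀ a b′ → Wᴱ (suc t) (Gω (suc m)) (F + m * R (suc t)) (n ∷ a) (column g (b′ ∷ b ∷ β) ++ w) ≈ 0ℤ
      within a b′ with ℕ.m≤n⇒m<n∨m≡n l≤s
      ... | inj₁ l<s = W-vanish m F n a g b′ (b ∷ β) w (trans (sym (ℕ.+-suc _ F)) l) l<s
              (subst (λ x → s + s * (n + m) < x + m * r) (ℕ.+-suc _ F) h)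
      -- The column is already complete, so one more vertex in it repeats an element.
      ... | inj₂ l≡s = W-repeat (κ (suc t)) (R (suc t)) (shifts prev (suc t)) (κ-self (suc t)) m F (n ∷ a) _
              (column-repeat g (b′ ∷ b ∷ β) w (s≤s (ℕ.≤-reflexive (sym l≡s))))
              (trans (cong (λ x → suc (x + F)) length-c) (trans (sym (ℕ.+-suc _ F)) l))

    Aω : ℕ → List (Fin p) → ℤ
    Aω = A.Euler.ω P

    -- Sign of the inner steps, cyclic factor, factor of the smaller group, finished columns. Every
    -- column is a block for the smaller group: the current one, j in this block and p in each of
    -- the m later blocks.
    value : ∀ m j f (g : Fin p) (β : List (El t)) cs → Vec ℕ t → ℤ
    value m j f g β cs a = pow f (sg (j + m * P)) ⊗ (AE.Wᴬ (Aω (suc m)) (j + m * P) (g ∷ heads cs) ⊗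
      (Wᴱ t (Ω t (suc (j + m * p))) (f + (j + m * p) * R t) a β ⊗ tail cs))

    -- The current block consists of the full columns cs and of the current
    -- column, which misses f vertices; j columns are missing.
    W-value : ∀ m j f g b β cs → Full cs → length β + f ≡ R t → length cs + j ≡ P → ∀ a →
              Wᴱ (suc t) (Gω (suc m)) (f + j * s + m * R (suc t)) (j + m * P ∷ a) (column g (b ∷ β) ++ columns cs) ≈
              value m j f g (b ∷ β) cs a
    W-value m j (suc f) g b β cs full lβ lcs a = begin
      Wᴱ (suc t) (Gω (suc m)) (suc q) (n ∷ a) c
        ≡⟨ W-step (Gω (suc m)) q n a g b (column g β ++ columns cs) ⟩
      across-down n (λ n g′ → Wᴱ (suc t) (Gω (suc m)) q (n ∷ a) ((g′ , b) ∷ c)) g ⊕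
      sg n ⊗ D (shifts prev t) (λ a b′ → Wᴱ (suc t) (Gω (suc m)) q (n ∷ a) ((g , b′) ∷ c)) a b
        ≈⟨ +-cong (across n refl) (*-cong ≈-refl (D-cong (shifts prev t) (λ a b′ →
             ≈-trans (W-value m j f g b′ (b ∷ β) cs full (trans (sym (ℕ.+-suc _ f)) lβ) lcs a)
               (≈-reflexive (eval-factor (pow f (sg n)) X (Y a b′) (tail cs)))) a b)) ⟩
      0ℤ ⊕ sg n ⊗ D (shifts prev t) (λ a b′ → (pow f (sg n) ⊗ (X ⊗ tail cs)) ⊗ Y a b′) a b
        ≈⟨ +-cong ≈-refl (*-cong ≈-refl (D-scale (shifts prev t) (pow f (sg n) ⊗ (X ⊗ tail cs)) Y a b)) ⟩
      0ℤ ⊕ sg n ⊗ ((pow f (sg n) ⊗ (X ⊗ tail cs)) ⊗ D (shifts prev t) Y a b)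
        ≡⟨ eval-down (sg n) (pow f (sg n)) X (D (shifts prev t) Y a b) (tail cs) ⟩
      value m j (suc f) g (b ∷ β) cs a ∎
      where
      n q : ℕ
      n = j + m * P
      q = f + j * s + m * R (suc t)
      c : List (El (suc t))
      c = column g (b ∷ β) ++ columns cs
      X : ℤ
      X = AE.Wᴬ (Aω (suc m)) n (g ∷ heads cs)
      Y : Vec ℕ t → El t → ℤ
      Y a b′ = Wᴱ t (Ω t (suc (j + m * p))) (f + (j + m * p) * R t) a (b′ ∷ b ∷ β)
      length-c : length c ≡ length (b ∷ β) + length cs * s
      length-c = trans (length-++ (column g (b ∷ β))) (cong₂ _+_ (length-map (g ,_) (b ∷ β)) (length-columns cs full))
      total : 1 + length c + (f + j * s) ≡ r
      total = trans (cong (λ x → 1 + x + (f + j * s)) length-c)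
        (trans (arrange (length β) (length cs) s f j) (cong₂ (λ x y → suc x + y * s) lβ lcs))
        where
        arrange : ∀ lβ k s f j → 1 + (suc lβ + k * s) + (f + j * s) ≡ suc (lβ + suc f) + (k + j) * s
        arrange = ℕSolver.solve-∀
      -- Here the column still misses a vertex. With j + m P steps across the capacity of the
      -- columns to come is exactly j s + m r, so leaving early creates a deficit.
      across : ∀ n′ → n′ ≡ n → across-down n′ (λ n g′ → Wᴱ (suc t) (Gω (suc m)) q (n ∷ a) ((g′ , b) ∷ c)) g ≈ 0ℤ
      across zero     e = ≈-refl
      across (suc n′) e = ≈-trans (Linear.T-cong (d-linear prev n′) (λ g′ →
          W-vanish m (f + j * s) n′ a g′ b [] c total (s≤s z≤n) bound) g)
        (Linear.T-zero (d-linear prev n′) g)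
        where
        capacity : s + s * (n′ + m) ≡ j * s + m * r
        capacity = trans (sym (ℕ.*-suc s (n′ + m))) (trans (cong (λ x → s * (x + m)) e) (arrange (R t) P j m))
          where
          arrange : ∀ R P j m → suc R * (j + m * P + m) ≡ j * suc R + m * suc (R + P * suc R)
          arrange = ℕSolver.solve-∀
        bound : s + s * (n′ + m) < 1 + (f + j * s) + m * r
        bound = s≤s (ℕ.≤-trans (ℕ.≤-reflexive capacity) (ℕ.+-monoˡ-≤ (m * r) (ℕ.m≤n+m (j * s) f)))
    W-value m (suc j) zero g b β cs full lβ lcs a = begin
      Wᴱ (suc t) (Gω (suc m)) (suc q) (suc n ∷ a) c
        ≡⟨ W-step (Gω (suc m)) q (suc n) a g b (column g β ++ columns cs) ⟩
      d n prev (λ g′ → Wᴱ (suc t) (Gω (suc m)) q (n ∷ a) ((g′ , b) ∷ c)) g ⊕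
      sg (suc n) ⊗ D (shifts prev t) (λ a b′ → Wᴱ (suc t) (Gω (suc m)) q (suc n ∷ a) ((g , b′) ∷ c)) a b
        ≈⟨ +-cong (Linear.T-cong (d-linear prev n) (λ g′ →
             ≈-trans (W-value m j (R t) g′ b [] ((g , b ∷ β) ∷ cs) (cong suc length-β ∷ full) refl
                       (trans (sym (ℕ.+-suc (length cs) j)) lcs) a)
               (≈-trans (*-cong (pow-R t n) ≈-refl) (≈-reflexive (eval-across′ (X g′) Y K)))) g)
             (*-cong ≈-refl (≈-trans (D-cong (shifts prev t) within a b) (D-zero (shifts prev t) a b))) ⟩
      d n prev (λ g′ → (Y ⊗ K) ⊗ X g′) g ⊕ sg (suc n) ⊗ 0ℤ
        ≈⟨ +-cong (Linear.T-scale (d-linear prev n) (Y ⊗ K) X g) ≈-refl ⟩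
      (Y ⊗ K) ⊗ d n prev X g ⊕ sg (suc n) ⊗ 0ℤ
        ≡⟨ eval-across (d n prev X g) Y (B.alt (b ∷ β)) (tail cs) (sg (suc n)) ⟩
      1ℤ ⊗ (d n prev X g ⊗ ((B.alt (b ∷ β) ⊗ Y) ⊗ tail cs))
        ≈⟨ *-cong ≈-refl (*-cong (≈-reflexive (sym (AE.Wᴬ-step (Aω (suc m)) n g (heads cs))))
             (*-cong (≈-sym (W-block (κ t) (R t) (shifts prev t) (suc (j + m * p)) a b β length-β)) ≈-refl)) ⟩
      value m (suc j) zero g (b ∷ β) cs a ∎
      where
      n q : ℕ
      n = j + m * P
      q = R t + j * s + m * R (suc t)
      c : List (El (suc t))
      c = column g (b ∷ β) ++ columns cs
      X : Fin p → ℤ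
      X g′ = AE.Wᴬ (Aω (suc m)) n (g′ ∷ g ∷ heads cs)
      Y K : ℤ
      Y = Wᴱ t (Ω t (suc (j + m * p))) (R t + (j + m * p) * R t) a (b ∷ [])
      K = B.alt (b ∷ β) ⊗ tail cs
      length-β : length β ≡ R t
      length-β = trans (sym (ℕ.+-identityʳ _)) lβ
      length-c : length c ≡ length (b ∷ β) + length cs * s
      length-c = trans (length-++ (column g (b ∷ β))) (cong₂ _+_ (length-map (g ,_) (b ∷ β)) (length-columns cs full))
      total : 1 + length c + (R t + j * s) ≡ r
      total = trans (cong (λ x → 1 + x + (R t + j * s)) length-c)
        (trans (arrange (length β) (length cs) (R t) j) (cong₂ (λ x y → suc x + y * s) length-β lcs))
        where
        arrange : ∀ lβ k R j → 1 + (suc lβ + k * suc R) + (R + j * suc R) ≡ suc lβ + (k + suc j) * suc R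
        arrange = ℕSolver.solve-∀
      within : ∀ a b′ → Wᴱ (suc t) (Gω (suc m)) q (suc n ∷ a) ((g , b′) ∷ c) ≈ 0ℤ
      within a b′ = W-repeat (κ (suc t)) (R (suc t)) (shifts prev (suc t)) (κ-self (suc t)) m (R t + j * s) (suc n ∷ a) _
        (column-repeat g (b′ ∷ b ∷ β) (columns cs) (s≤s (ℕ.≤-reflexive (cong suc (sym length-β))))) total
    W-value zero zero zero g b β cs full lβ lcs a = begin
      Wᴱ (suc t) (Gω 1) 0 (0 ∷ a) (column g (b ∷ β) ++ columns cs)
        ≈⟨ W-block (κ (suc t)) (R (suc t)) (shifts prev (suc t)) 0 (0 ∷ a) (g , b) (column g β ++ columns cs) length-c ⟩
      G.alt (column g (b ∷ β) ++ columns cs) ⊗ 1ℤ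
        ≡⟨ cong (_⊗ 1ℤ) (alt-columns ((g , b ∷ β) ∷ cs) (cong suc length-β ∷ full)) ⟩
      (A.alt (g ∷ heads cs) ⊗ (B.alt (b ∷ β) ⊗ tail cs)) ⊗ 1ℤ
        ≡⟨ eval-base (A.alt (g ∷ heads cs)) (B.alt (b ∷ β)) (tail cs) ⟩
      1ℤ ⊗ ((A.alt (g ∷ heads cs) ⊗ 1ℤ) ⊗ ((B.alt (b ∷ β) ⊗ 1ℤ) ⊗ tail cs))
        ≈⟨ *-cong ≈-refl (*-cong (≈-sym (W-block κᴬ P (prev ∷ []) 0 (0 ∷ []) g (heads cs) length-heads))
             (*-cong (≈-sym (W-block (κ t) (R t) (shifts prev t) 0 a b β length-β)) ≈-refl)) ⟩
      value zero zero zero g (b ∷ β) cs a ∎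
      where
      length-β : length β ≡ R t
      length-β = trans (sym (ℕ.+-identityʳ _)) lβ
      length-cs : length cs ≡ P
      length-cs = trans (sym (ℕ.+-identityʳ _)) lcs
      length-heads : length (heads cs) ≡ P
      length-heads = trans (length-map proj₁ cs) length-cs
      length-c : length (column g β ++ columns cs) ≡ R (suc t)
      length-c = trans (length-++ (column g β)) (cong₂ _+_ (trans (length-map (g ,_) β) length-β)
        (trans (length-columns cs full) (cong (_* s) length-cs)))
    W-value (suc m) zero zero g b β cs full lβ lcs a = begin
      Wᴱ (suc t) (Gω (suc (suc m))) (R (suc t) + m * R (suc t)) (P + m * P ∷ a) (column g (b ∷ β) ++ columns cs)
        ≈⟨ W-block (κ (suc t)) (R (suc t)) (shifts prev (suc t)) (suc m) (P + m * P ∷ a) (g , b) (column g β ++ columns cs) length-c ⟩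
      G.alt (column g (b ∷ β) ++ columns cs) ⊗ Wᴱ (suc t) (Gω (suc m)) (R (suc t) + m * R (suc t)) (P + m * P ∷ a) ((g , b) ∷ [])
        ≈⟨ *-cong (≈-reflexive (alt-columns ((g , b ∷ β) ∷ cs) (cong suc length-β ∷ full)))
             (≈-trans (W-value m P (R t) g b [] [] [] refl refl a) (*-cong (pow-R t (P + m * P)) ≈-refl)) ⟩
      (A.alt (g ∷ heads cs) ⊗ (B.alt (b ∷ β) ⊗ tail cs)) ⊗ (1ℤ ⊗ (X ⊗ (Y ⊗ 1ℤ)))
        ≡⟨ eval-block (A.alt (g ∷ heads cs)) (B.alt (b ∷ β)) (tail cs) X Y ⟩
      1ℤ ⊗ ((A.alt (g ∷ heads cs) ⊗ X) ⊗ ((B.alt (b ∷ β) ⊗ Y) ⊗ tail cs))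
        ≈⟨ *-cong ≈-refl (*-cong (≈-sym (W-block κᴬ P (prev ∷ []) (suc m) (P + m * P ∷ []) g (heads cs) length-heads))
             (*-cong (≈-sym (W-block (κ t) (R t) (shifts prev t) (suc (P + m * p)) a b β length-β)) ≈-refl)) ⟩
      value (suc m) zero zero g (b ∷ β) cs a ∎
      where
      X Y : ℤ
      X = AE.Wᴬ (Aω (suc m)) (P + m * P) (g ∷ [])
      Y = Wᴱ t (Ω t (suc (P + m * p))) (R t + (P + m * p) * R t) a (b ∷ [])
      length-β : length β ≡ R t
      length-β = trans (sym (ℕ.+-identityʳ _)) lβ
      length-cs : length cs ≡ P
      length-cs = trans (sym (ℕ.+-identityʳ _)) lcs
      length-heads : length (heads cs) ≡ P
      length-heads = trans (length-map proj₁ cs) length-cs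
      length-c : length (column g β ++ columns cs) ≡ R (suc t)
      length-c = trans (length-++ (column g β)) (cong₂ _+_ (trans (length-map (g ,_) β) length-β)
        (trans (length-columns cs full) (cong (_* s) length-cs)))

  -- With no finished columns, `W-value` factors the coefficient into a cyclic one and one for the
  -- smaller group with p times as many blocks. Both are units, and p is prime.
  leading-nonzero : ∀ t m v → ¬ Wᴱ t (Ω t m) (m * R t) (leading t m) (v ∷ []) ≈ 0ℤ
  leading-nonzero zero m v = ≉0-resp (unit m) (small-nonzero 0 1<p)
    where
    unit : ∀ m → Wᴱ 0 (Ω 0 m) (m * 0) [] (v ∷ []) ≈ 1ℤ
    unit zero    = ≈-refl
    unit (suc m) = ≈-trans (W-block (κ 0) 0 [] m [] v [] refl)
      (≈-trans (*-cong ≈-refl (unit m)) (≈-reflexive (trans (⊗-identityʳ _) (⊗-identityʳ 1ℤ))))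
  leading-nonzero (suc t) zero    v = small-nonzero 0 1<p
  leading-nonzero (suc t) (suc m) (g , b) = ≉0-resp
    (≈-trans (Step.W-value t m P (R t) g b [] [] [] refl refl (leading t (suc m * p)))
      (≈-trans (*-cong (pow-R t (P + m * P)) ≈-refl) (≈-reflexive (unit-product 1ℤ _ _))))
    (⊗-nonzero (small-nonzero 0 1<p) (⊗-nonzero (Step.AE.cyclic-nonzero t (suc m) g) (leading-nonzero t (suc m * p) b)))

-- Multiplicities in a multisubset.

multiplicity-tabulate : ∀ {n r} (u : Fin r → Fin n) v → lookup (multisetOf u) v ≡ _
multiplicity-tabulate u v = lookup∘tabulate _ v

multiplicity-yes : ∀ {n r} (u : Fin (suc r) → Fin n) v → u Fin.zero ≡ v →
                   lookup (multisetOf u) v ≡ suc (lookup (multisetOf (λ i → u (Fin.suc i))) v)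
multiplicity-yes u v e with u Fin.zero Fin.≟ v | multiplicity-tabulate u v
... | yes _ | q = trans q (cong suc (sym (multiplicity-tabulate (λ i → u (Fin.suc i)) v)))
... | no n  | _ = contradiction e n

multiplicity-no : ∀ {n r} (u : Fin (suc r) → Fin n) v → u Fin.zero ≢ v →
                  lookup (multisetOf u) v ≡ lookup (multisetOf (λ i → u (Fin.suc i))) v
multiplicity-no u v n with u Fin.zero Fin.≟ v | multiplicity-tabulate u v
... | no _  | q = trans q (sym (multiplicity-tabulate (λ i → u (Fin.suc i)) v))
... | yes e | _ = contradiction e n

hit : ∀ {P : Set} → Dec P → ℕ
hit (yes _) = 1
hit (no _)  = 0

multiplicity-sum : ∀ {n} r (u : Fin r → Fin n) v → lookup (multisetOf u) v ≡ sumℕ (λ i → hit (u i Fin.≟ v))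
multiplicity-sum zero    u v = multiplicity-tabulate u v
multiplicity-sum (suc r) u v = go (u Fin.zero Fin.≟ v)
  where
  go : (D : Dec (u Fin.zero ≡ v)) →
       lookup (multisetOf u) v ≡ hit D + sumℕ (λ i → hit (u (Fin.suc i) Fin.≟ v))
  go (yes e) = trans (multiplicity-yes u v e) (cong suc (multiplicity-sum r (λ i → u (Fin.suc i)) v))
  go (no n)  = trans (multiplicity-no u v n) (multiplicity-sum r (λ i → u (Fin.suc i)) v)

multiplicity-positive : ∀ {n} r (u : Fin r → Fin n) v → 1 ≤ lookup (multisetOf u) v → ∃ λ i → u i ≡ v
multiplicity-positive zero u v l = contradiction (subst (1 ≤_) (multiplicity-tabulate u v) l) λ ()
multiplicity-positive (suc r) u v l with u Fin.zero Fin.≟ v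
... | yes e = Fin.zero , e
... | no n with multiplicity-positive r (λ i → u (Fin.suc i)) v (subst (1 ≤_) (multiplicity-no u v n) l)
...   | i , e = Fin.suc i , e

-- A multiplicity is a sum over the copies, hence unchanged by permuting them. This is why the group
-- preserves the box condition.
multisetOf-permute : ∀ {n r} (u : Fin r → Fin n) (f g : Fin r → Fin r) → (∀ i → f (g i) ≡ i) → (∀ i → g (f i) ≡ i) →
                     multisetOf (λ i → u (f i)) ≡ multisetOf u
multisetOf-permute {n} {r} u f g fg gf = trans (sym (tabulate∘lookup _)) (trans (tabulate-cong same-multiplicity) (tabulate∘lookup _))
  where
  same-multiplicity : ∀ v → lookup (multisetOf (λ i → u (f i))) v ≡ lookup (multisetOf u) v
  same-multiplicity v = trans (multiplicity-sum r (λ i → u (f i)) v)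
    (trans (sym (sum-permute (λ i → hit (u i Fin.≟ v)) (Permutation.permutation f g fg gf)))
      (sym (multiplicity-sum r u v)))

-- Translation between cochains on vectors and on tuples.

opaque
  unfolding _⊕_ _⊗_ _⊖_ ⊝_

  sumFin-cong : ∀ k {f g : Fin k → ℤ} → (∀ j → f j ≡ g j) → sumFin k f ≡ sumFin k g
  sumFin-cong zero    h = refl
  sumFin-cong (suc k) h = cong₂ ℤ._+_ (h Fin.zero) (sumFin-cong k (λ j → h (Fin.suc j)))

  sumFin-neg : ∀ k (f : Fin k → ℤ) → sumFin k (λ j → ℤ.- f j) ≡ ℤ.- sumFin k f
  sumFin-neg zero    f = refl
  sumFin-neg (suc k) f = trans (cong (λ x → ℤ.- f Fin.zero ℤ.+ x) (sumFin-neg k (λ j → f (Fin.suc j))))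
    (sym (ℤ.neg-distrib-+ (f Fin.zero) _))

  sign-suc : ∀ j a → sign (suc j) a ≡ ℤ.- sign j a
  sign-suc zero          a = refl
  sign-suc (suc zero)    a = sym (ℤ.neg-involutive a)
  sign-suc (suc (suc j)) a = sign-suc j a

  coboundary≡∂ : ∀ p {V : Set} k (f : Vec V k → ℤ) (f′ : List V → ℤ) → (∀ τ → f τ ≡ f′ (toList τ)) → (σ : Vec V (suc k)) →
                 sumFin (suc k) (λ j → sign (toℕ j) (f (removeAt σ j))) ≡ Mod.∂ p f′ (toList σ)
  coboundary≡∂ p zero    f f′ h (v ∷ []) = cong (ℤ._+ 0ℤ) (h [])
  coboundary≡∂ p (suc k) f f′ h (v ∷ x ∷ w) = cong₂ ℤ._+_ (h (x ∷ w))
    (trans (sumFin-cong (suc k) (λ j → sign-suc (toℕ j) (f (v ∷ removeAt (x ∷ w) j))))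
      (trans (sumFin-neg (suc k) (λ j → sign (toℕ j) (f (v ∷ removeAt (x ∷ w) j))))
        (cong ℤ.-_ (coboundary≡∂ p k (λ τ → f (v ∷ τ)) (λ u → f′ (v ∷ u)) (λ τ → h (v ∷ τ)) (x ∷ w)))))

  ≈⇒mod : ∀ {p a b} → Mod._≈_ p a b → a ≡ b [mod p ]
  ≈⇒mod {p} {a} {b} (Mod.mod k e) = divides ℤ.∣ k ∣
    (trans (cong ℤ.∣_∣ (trans (cong (_⊖ b) e) (⊕-⊖-cancel b (k ⊗ + p)))) (∣⊗∣ k (+ p)))

  mod⇒≈ : ∀ {p a b} → a ≡ b [mod p ] → Mod._≈_ p a b
  mod⇒≈ {p} {a} {b} d with ∣-multiple (a ⊖ b) p d
  ... | k , e = Mod.mod k (trans (⊖-solve a b) (trans (cong (_⊕ b) (trans e (⊕-identityˡ (k ⊗ + p)))) (⊕-comm (k ⊗ + p) b)))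

-- The box complex as a family of tuples.

module BoxCochains (p n r : ℕ) (H : Hypergraph n r) where
  open Mod p
  open Sorting p {BoxVertex n r}

  private
    V : Set
    V = BoxVertex n r

  -- Depends only on which vertices occur, so it admits repetitions, any order and the empty tuple,
  -- and passes to every tuple built from the same vertices.
  BoxTuple : List V → Set
  BoxTuple w = (∀ i → ∃ λ v → (i , v) ∈ w) → ∀ u → (∀ i → (i , u i) ∈ w) → Edge H (multisetOf u)

  cmp′ : ∀ {i j : Fin r} {v w : Fin n} → Tri (toℕ i < toℕ j) (i ≡ j) (toℕ j < toℕ i) →
         Tri (toℕ v < toℕ w) (v ≡ w) (toℕ w < toℕ v) → Cmp
  cmp′ (tri< _ _ _) _            = before
  cmp′ (tri> _ _ _) _            = after
  cmp′ (tri≈ _ _ _) (tri< _ _ _) = before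
  cmp′ (tri≈ _ _ _) (tri≈ _ _ _) = same
  cmp′ (tri≈ _ _ _) (tri> _ _ _) = after

  cmpV : V → V → Cmp
  cmpV (i , v) (j , w) = cmp′ (Fin.<-cmp i j) (Fin.<-cmp v w)

  before⇒< : ∀ a b → cmpV a b ≡ before → a <V b
  before⇒< (i , v) (j , w) e with Fin.<-cmp i j | Fin.<-cmp v w
  ... | tri< l _ _ | _          = inj₁ l
  ... | tri≈ _ q _ | tri< l _ _ = inj₂ (q , l)

  <⇒before : ∀ a b → a <V b → cmpV a b ≡ before
  <⇒before (i , v) (j , w) l with Fin.<-cmp i j | Fin.<-cmp v w | l
  ... | tri< _ _ _  | _           | _            = refl
  ... | tri≈ _ _ _  | tri< _ _ _  | _            = refl
  ... | tri≈ ¬l _ _ | tri≈ _ _ _  | inj₁ l       = contradiction l ¬l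
  ... | tri≈ _ _ _  | tri≈ ¬l _ _ | inj₂ (_ , l) = contradiction l ¬l
  ... | tri≈ ¬l _ _ | tri> _ _ _  | inj₁ l       = contradiction l ¬l
  ... | tri≈ _ _ _  | tri> ¬l _ _ | inj₂ (_ , l) = contradiction l ¬l
  ... | tri> ¬l _ _ | _           | inj₁ l       = contradiction l ¬l
  ... | tri> _ ¬e _ | _           | inj₂ (e , _) = contradiction e ¬e

  after⇒> : ∀ a b → cmpV a b ≡ after → b <V a
  after⇒> (i , v) (j , w) e with Fin.<-cmp i j | Fin.<-cmp v w
  ... | tri> _ _ l | _          = inj₁ l
  ... | tri≈ _ q _ | tri> _ _ l = inj₂ (sym q , l)

  same⇒≡ : ∀ a b → cmpV a b ≡ same → a ≡ b
  same⇒≡ (i , v) (j , w) e with Fin.<-cmp i j | Fin.<-cmp v w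
  ... | tri≈ _ refl _ | tri≈ _ refl _ = refl

  <V-trans : ∀ {a b c : V} → a <V b → b <V c → a <V c
  <V-trans (inj₁ l)          (inj₁ m)          = inj₁ (ℕ.<-trans l m)
  <V-trans (inj₁ l)          (inj₂ (refl , m)) = inj₁ l
  <V-trans (inj₂ (refl , l)) (inj₁ m)          = inj₁ m
  <V-trans (inj₂ (refl , l)) (inj₂ (refl , m)) = inj₂ (refl , ℕ.<-trans l m)

  vertexOrder : Comparison
  vertexOrder = record
    { cmp          = cmpV
    ; before-trans = λ {a} {b} {c} x y → <⇒before a c (<V-trans (before⇒< a b x) (before⇒< b c y))
    ; after-before = λ {a} {b} x → <⇒before b a (after⇒> a b x)
    ; same-≡       = λ {a} {b} → same⇒≡ a b }

  increasing : ∀ {k} (σ : Vec V k) → Mono vertexOrder (toList σ) → Increasing σ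
  increasing []          m                   = inc-[]
  increasing (a ∷ [])    m                   = inc-[ a ]
  increasing (a ∷ b ∷ σ) ((x ∷ _) ∷ m)       = inc-∷ (before⇒< a b x) (increasing (b ∷ σ) m)

  mono : ∀ {k} (σ : Vec V k) → Increasing σ → Mono vertexOrder (toList σ)
  mono []          i             = []
  mono (a ∷ [])    i             = [] ∷ []
  mono (a ∷ b ∷ σ) (inc-∷ l i) with mono (b ∷ σ) i
  ... | all ∷ m = (<⇒before a b l ∷ All.map (λ {c} x → <⇒before a c (<V-trans l (before⇒< b c x))) all) ∷ all ∷ m

  box-tuple : ∀ {k} (σ : Vec V k) → BoxCondition H σ → BoxTuple (toList σ)
  box-tuple σ box full u m = box (λ i → proj₁ (full i) , ∈-toList⁻ (proj₂ (full i))) u (λ i → ∈-toList⁻ (m i))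

  box-condition : ∀ {k} (σ : Vec V k) → BoxTuple (toList σ) → BoxCondition H σ
  box-condition σ box full u m = box (λ i → proj₁ (full i) , ∈-toList⁺ (proj₂ (full i))) u (λ i → ∈-toList⁺ (m i))

  vector : ∀ {k} (w : List V) → length w ≡ k → ∃ λ (σ : Vec V k) → toList σ ≡ w
  vector w refl = fromList w , toList∘fromList w

  extend : ∀ k → (Vec V k → ℤ) → List V → ℤ
  extend k g w with length w ℕ.≟ k
  ... | yes l = g (proj₁ (vector w l))
  ... | no  _ = 0ℤ

  extend-toList : ∀ k g (σ : Vec V k) → g σ ≡ extend k g (toList σ)
  extend-toList k g σ with length (toList σ) ℕ.≟ k
  ... | yes l = cong g (trans (sym (cast-is-id refl σ)) (toList-injective refl σ _ (sym (proj₂ (vector (toList σ) l)))))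
  ... | no n = contradiction (length-toList σ) n

  ordered-acyclic : ∀ k → ReducedCohomologyVanishes p H k → Acyclic (λ w → Mono vertexOrder w × BoxTuple w) k
  ordered-acyclic k vanishes f cocycle = conclude k vanishes cocycle
    where
    f^ : ∀ k → Cochain n r k
    f^ k σ = f (toList σ)
    cocycle^ : ∀ k → (∀ w → Mono vertexOrder w × BoxTuple w → length w ≡ suc k → ∂ f w ≈ 0ℤ) → Cocycle p H k (f^ k)
    cocycle^ k c σ (inc , box) = ≈⇒mod (≈-trans (≈-reflexive (coboundary≡∂ p k (f^ k) f (λ _ → refl) σ))
      (c (toList σ) (mono σ inc , box-tuple σ box) (length-toList σ)))
    conclude : ∀ k → ReducedCohomologyVanishes p H k →
               (∀ w → Mono vertexOrder w × BoxTuple w → length w ≡ suc k → ∂ f w ≈ 0ℤ) →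
               Σ (List V → ℤ) λ g → ∀ w → Mono vertexOrder w × BoxTuple w → length w ≡ k → f w ≈ ∂ g w
    conclude zero vanishes c = (λ _ → 0ℤ) , nil
      where
      nil : ∀ w → Mono vertexOrder w × BoxTuple w → length w ≡ 0 → f w ≈ ∂ (λ _ → 0ℤ) w
      nil [] _ _ = mod⇒≈ (vanishes (f^ 0) (cocycle^ 0 c) [] inc-[])
    conclude (suc k) vanishes c = extend k g , bounds
      where
      g : Cochain n r k
      g = proj₁ (vanishes (f^ (suc k)) (cocycle^ (suc k) c))
      bounds : ∀ w → Mono vertexOrder w × BoxTuple w → length w ≡ suc k → f w ≈ ∂ (extend k g) w
      bounds w (m , box) l with vector w l
      ... | σ , refl = ≈-trans
        (mod⇒≈ (proj₂ (vanishes (f^ (suc k)) (cocycle^ (suc k) c)) σ (increasing σ m , box-condition σ box)))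
        (≈-reflexive (coboundary≡∂ p k g (extend k g) (extend-toList k g) σ))

-- The coloured box complex and the contradiction.

module ColouredBox (P : ℕ) (prime-p : Prime (suc P)) (t n : ℕ) (H : Hypergraph n (suc P ^ t))
                   (m : ℕ) (c : Fin n → Fin m) (proper : ProperColouring H c) where
  open PrimeField P prime-p
  open Cyclic P
  open Mod p
  open Operators p
  open Invariance p
  open Walks p
  open TowerEvaluation P prime-p
  open BoxCochains p n (p ^ t) H
  open Sorting p {BoxVertex n (p ^ t)}

  private
    V : Set
    V = BoxVertex n (p ^ t)

  colour : V → ℕ
  colour v = toℕ (c (proj₂ v))

  label : V → El t
  label v = element (proj₁ v)

  -- Ties count as `before`, never as `same`: distinct vertices of one colour must not cancel.
  by-colour : ∀ {a b} → a ≤ b ⊎ b < a → Cmp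
  by-colour (inj₁ _) = before
  by-colour (inj₂ _) = after

  cmpC : V → V → Cmp
  cmpC u v = by-colour (ℕ.≤-<-connex (colour u) (colour v))

  before⇒≤ : ∀ u v → cmpC u v ≡ before → colour u ≤ colour v
  before⇒≤ u v e with ℕ.≤-<-connex (colour u) (colour v)
  ... | inj₁ l = l

  ≤⇒before : ∀ u v → colour u ≤ colour v → cmpC u v ≡ before
  ≤⇒before u v l with ℕ.≤-<-connex (colour u) (colour v)
  ... | inj₁ _ = refl
  ... | inj₂ g = contradiction l (ℕ.<⇒≱ g)

  colourOrder : Comparison
  colourOrder = record
    { cmp          = cmpC
    ; before-trans = λ {u} {v} {w} x y → ≤⇒before u w (ℕ.≤-trans (before⇒≤ u v x) (before⇒≤ v w y))
    ; after-before = λ {u} {v} x → ≤⇒before v u (after⇒≤ u v x)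
    ; same-≡       = λ {u} {v} x → ⊥-elim (never u v x) }
    where
    after⇒≤ : ∀ u v → cmpC u v ≡ after → colour v ≤ colour u
    after⇒≤ u v e with ℕ.≤-<-connex (colour u) (colour v)
    ... | inj₂ g = ℕ.<⇒≤ g
    never : ∀ u v → cmpC u v ≢ same
    never u v e with ℕ.≤-<-connex (colour u) (colour v)
    never u v () | inj₁ _
    never u v () | inj₂ _

  BoxTuple-sub : ∀ {u w : List V} → All (_∈ w) u → BoxTuple w → BoxTuple u
  BoxTuple-sub a box full u m = box (λ i → proj₁ (full i) , All.lookup a (proj₂ (full i))) u (λ i → All.lookup a (m i))

  -- A monochromatic tuple of a simplex cannot meet all p ^ t copies of the
  -- vertex set, so it repeats a label as soon as it has p ^ t entries.
  monochromatic-alt : ∀ k w → BoxTuple w → All (λ v → colour v ≡ k) w → length w ≡ suc (R t) →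
                      AlternatingProduct.alt (κ t) (map label w) ≡ 0ℤ
  monochromatic-alt k w box mono l with Fin.all? (λ i → DecMembership._∈?_ _≟El_ (element i) (map label w))
  ... | yes all = contradiction (trans (colour-u x x≥1) (sym (colour-u y y≥1))) (λ e → cx≢cy (Fin.toℕ-injective e))
    where
    preimage : ∀ i → ∃ λ v → (i , v) ∈ w
    preimage i with ∈-map⁻ label (all i)
    ... | (i′ , v) , m , e = v , subst (λ j → (j , v) ∈ w) (trans (sym (index-element {t} i′))
      (trans (cong index (sym e)) (index-element {t} i))) m
    u : Fin (p ^ t) → Fin n
    u i = proj₁ (preimage i)
    edge : Edge H (multisetOf u)
    edge = box preimage u (λ i → proj₂ (preimage i))
    x y : Fin n
    x = proj₁ (proper (multisetOf u) edge)
    y = proj₁ (proj₂ (proper (multisetOf u) edge))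
    x≥1 : 1 ≤ lookup (multisetOf u) x
    x≥1 = proj₁ (proj₂ (proj₂ (proper (multisetOf u) edge)))
    y≥1 : 1 ≤ lookup (multisetOf u) y
    y≥1 = proj₁ (proj₂ (proj₂ (proj₂ (proper (multisetOf u) edge))))
    cx≢cy : c x ≢ c y
    cx≢cy = proj₂ (proj₂ (proj₂ (proj₂ (proper (multisetOf u) edge))))
    colour-u : ∀ z → 1 ≤ lookup (multisetOf u) z → toℕ (c z) ≡ k
    colour-u z z≥1 with multiplicity-positive (p ^ t) u z z≥1
    ... | i , e = trans (cong (λ z → toℕ (c z)) (sym e)) (All.lookup mono (proj₂ (preimage i)))
  ... | no ¬all with Fin.¬∀⟶∃¬ (p ^ t) _ (λ i → DecMembership._∈?_ _≟El_ (element i) (map label w)) ¬all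
  ...   | i , i∉ with El-pigeonhole t (element i ∷ map label w)
                        (s≤s (ℕ.≤-reflexive (sym (trans (length-map label w) l))))
  ...     | here i∈ = contradiction i∈ i∉
  ...     | there r = AlternatingProduct.alt-repeat (κ t) (κ-self t) r

  decompose : ∀ f g (w : List V) → (∀ u v z → w ≡ u ++ v ∷ z → f (u ++ v ∷ []) ⊗ g (v ∷ z) ≈ 0ℤ) →
              ∀ j → CupProduct.cup p j f g w ≈ 0ℤ
  decompose f g []      h j       = ≈-refl
  decompose f g (v ∷ w) h zero    = h [] v w refl
  decompose f g (v ∷ w) h (suc j) = decompose (λ u → f (v ∷ u)) g w (λ u x z e → h (v ∷ u) x z (cong (v ∷_) e)) j

  Mono-++ˡ : ∀ u {v z} → Mono colourOrder (u ++ v ∷ z) → Mono colourOrder (u ++ v ∷ [])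
  Mono-++ˡ []      (a ∷ m) = [] ∷ []
  Mono-++ˡ (x ∷ u) {v} (a ∷ m) = All.++⁺ (All.++⁻ˡ u a) (All.head (All.++⁻ʳ u a) ∷ []) ∷ Mono-++ˡ u m

  Mono-++ʳ : ∀ u {v} → Mono colourOrder (u ++ v) → Mono colourOrder v
  Mono-++ʳ []      m       = m
  Mono-++ʳ (x ∷ u) (a ∷ m) = Mono-++ʳ u m

  Mono-max : ∀ u {v} → Mono colourOrder (u ++ v ∷ []) → All (λ x → colour x ≤ colour v) (u ++ v ∷ [])
  Mono-max []      m           = ℕ.≤-refl ∷ []
  Mono-max (x ∷ u) {v} (a ∷ m) = before⇒≤ x v (All.head (All.++⁻ʳ u a)) ∷ Mono-max u m

  -- Along a tuple with increasing colours fewer than k colours allow fewer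
  -- than k colour changes, so one of the k blocks is monochromatic.
  Ω-vanish : ∀ k w → Mono colourOrder w → BoxTuple w → All (λ v → colour v < k) w → Ω t k (map label w) ≈ 0ℤ
  Ω-vanish zero    []      mono box all      = ≈-refl
  Ω-vanish zero    (v ∷ w) mono box (() ∷ _)
  Ω-vanish (suc k) w       mono box all      = ≈-trans (cup-label (k * R t) (Ω t k) E w) (decompose _ _ w blocks (k * R t))
    where
    open Alternating p (κ t) using (alt)
    E : List (El t) → ℤ
    E = Alternating.Euler.e p (κ t) (R t)
    cup-label : ∀ j f g w → CupProduct.cup p j f g (map label w) ≈
                CupProduct.cup p j (λ u → f (map label u)) (λ u → g (map label u)) w
    cup-label j       f g []      = ≈-refl
    cup-label zero    f g (v ∷ w) = ≈-refl
    cup-label (suc j) f g (v ∷ w) = cup-label j (λ u → f (label v ∷ u)) g w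
    blocks : ∀ u v z → w ≡ u ++ v ∷ z → Ω t k (map label (u ++ v ∷ [])) ⊗ E (map label (v ∷ z)) ≈ 0ℤ
    -- v is shared by the first k blocks and the last one. If its colour is below k, the first part
    -- uses only k colours and induction applies; otherwise the last block has the single colour k.
    blocks u v z refl with ℕ.m≤n⇒m<n∨m≡n (ℕ.s≤s⁻¹ (All.head (All.++⁻ʳ u all)))
    ... | inj₁ v<k = ≈-trans (*-cong (Ω-vanish k (u ++ v ∷ []) (Mono-++ˡ u mono)
        (BoxTuple-sub (All.++⁺ (All.tabulate ∈-++⁺ˡ) (∈-++⁺ʳ u (here refl) ∷ [])) box)
        (All.map (λ l → ℕ.≤-<-trans l v<k) (Mono-max u (Mono-++ˡ u mono)))) ≈-refl)
        (≈-reflexive (⊗-zeroˡ _))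
    ... | inj₂ v≡k = ≈-trans (*-cong ≈-refl (≈-reflexive (guarded (length (map label (v ∷ z)) ℕ.≟ suc (R t)))))
        (≈-reflexive (⊗-zeroʳ _))
      where
      all-k : Mono colourOrder (v ∷ z) → All (λ x → colour x < suc k) (v ∷ z) → All (λ x → colour x ≡ k) (v ∷ z)
      all-k (a ∷ _) (_ ∷ b) = v≡k ∷ go a b
        where
        go : ∀ {z} → All (λ x → cmpC v x ≡ before) z → All (λ x → colour x < suc k) z → All (λ x → colour x ≡ k) z
        go []       []            = []
        go {x ∷ _} (l ∷ a) (s≤s b ∷ bs) = ℕ.≤-antisym b (subst (_≤ colour x) v≡k (before⇒≤ v x l)) ∷ go a bs
      guarded : ∀ D → AlternatingProduct.guard (κ t) D (alt (map label (v ∷ z))) ≡ 0ℤ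
      guarded (no _)  = refl
      guarded (yes l) = monochromatic-alt k (v ∷ z) (BoxTuple-sub (All.tabulate (∈-++⁺ʳ u)) box)
        (all-k (Mono-++ʳ u mono) (All.++⁻ʳ u all)) (trans (sym (length-map label (v ∷ z))) l)

  act : (El t → El t) → V → V
  act σ (i , v) = index (σ (element i)) , v

  acts : Vec (V → V) t
  acts = Vec.map act (shifts next t)

  acts-All : ∀ {u} {Q : (El t → El t) → Set} {Q′ : (V → V) → Set} → (∀ {σ} → Q σ → Q′ (act σ)) →
             {σs : Vec (El t → El t) u} → VAll.All Q σs → VAll.All Q′ (Vec.map act σs)
  acts-All h xs = VAll.map⁺ (VAll.map h xs)

  label-act : ∀ σ v → label (act σ v) ≡ σ (label v)
  label-act σ v = element-index _

  iter-act : ∀ k σ v → iter k (act σ) v ≡ (index (iter k σ (label v)) , proj₂ v)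
  iter-act zero    σ v = cong (_, proj₂ v) (sym (index-element {t} (proj₁ v)))
  iter-act (suc k) σ v = trans (iter-act k σ (act σ v)) (cong (λ x → index (iter k σ x) , proj₂ v) (label-act σ v))

  acts-action : Action acts
  acts-action = record
    { commuting = comm (Action.commuting (shifts-action t))
    ; order     = acts-All (λ {σ} h v → trans (iter-act p σ v)
        (cong (_, proj₂ v) (trans (cong index (h (label v))) (index-element {t} (proj₁ v))))) (Action.order (shifts-action t)) }
    where
    comm : ∀ {u} {σs : Vec (El t → El t) u} → Commuting σs → Commuting (Vec.map act σs)
    comm []       = []
    comm {σs = σ ∷ _} (x ∷ xs) = acts-All (λ {τ} h v → cong (λ i → index i , proj₂ v)
      (trans (cong σ (label-act τ v)) (trans (h (label v)) (cong τ (sym (label-act σ v)))))) x ∷ comm xs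

  -- A generator has order p, so its P-th iterate inverts it. A choice of vertices from the
  -- translated tuple is a permuted choice from the original one and gives the same multiset.
  BoxTuple-act : VAll.All (λ σ → ∀ {w} → BoxTuple w → BoxTuple (map σ w)) acts
  BoxTuple-act = acts-All {Q′ = λ σ → ∀ {w} → BoxTuple w → BoxTuple (map σ w)} (λ {σ} h {w} → closed σ h {w}) (Action.order (shifts-action t))
    where
    closed : ∀ σ → (∀ x → iter p σ x ≡ x) → ∀ {w} → BoxTuple w → BoxTuple (map (act σ) w)
    closed σ σᵖ {w} box full u m = subst (Edge H) (multisetOf-permute u f g fg gf)
      (box (λ i → let v , k = full (f i) in v , pull k) (λ i → u (f i)) (λ i → pull (m (f i))))
      where
      f g : Fin (p ^ t) → Fin (p ^ t)
      f i = index (σ (element i))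
      g i = index (iter P σ (element i))
      fg : ∀ i → f (g i) ≡ i
      fg i = trans (cong (λ x → index (σ x)) (element-index (iter P σ (element i))))
        (trans (cong index (trans (sym (iter-shift P σ (element i))) (σᵖ (element i)))) (index-element {t} i))
      gf : ∀ i → g (f i) ≡ i
      gf i = trans (cong (λ x → index (iter P σ x)) (element-index (σ (element i))))
        (trans (cong index (σᵖ (element i))) (index-element {t} i))
      pull : ∀ {i v} → (f i , v) ∈ map (act σ) w → (i , v) ∈ w
      pull {i} k with ∈-map⁻ (act σ) k
      ... | (j , v) , l , e = subst (λ x → x ∈ w) (cong₂ _,_ (trans (sym (gf j)) (trans (cong g (sym (cong proj₁ e))) (gf i)))
        (sym (cong proj₂ e))) l

  origin : ∀ t → El t
  origin zero    = tt
  origin (suc t) = Fin.zero , origin t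

  κ-invariance : VAll.All (λ σ → ∀ w → Ω t m (map σ w) ≈ Ω t m w) (shifts next t)
  κ-invariance = VAll.map (λ {σ} h → Alternating.Euler.ω-map p (κ t) (R t) σ h m) (κ-invariant t)

  Ω-closed : ∀ w → ∂ (Ω t m) w ≈ 0ℤ
  Ω-closed = Alternating.Euler.ω-closed p (κ t) (R t) (κ-self t) (κ-antisym t) (El-pigeonhole t) m

  coneΩ : ℕ → Family (List (El t)) t
  coneΩ = cone (shifts next t) (origin t) (Ω t m)

  module Contract = Cone (shifts next t) (shifts-action t) (origin t) (Ω t m) Ω-closed κ-invariance

  shifts-inverse : ∀ t → Pointwise (λ σ τ → ∀ x → σ (τ x) ≡ x) (shifts next t) (shifts prev t)
  shifts-inverse zero    = []
  shifts-inverse (suc t) = (λ (g , b) → cong (_, b) (next-prev g)) ∷ seconds (shifts-inverse t)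
    where
    seconds : ∀ {u} {σs τs : Vec (El t → El t) u} → Pointwise (λ σ τ → ∀ x → σ (τ x) ≡ x) σs τs →
              Pointwise (λ σ τ → ∀ x → σ (τ x) ≡ x) (Vec.map second σs) (Vec.map second τs)
    seconds []       = []
    seconds (e ∷ es) = (λ (g , b) → cong (g ,_) (e b)) ∷ seconds es

  shifts-commute : ∀ t → VAll.All (λ σ → Pointwise (λ τ τ′ → ∀ x → τ (σ x) ≡ σ (τ′ x)) (shifts prev t) (shifts prev t)) (shifts next t)
  shifts-commute zero    = []
  shifts-commute (suc t) =
    ((λ (g , b) → cong (_, b) (trans (prev-next g) (sym (next-prev g)))) ∷ first-second (shifts prev t)) ∷ seconds (shifts-commute t)
    where
    first-second : ∀ {u} (τs : Vec (El t → El t) u) →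
      Pointwise (λ τ τ′ → ∀ x → τ (first next x) ≡ first next (τ′ x)) (Vec.map second τs) (Vec.map second τs)
    first-second []       = []
    first-second (τ ∷ τs) = (λ _ → refl) ∷ first-second τs
    second-second : ∀ {σ u} {τs τs′ : Vec (El t → El t) u} → Pointwise (λ τ τ′ → ∀ x → τ (σ x) ≡ σ (τ′ x)) τs τs′ →
      Pointwise (λ τ τ′ → ∀ x → τ (second σ x) ≡ second σ (τ′ x)) (Vec.map second τs) (Vec.map second τs′)
    second-second []       = []
    second-second (e ∷ es) = (λ (g , b) → cong (g ,_) (e b)) ∷ second-second es
    seconds : ∀ {u} {σs : Vec (El t → El t) u} →
      VAll.All (λ σ → Pointwise (λ τ τ′ → ∀ x → τ (σ x) ≡ σ (τ′ x)) (shifts prev t) (shifts prev t)) σs →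
      VAll.All (λ σ → Pointwise (λ τ τ′ → ∀ x → τ (σ x) ≡ σ (τ′ x)) (shifts prev (suc t)) (shifts prev (suc t))) (Vec.map second σs)
    seconds []       = []
    seconds (x ∷ xs) = ((λ _ → refl) ∷ second-second x) ∷ seconds xs

  cone-walk : ∀ q a → coneΩ q a [] ≈ Wᴱ t (Ω t m) q a (origin t ∷ [])
  cone-walk q a = cone≈W (shifts next t) (shifts prev t) (origin t) (Ω t m) (shifts-inverse t)
    (invariant (shifts-commute t) κ-invariance) q a []
    where
    invariant : ∀ {u} {σs : Vec (El t → El t) u} →
      VAll.All (λ σ → Pointwise (λ τ τ′ → ∀ x → τ (σ x) ≡ σ (τ′ x)) (shifts prev t) (shifts prev t)) σs →
      VAll.All (λ σ → ∀ w → Ω t m (map σ w) ≈ Ω t m w) σs →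
      VAll.All (λ σ → ∀ q a w → Wᴱ t (Ω t m) q a (map σ w) ≈ Wᴱ t (Ω t m) q a w) σs
    invariant []       []       = []
    invariant (c ∷ cs) (h ∷ hs) = W-invariant (shifts prev t) (Ω t m) _ c h ∷ invariant cs hs

  -- Ω vanishes only on tuples with increasing colours, so tuples are sorted by colour before labels
  -- are read. The action keeps colours, hence sorting commutes with ∂ and with G and the equations
  -- of `cone` survive.
  pull : (List (El t) → ℤ) → List V → ℤ
  pull f w = sort colourOrder (λ u → f (map label u)) w

  sort-linear : Linear (sort colourOrder)
  sort-linear = record
    { T-cong = λ h w → sort-cong colourOrder _ _ w (λ u _ _ → h u)
    ; T-add = sort-add colourOrder ; T-sub = sort-sub colourOrder ; T-scale = sort-scale colourOrder }

  X : ℕ → Family (List V) t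
  X q a = pull (coneΩ q a)

  ∂-pull : ∀ f w → ∂ (pull f) w ≈ pull (∂ f) w
  ∂-pull f w = ≈-trans (≈-sym (sort-∂ colourOrder (λ u → f (map label u)) w))
    (sort-cong colourOrder _ _ w (λ u _ _ → ≈-reflexive (∂-map label f u)))

  X-zero : ∀ a w → BoxTuple w → ∂ (X 0 a) w ≈ 0ℤ
  X-zero a w box = begin
    ∂ (pull (coneΩ 0 a)) w   ≈⟨ ∂-pull (coneΩ 0 a) w ⟩
    pull (∂ (coneΩ 0 a)) w   ≈⟨ sort-local colourOrder (_∈ w) _ (λ _ → 0ℤ) w
                                  (λ u mono sub _ → ≈-trans (Contract.cone-zero a (map label u))
                                    (Ω-vanish m u mono (BoxTuple-sub sub box) (All.tabulate (λ {v} _ → Fin.toℕ<n (c (proj₂ v))))))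
                                  (All.tabulate (λ x → x)) ⟩
    sort colourOrder (λ _ → 0ℤ) w ≈⟨ Acyclicity.sort-zero p colourOrder w ⟩
    0ℤ ∎

  X-suc : ∀ q a w → BoxTuple w → ∂ (X (suc q) a) w ≈ D (maps acts) (X q) a w
  X-suc q a w _ = begin
    ∂ (pull (coneΩ (suc q) a)) w                        ≈⟨ ∂-pull (coneΩ (suc q) a) w ⟩
    pull (∂ (coneΩ (suc q) a)) w                        ≈⟨ sort-cong colourOrder _ _ w (λ u _ _ →
                                                             ≈-trans (Contract.cone-suc q a (map label u))
                                                               (≈-reflexive (D-natural (map label) (labels (shifts next t)) (coneΩ q) a u))) ⟩
    sort colourOrder (D (maps acts) (λ a u → coneΩ q a (map label u)) a) w
                                                        ≈⟨ T-D (sort colourOrder) sort-linear (maps acts) (sorts (shifts next t)) _ a w ⟩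
    D (maps acts) (X q) a w                             ∎
    where
    map-label : ∀ σ u → map σ (map label u) ≡ map label (map (act σ) u)
    map-label σ []      = refl
    map-label σ (v ∷ u) = cong₂ _∷_ (sym (label-act σ v)) (map-label σ u)
    labels : ∀ {k} (σs : Vec (El t → El t) k) →
             Pointwise (λ σ τ → ∀ u → σ (map label u) ≡ map label (τ u)) (maps σs) (maps (Vec.map act σs))
    labels []       = []
    labels (σ ∷ σs) = map-label σ ∷ labels σs
    sorts : ∀ {k} (σs : Vec (El t → El t) k) →
            VAll.All (λ σ → ∀ f s → sort colourOrder (λ s → f (σ s)) s ≈ sort colourOrder f (σ s)) (maps (Vec.map act σs))
    sorts []       = []
    sorts (σ ∷ σs) = sort-map colourOrder (act σ) (λ _ _ → refl) ∷ sorts σs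

  -- X (m * R t) at the empty tuple, where sorting does nothing, is evaluated twice: the zigzag
  -- gives zero, `cone-walk` gives the leading coefficient.
  obstruction : ¬ (∀ k → k ≤ m * R t → ReducedCohomologyVanishes p H k)
  obstruction vanishes = leading-nonzero t m (origin t) (≈-trans (≈-sym (cone-walk (m * R t) (leading t m)))
    (Zigzag.zigzag-end acts acts-action BoxTuple BoxTuple-act (m * R t)
      (λ k k≤ → Acyclicity.tuple-acyclic p vertexOrder BoxTuple BoxTuple-sub k (ordered-acyclic k (vanishes k k≤)))
      X X-zero X-suc nil (leading t m)))
    where
    nil : BoxTuple []
    -- The empty tuple meets no copy of the vertex set, and there is at least one copy.
    nil full with full (index (origin t))
    ... | _ , ()

-- The bound on the number of colours.

⌈/⌉-≤ : ∀ a b m → a ≤ m * b → ⌈ a / b ⌉ ≤ m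
⌈/⌉-≤ a zero    m l = z≤n
⌈/⌉-≤ a (suc b) m l = ℕ.s≤s⁻¹ (m<n*o⇒m/o<n {a + b} {suc m} {suc b}
  (ℕ.≤-<-trans (ℕ.+-monoˡ-≤ b l) (subst (m * suc b + b <_) (ℕ.+-comm (m * suc b) (suc b)) (ℕ.+-monoʳ-< (m * suc b) (ℕ.n<1+n b)))))

theorem2 : (p t : ℕ) → Prime p → 1 ≤ t →
    (n : ℕ) (H : Hypergraph n (p ^ t)) →
    (L : ℕ) → (∀ k → k ≤ L → ReducedCohomologyVanishes p H k) →
    (m : ℕ) (c : Fin n → Fin m) → ProperColouring H c →
    ⌈ L + 1 / p ^ t ∸ 1 ⌉ ≤ m
theorem2 zero    t prime-p 1≤t n H L vanishes m c proper = contradiction prime-p Primality.¬prime[0]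
theorem2 (suc P) t prime-p 1≤t n H L vanishes m c proper = ⌈/⌉-≤ (L + 1) (suc P ^ t ∸ 1) m
  (subst (λ r → L + 1 ≤ m * (r ∸ 1)) (sym (TowerEvaluation.R-size P prime-p t))
    (subst (_≤ m * TowerEvaluation.R P prime-p t) (ℕ.+-comm 1 L)
      -- `k` counts vertices, so L stands for ℓ + 1 and the numerator L + 1 is ℓ + 2. If m (r - 1) ≤
      -- L, the hypothesis covers every length that the zigzag visits.
      (ℕ.≰⇒> (λ small → ColouredBox.obstruction P prime-p t n H m c proper
        (λ k k≤ → vanishes k (ℕ.≤-trans k≤ small))))))
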